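{- Let $(V,\Gamma,K)$ be a valued vector space with variable base field $K$ and value set $(\Gamma,<)$ in the language $\mathrm{L}_{W,\lambda}$, and let $(W,\Delta,L)\supseteq(V,\Gamma,K)$ be an extension (of valued vector spaces, in the language $\mathrm{L}_{W,\lambda}$). Then the following are equivalent: - $(W,\Delta,L)\succeq(V,\Gamma,K)$; - $L\succeq K$ as fields and $(\Delta,(E_n)_{n\in\mathbb{N}},<)\succeq(\Gamma,(D_n)_{n\in\mathbb{N}},<)$ as coloured linear orders, where $E_n:=\{\gamma\in\Delta\mid\dim_L(B_\gamma(W))=n\}$ and $D_n:=\{\gamma\in\Gamma\mid\dim_K(B_\gamma(V))=n\}$.
   Context: Valued vector space: $K$ is a field, $V$ a $K$-vector space, $(\Gamma,<,\infty)$ a totally ordered set with last element $\infty$, and $\mathrm{val}:V\to\Gamma$ a surjective map such that $\mathrm{val}(x)=\infty$ iff $x=0$, $\mathrm{val}(x-y)\ge\min(\mathrm{val}(x),\mathrm{val}(y))$, and $\mathrm{val}(kx)=\mathrm{val}(x)$ for all $k\in K\setminus\{0\}$, $x\in V$. For $\gamma\in\Gamma$, $B_\gamma(V)$ is the $K$-vector space $\{x\in V\mid\mathrm{val}(x)\ge\gamma\}/\{x\in V\mid\mathrm{val}(x)>\gamma\}$, with the convention $B_\infty(V)=\{0\}$. $\mathrm{L}_{W,\lambda}:=\{(V,+,0),(K,+,\cdot,0,1),(\Gamma,<,\infty),\mathrm{scal}:K\times V\to V,\mathrm{val}:V\to\Gamma\}\cup\{W_n\subset V^n\}_n\cup\{\lambda_{n,i}:V^{n+1}\to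 K\}_{1\le i\le n}$, where $\mathrm{scal}$ is scalar multiplication. $W_n(v_1,\dots,v_n)$ holds iff the $v_i$ are nonzero, $\mathrm{val}(v_1)=\dots=\mathrm{val}(v_n)$, and for all $k_1,\dots,k_n\in K$, $\mathrm{val}(\sum_ik_iv_i)>\mathrm{val}(v_1)$ implies $k_1=\dots=k_n=0$. If $W_n(v_1,\dots,v_n)$ and $\neg W_{n+1}(v,v_1,\dots,v_n)$, then $(\lambda_{n,i}(v,v_1,\dots,v_n))_{1\le i\le n}$ is the unique tuple in $K$ with $\mathrm{val}(\sum_i\lambda_{n,i}(v,v_1,\dots,v_n)v_i-v)>\mathrm{val}(v)$; all $\lambda_{n,i}$ take the value $0$ when no such tuple exists or the condition fails. -}

module Defs where

open import Algebra.Bundles using (CommutativeMonoid; CommutativeRing; Ring)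
import Algebra.Construct.NaturalChoice.Min as Min
import Algebra.Definitions.RawMonoid as RawMonoidSum
open import Algebra.Module.Bundles using (LeftModule)
import Algebra.Properties.AbelianGroup as AbelianGroupProperties
import Algebra.Properties.CommutativeSemigroup as CommutativeSemigroupProperties
import Algebra.Properties.Monoid.Sum as MonoidSum
open import Axiom.ExcludedMiddle using (ExcludedMiddle)
open import Data.Empty using (⊥; ⊥-elim)
open import Data.Fin.Base using (Fin; zero; suc)
open import Data.List.Base using (List; []; _∷_)
open import Data.List.Membership.Propositional using (_∈_)
open import Data.List.Relation.Unary.All as All using (All; []; _∷_)
open import Data.Nat.Base using (ℕ; zero; suc)
open import Data.Product using (Σ; ∃; ∃!; _×_; _,_; proj₁; proj₂)
open import Data.Sum.Base using (_⊎_; inj₁; inj₂)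
open import Data.Unit.Base using (⊤; tt)
open import Data.Vec.Functional using (Vector; head; tail)
open import Function.Base using (_∘_)
open import Function.Bundles using (_⇔_; mk⇔; Equivalence)
open import Function.Definitions using (Congruent; Surjective)
open import Level using (Level; _⊔_) renaming (suc to lsuc)
open import Relation.Binary.Bundles using (Setoid; StrictTotalOrder; TotalOrder)
open import Relation.Binary.Definitions using (Maximum; tri<; tri≈; tri>)
import Relation.Binary.Properties.StrictTotalOrder as StrictTotalOrderProperties
import Relation.Binary.Reasoning.Setoid as SetoidReasoning
open import Relation.Nullary using (¬_; Dec; yes; no)
open import Relation.Nullary.Decidable using (_⊎-dec_)
open import Relation.Unary using (Pred; Decidable)

------------------------------------------------------------------------
-- Many-sorted first-order logic with equality

record Signature : Set₁ where
  field
    Sort     : Set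
    Fun      : Set
    funArity : Fun → ℕ
    funDom   : (f : Fun) → Fin (funArity f) → Sort
    funCod   : Fun → Sort
    Rel      : Set
    relArity : Rel → ℕ
    relDom   : (r : Rel) → Fin (relArity r) → Sort

module Syntax (S : Signature) where
  open Signature S

  -- The list Γ gives the sorts of the free variables.

  data Term (Γ : List Sort) : Sort → Set where
    var : ∀ {s} → s ∈ Γ → Term Γ s
    app : (f : Fun) → (∀ i → Term Γ (funDom f i)) → Term Γ (funCod f)

  infix  7 _≐_
  infixr 6 _∧′_

  -- Satisfaction is only ever considered in the presence of excluded
  -- middle, so the remaining connectives are abbreviations.

  data Formula (Γ : List Sort) : Set where
    _≐_  : ∀ {s} → Term Γ s → Term Γ s → Formula Γ
    rel  : (r : Rel) → (∀ i → Term Γ (relDom r i)) → Formula Γ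
    ¬′_  : Formula Γ → Formula Γ
    _∧′_ : Formula Γ → Formula Γ → Formula Γ
    ∃′   : ∀ s → Formula (s ∷ Γ) → Formula Γ

-- Sorts are setoids: the symbol for equality is interpreted by the
-- setoid equality of the sort.

record Structure (S : Signature) (ℓ : Level) : Set (lsuc ℓ) where
  open Signature S
  field
    sort : Sort → Setoid ℓ ℓ

  ∣_∣ : Sort → Set ℓ
  ∣ s ∣ = Setoid.Carrier (sort s)

  Eq : ∀ s → ∣ s ∣ → ∣ s ∣ → Set ℓ
  Eq s = Setoid._≈_ (sort s)

  field
    fun      : (f : Fun) → (∀ i → ∣ funDom f i ∣) → ∣ funCod f ∣
    fun-cong : ∀ f {xs ys} → (∀ i → Eq (funDom f i) (xs i) (ys i)) →
               Eq (funCod f) (fun f xs) (fun f ys)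
    rel      : (r : Rel) → (∀ i → ∣ relDom r i ∣) → Set ℓ
    rel-resp : ∀ r {xs ys} → (∀ i → Eq (relDom r i) (xs i) (ys i)) →
               rel r xs → rel r ys

module Semantics {S : Signature} {ℓ : Level} (M : Structure S ℓ) where
  open Signature S using (Sort)
  open Syntax S
  open Structure M using (∣_∣; Eq; fun)

  ⟦_⟧ : ∀ {Γ s} → Term Γ s → All ∣_∣ Γ → ∣ s ∣
  ⟦ var x    ⟧ ρ = All.lookup ρ x
  ⟦ app f ts ⟧ ρ = fun f (λ i → ⟦ ts i ⟧ ρ)

  Sat : ∀ {Γ} → Formula Γ → All ∣_∣ Γ → Set ℓ
  Sat (_≐_ {s} t u) ρ = Eq s (⟦ t ⟧ ρ) (⟦ u ⟧ ρ)
  Sat (rel r ts)    ρ = Structure.rel M r (λ i → ⟦ ts i ⟧ ρ)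
  Sat (¬′ φ)        ρ = ¬ Sat φ ρ
  Sat (φ ∧′ ψ)      ρ = Sat φ ρ × Sat ψ ρ
  Sat (∃′ s φ)      ρ = Σ ∣ s ∣ λ x → Sat φ (x ∷ ρ)

module _ {S : Signature} {ℓ : Level} (M N : Structure S ℓ) where
  open Signature S
  open Syntax S using (Formula)
  private
    module M = Structure M
    module N = Structure N

  -- N ⊇ M, with the inclusion given as an explicit map.

  record Extension : Set ℓ where
    field
      map       : ∀ s → M.∣ s ∣ → N.∣ s ∣
      cong      : ∀ s {x y} → M.Eq s x y → N.Eq s (map s x) (map s y)
      injective : ∀ s {x y} → N.Eq s (map s x) (map s y) → M.Eq s x y
      fun-homo  : ∀ f xs → N.Eq (funCod f) (map (funCod f) (M.fun f xs))
                                           (N.fun f (λ i → map (funDom f i) (xs i)))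
      rel-iff   : ∀ r xs → M.rel r xs ⇔ N.rel r (λ i → map (relDom r i) (xs i))

  -- N ≽ M along the map h.

  Elementary : (∀ s → M.∣ s ∣ → N.∣ s ∣) → Set ℓ
  Elementary h = ∀ {Γ} (φ : Formula Γ) (ρ : All M.∣_∣ Γ) →
    Semantics.Sat M φ ρ ⇔ Semantics.Sat N φ (All.map (λ {s} → h s) ρ)

------------------------------------------------------------------------
-- Fields, dimension, subquotients of modules

record Field (ℓ : Level) : Set (lsuc ℓ) where
  field
    commutativeRing : CommutativeRing ℓ ℓ
  open CommutativeRing commutativeRing public
  field
    1≉0      : ¬ 1# ≈ 0#
    inverses : ∀ x → ¬ x ≈ 0# → ∃ λ y → x * y ≈ 1#

module Linear {ℓ : Level} {R : Ring ℓ ℓ} (M : LeftModule R ℓ ℓ) where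
  open Ring R using (Carrier; _≈_; 0#)
  open LeftModule M

  infixl 6 _-ᴹ_
  _-ᴹ_ : Carrierᴹ → Carrierᴹ → Carrierᴹ
  x -ᴹ y = x +ᴹ (-ᴹ y)

  combination : ∀ {n} → Vector Carrier n → Vector Carrierᴹ n → Carrierᴹ
  combination ks vs = RawMonoidSum.sum +ᴹ-rawMonoid (λ i → ks i *ₗ vs i)

  IsBasis : ∀ {n} → Vector Carrierᴹ n → Set ℓ
  IsBasis {n} b =
    (∀ (ks : Vector Carrier n) → combination ks b ≈ᴹ 0ᴹ → ∀ i → ks i ≈ 0#) ×
    (∀ x → ∃ λ (ks : Vector Carrier n) → combination ks b ≈ᴹ x)

  HasDimension : ℕ → Set ℓ
  HasDimension n = ∃ λ (b : Vector Carrierᴹ n) → IsBasis b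

  combination-cong : ∀ {n} {ks ls : Vector Carrier n} {us vs : Vector Carrierᴹ n} →
    (∀ i → ks i ≈ ls i) → (∀ i → us i ≈ᴹ vs i) → combination ks us ≈ᴹ combination ls vs
  combination-cong ks≈ls us≈vs =
    MonoidSum.sum-cong-≋ +ᴹ-monoid (λ i → *ₗ-cong (ks≈ls i) (us≈vs i))

  record IsSubmodule (P : Pred Carrierᴹ ℓ) : Set ℓ where
    field
      resp  : ∀ {x y} → x ≈ᴹ y → P x → P y
      zero∈ : P 0ᴹ
      sub∈  : ∀ {x y} → P x → P y → P (x -ᴹ y)
      scal∈ : ∀ k {x} → P x → P (k *ₗ x)

  private
    module G = AbelianGroupProperties +ᴹ-abelianGroup
    module C = CommutativeSemigroupProperties
      (CommutativeMonoid.commutativeSemigroup +ᴹ-commutativeMonoid)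
    open SetoidReasoning ≈ᴹ-setoid

  neg-zero : ∀ x → 0ᴹ -ᴹ x ≈ᴹ -ᴹ x
  neg-zero x = +ᴹ-identityˡ (-ᴹ x)

  add-as-sub : ∀ x y → x -ᴹ (0ᴹ -ᴹ y) ≈ᴹ x +ᴹ y
  add-as-sub x y = begin
    x -ᴹ (0ᴹ -ᴹ y)  ≈⟨ +ᴹ-congˡ (-ᴹ‿cong (neg-zero y)) ⟩
    x -ᴹ (-ᴹ y)     ≈⟨ +ᴹ-congˡ (G.⁻¹-involutive y) ⟩
    x +ᴹ y          ∎

  ≈⇒sub≈0 : ∀ {x y} → x ≈ᴹ y → x -ᴹ y ≈ᴹ 0ᴹ
  ≈⇒sub≈0 {x} {y} x≈y = begin
    x -ᴹ y  ≈⟨ +ᴹ-congʳ x≈y ⟩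
    y -ᴹ y  ≈⟨ -ᴹ‿inverseʳ y ⟩
    0ᴹ      ∎

  sub-swap : ∀ x y → 0ᴹ -ᴹ (x -ᴹ y) ≈ᴹ y -ᴹ x
  sub-swap x y = begin
    0ᴹ -ᴹ (x -ᴹ y)         ≈⟨ neg-zero (x -ᴹ y) ⟩
    -ᴹ (x -ᴹ y)            ≈⟨ G.⁻¹-∙-comm x (-ᴹ y) ⟨
    (-ᴹ x) +ᴹ (-ᴹ (-ᴹ y))  ≈⟨ +ᴹ-congˡ (G.⁻¹-involutive y) ⟩
    (-ᴹ x) +ᴹ y            ≈⟨ +ᴹ-comm (-ᴹ x) y ⟩
    y -ᴹ x                 ∎

  sub-chain : ∀ x y z → (x -ᴹ y) +ᴹ (y -ᴹ z) ≈ᴹ x -ᴹ z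
  sub-chain x y z = begin
    (x -ᴹ y) +ᴹ (y -ᴹ z)       ≈⟨ +ᴹ-assoc x (-ᴹ y) (y -ᴹ z) ⟩
    x +ᴹ ((-ᴹ y) +ᴹ (y -ᴹ z))  ≈⟨ +ᴹ-congˡ (+ᴹ-assoc (-ᴹ y) y (-ᴹ z)) ⟨
    x +ᴹ ((-ᴹ y +ᴹ y) -ᴹ z)    ≈⟨ +ᴹ-congˡ (+ᴹ-congʳ (-ᴹ‿inverseˡ y)) ⟩
    x +ᴹ (0ᴹ -ᴹ z)             ≈⟨ +ᴹ-congˡ (neg-zero z) ⟩
    x -ᴹ z                     ∎

  sub-add : ∀ x x′ y y′ → (x -ᴹ x′) +ᴹ (y -ᴹ y′) ≈ᴹ (x +ᴹ y) -ᴹ (x′ +ᴹ y′)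
  sub-add x x′ y y′ = begin
    (x -ᴹ x′) +ᴹ (y -ᴹ y′)            ≈⟨ C.interchange x (-ᴹ x′) y (-ᴹ y′) ⟩
    (x +ᴹ y) +ᴹ ((-ᴹ x′) +ᴹ (-ᴹ y′))  ≈⟨ +ᴹ-congˡ (G.⁻¹-∙-comm x′ y′) ⟩
    (x +ᴹ y) -ᴹ (x′ +ᴹ y′)            ∎

  scal-neg : ∀ k x → k *ₗ (-ᴹ x) ≈ᴹ -ᴹ (k *ₗ x)
  scal-neg k x = G.inverseʳ-unique (k *ₗ x) (k *ₗ (-ᴹ x)) (begin
    (k *ₗ x) +ᴹ (k *ₗ (-ᴹ x))  ≈⟨ *ₗ-distribˡ k x (-ᴹ x) ⟨
    k *ₗ (x -ᴹ x)              ≈⟨ *ₗ-cong (Ring.refl R) (-ᴹ‿inverseʳ x) ⟩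
    k *ₗ 0ᴹ                    ≈⟨ *ₗ-zeroʳ k ⟩
    0ᴹ                         ∎)

  scal-sub : ∀ k l {x y} → k ≈ l → k *ₗ (x -ᴹ y) ≈ᴹ (k *ₗ x) -ᴹ (l *ₗ y)
  scal-sub k l {x} {y} k≈l = begin
    k *ₗ (x -ᴹ y)              ≈⟨ *ₗ-distribˡ k x (-ᴹ y) ⟩
    (k *ₗ x) +ᴹ (k *ₗ (-ᴹ y))  ≈⟨ +ᴹ-congˡ (scal-neg k y) ⟩
    (k *ₗ x) -ᴹ (k *ₗ y)       ≈⟨ +ᴹ-congˡ (-ᴹ‿cong (*ₗ-cong k≈l ≈ᴹ-refl)) ⟩
    (k *ₗ x) -ᴹ (l *ₗ y)       ∎

  -- The quotient P / Q, as the setoid P with equality x - y ∈ Q; it is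
  -- only used for Q ⊆ P, but the construction does not need this.

  module Subquotient {P Q : Pred Carrierᴹ ℓ}
                     (isP : IsSubmodule P) (isQ : IsSubmodule Q) where
    private
      module P = IsSubmodule isP
      module Q = IsSubmodule isQ

      P-neg : ∀ {x} → P x → P (-ᴹ x)
      P-neg {x} p = P.resp (neg-zero x) (P.sub∈ P.zero∈ p)

      P-add : ∀ {x y} → P x → P y → P (x +ᴹ y)
      P-add {x} {y} p q = P.resp (add-as-sub x y) (P.sub∈ p (P.sub∈ P.zero∈ q))

      Q-add : ∀ {x y} → Q x → Q y → Q (x +ᴹ y)
      Q-add {x} {y} p q = Q.resp (add-as-sub x y) (Q.sub∈ p (Q.sub∈ Q.zero∈ q))

      lift : ∀ {x y} → x ≈ᴹ y → Q (x -ᴹ y)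
      lift x≈y = Q.resp (≈ᴹ-sym (≈⇒sub≈0 x≈y)) Q.zero∈

      Q-neg-cong : ∀ {x y} → Q (x -ᴹ y) → Q ((-ᴹ x) -ᴹ (-ᴹ y))
      Q-neg-cong {x} {y} q =
        Q.resp (≈ᴹ-trans (neg-zero (x -ᴹ y)) (≈ᴹ-sym (G.⁻¹-∙-comm x (-ᴹ y))))
               (Q.sub∈ Q.zero∈ q)

    quotient : LeftModule R ℓ ℓ
    quotient = record
      { Carrierᴹ = Σ Carrierᴹ P
      ; _≈ᴹ_     = λ x y → Q (proj₁ x -ᴹ proj₁ y)
      ; _+ᴹ_     = λ x y → proj₁ x +ᴹ proj₁ y , P-add (proj₂ x) (proj₂ y)
      ; _*ₗ_     = λ k x → k *ₗ proj₁ x , P.scal∈ k (proj₂ x)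
      ; 0ᴹ       = 0ᴹ , P.zero∈
      ; -ᴹ_      = λ x → -ᴹ proj₁ x , P-neg (proj₂ x)
      ; isLeftModule = record
        { isLeftSemimodule = record
          { +ᴹ-isCommutativeMonoid = record
            { isMonoid = record
              { isSemigroup = record
                { isMagma = record
                  { isEquivalence = record
                    { refl  = lift ≈ᴹ-refl
                    ; sym   = λ q → Q.resp (sub-swap _ _) (Q.sub∈ Q.zero∈ q)
                    ; trans = λ p q → Q.resp (sub-chain _ _ _) (Q-add p q)
                    }
                  ; ∙-cong = λ p q → Q.resp (sub-add _ _ _ _) (Q-add p q)
                  }
                ; assoc = λ x y z → lift (+ᴹ-assoc _ _ _)
                }
              ; identity = (λ x → lift (+ᴹ-identityˡ _)) , (λ x → lift (+ᴹ-identityʳ _))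
              }
            ; comm = λ x y → lift (+ᴹ-comm _ _)
            }
          ; isPreleftSemimodule = record
            { *ₗ-cong      = λ {k} {l} k≈l q → Q.resp (scal-sub k l k≈l) (Q.scal∈ k q)
            ; *ₗ-zeroˡ     = λ x → lift (*ₗ-zeroˡ _)
            ; *ₗ-distribʳ  = λ x k l → lift (*ₗ-distribʳ _ _ _)
            ; *ₗ-identityˡ = λ x → lift (*ₗ-identityˡ _)
            ; *ₗ-assoc     = λ k l x → lift (*ₗ-assoc _ _ _)
            ; *ₗ-zeroʳ     = λ k → lift (*ₗ-zeroʳ _)
            ; *ₗ-distribˡ  = λ k x y → lift (*ₗ-distribˡ _ _ _)
            }
          }
        ; -ᴹ‿cong    = Q-neg-cong
        ; -ᴹ‿inverse = (λ x → lift (-ᴹ‿inverseˡ _)) , (λ x → lift (-ᴹ‿inverseʳ _))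
        }
      }

------------------------------------------------------------------------
-- Valued vector spaces

record ValuedVectorSpace (ℓ : Level) : Set (lsuc ℓ) where
  field
    K : Field ℓ
    V : LeftModule (Field.ring K) ℓ ℓ
    Γ : StrictTotalOrder ℓ ℓ ℓ

  open Field K public
    using (_+_; _*_; 0#; 1#) renaming (Carrier to Scalar; _≈_ to _≈ᴷ_)
  open LeftModule V public
  open Linear V public using (_-ᴹ_; combination)
  open StrictTotalOrder Γ public
    using (_<_) renaming (Carrier to Value; _≈_ to _≈ⱽ_)
  open TotalOrder (StrictTotalOrderProperties.totalOrder Γ) public using (_≤_)
  open Min (StrictTotalOrderProperties.totalOrder Γ) public using (_⊓_)

  field
    ∞              : Value
    ∞-last         : Maximum _≤_ ∞
    val            : Carrierᴹ → Value
    val-cong       : Congruent _≈ᴹ_ _≈ⱽ_ val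
    val-surjective : Surjective _≈ᴹ_ _≈ⱽ_ val
    val-∞          : ∀ x → val x ≈ⱽ ∞ ⇔ x ≈ᴹ 0ᴹ
    val-sub        : ∀ x y → val x ⊓ val y ≤ val (x -ᴹ y)
    val-scal       : ∀ k x → ¬ k ≈ᴷ 0# → val (k *ₗ x) ≈ⱽ val x

module _ {ℓ : Level} (𝒱 : ValuedVectorSpace ℓ) where
  open ValuedVectorSpace 𝒱
  private
    module Γ = StrictTotalOrder Γ
    module T = TotalOrder (StrictTotalOrderProperties.totalOrder Γ)
    module K = Field K

    <-≤-trans : ∀ {a b c} → a < b → b ≤ c → a < c
    <-≤-trans a<b (inj₁ b<c) = Γ.trans a<b b<c
    <-≤-trans a<b (inj₂ b≈c) = Γ.<-respʳ-≈ b≈c a<b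

    -- Membership in U is decidable, whereas "k is zero" need not be.
    upSet-isSubmodule : {U : Pred Value ℓ} → Decidable U →
      (∀ {a b} → a ≤ b → U a → U b) → U ∞ → Linear.IsSubmodule V (U ∘ val)
    upSet-isSubmodule {U} U? up U∞ = record
      { resp  = λ x≈y → up (inj₂ (val-cong x≈y))
      ; zero∈ = U0
      ; sub∈  = λ {x} {y} p q → up (val-sub x y) (meet (val x) (val y) p q)
      ; scal∈ = scal
      }
      where
      U0 : U (val 0ᴹ)
      U0 = up (inj₂ (Γ.Eq.sym (Equivalence.from (val-∞ 0ᴹ) ≈ᴹ-refl))) U∞

      meet : ∀ a b → U a → U b → U (a ⊓ b)
      meet a b p q with T.total a b
      ... | inj₁ _ = p
      ... | inj₂ _ = q

      scal : ∀ k {x} → U (val x) → U (val (k *ₗ x))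
      scal k {x} p with U? (val (k *ₗ x))
      ... | yes q = q
      ... | no ¬q = up (inj₂ (Γ.Eq.sym (val-scal k x k≉0))) p
        where
        k≉0 : ¬ k ≈ᴷ 0#
        k≉0 k≈0 = ¬q (up (inj₂ (val-cong
          (≈ᴹ-sym (≈ᴹ-trans (*ₗ-cong k≈0 ≈ᴹ-refl) (*ₗ-zeroˡ x))))) U0)

    above : ∀ γ → Linear.IsSubmodule V (λ x → γ ≤ val x)
    above γ = upSet-isSubmodule (λ a → (γ Γ.<? a) ⊎-dec (γ Γ.≟ a))
                                (λ a≤b γ≤a → T.trans γ≤a a≤b) (∞-last γ)

    strictlyAbove : ∀ γ → Linear.IsSubmodule V (λ x → γ ≈ⱽ ∞ ⊎ γ < val x)
    strictlyAbove γ = upSet-isSubmodule {U = λ a → γ ≈ⱽ ∞ ⊎ γ < a}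
      (λ a → (γ Γ.≟ ∞) ⊎-dec (γ Γ.<? a)) up at-∞
      where
      up : ∀ {a b} → a ≤ b → γ ≈ⱽ ∞ ⊎ γ < a → γ ≈ⱽ ∞ ⊎ γ < b
      up a≤b (inj₁ γ≈∞) = inj₁ γ≈∞
      up a≤b (inj₂ γ<a) = inj₂ (<-≤-trans γ<a a≤b)

      at-∞ : γ ≈ⱽ ∞ ⊎ γ < ∞
      at-∞ with ∞-last γ
      ... | inj₁ γ<∞ = inj₂ γ<∞
      ... | inj₂ γ≈∞ = inj₁ γ≈∞

  -- {x | val x ≥ γ} / {x | val x > γ}.  The disjunct γ ≈ ∞ in the
  -- denominator implements the convention that B ∞ is zero.

  B : Value → LeftModule (Field.ring K) ℓ ℓ
  B γ = Linear.Subquotient.quotient V (above γ) (strictlyAbove γ)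

  W : ∀ {n} → Vector Carrierᴹ (suc n) → Set ℓ
  W {n} vs =
    (∀ i → ¬ vs i ≈ᴹ 0ᴹ) ×
    (∀ i j → val (vs i) ≈ⱽ val (vs j)) ×
    (∀ (ks : Vector Scalar (suc n)) →
       val (head vs) < val (combination ks vs) → ∀ i → ks i ≈ᴷ 0#)

  -- ks is the tuple (λᵢ(v , v₁ , … , vₙ))ᵢ for vs = (v , v₁ , … , vₙ),
  -- where n is suc m.

  λ-Case : ∀ {m} → Vector Carrierᴹ (suc (suc m)) → Set ℓ
  λ-Case {m} vs =
    W (tail vs) × ¬ W vs ×
    ∃! (λ (ks ls : Vector Scalar (suc m)) → ∀ i → ks i ≈ᴷ ls i)
       (λ ks → val (head vs) < val (combination ks (tail vs) -ᴹ head vs))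

  λ-value : ExcludedMiddle ℓ → ∀ {m} → Fin (suc m) → Vector Carrierᴹ (suc (suc m)) → Scalar
  λ-value em i vs with em {λ-Case vs}
  ... | yes (_ , _ , ks , _) = ks i
  ... | no  _                = 0#

  comb-cong : ∀ {n} (ks : Vector Scalar n) {us vs : Vector Carrierᴹ n} →
    (∀ i → us i ≈ᴹ vs i) → combination ks us ≈ᴹ combination ks vs
  comb-cong ks us≈vs =
    Linear.combination-cong V {ks = ks} {ls = ks} (λ _ → K.refl) us≈vs

  W-resp : ∀ {n} {us vs : Vector Carrierᴹ (suc n)} → (∀ i → us i ≈ᴹ vs i) → W us → W vs
  W-resp us≈vs (nz , eq , ind) =
      (λ i vi≈0 → nz i (≈ᴹ-trans (us≈vs i) vi≈0))
    , (λ i j → Γ.Eq.trans (val-cong (≈ᴹ-sym (us≈vs i)))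
                          (Γ.Eq.trans (eq i j) (val-cong (us≈vs j))))
    , (λ ks lt → ind ks
         (Γ.<-respˡ-≈ (val-cong (≈ᴹ-sym (us≈vs zero)))
           (Γ.<-respʳ-≈ (val-cong (comb-cong ks (λ i → ≈ᴹ-sym (us≈vs i)))) lt)))

  approx-resp : ∀ {m} {us vs : Vector Carrierᴹ (suc (suc m))} {ks : Vector Scalar (suc m)} →
    (∀ i → us i ≈ᴹ vs i) →
    val (head us) < val (combination ks (tail us) -ᴹ head us) →
    val (head vs) < val (combination ks (tail vs) -ᴹ head vs)
  approx-resp {ks = ks} us≈vs lt =
    Γ.<-respˡ-≈ (val-cong (us≈vs zero))
      (Γ.<-respʳ-≈ (val-cong (+ᴹ-cong
        (comb-cong ks (us≈vs ∘ suc))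
        (-ᴹ‿cong (us≈vs zero)))) lt)

  λ-Case-resp : ∀ {m} {us vs : Vector Carrierᴹ (suc (suc m))} →
    (∀ i → us i ≈ᴹ vs i) → λ-Case us → λ-Case vs
  λ-Case-resp {us = us} {vs} us≈vs (w , ¬w , ks , ap , uniq) =
      W-resp (us≈vs ∘ suc) w
    , (λ w′ → ¬w (W-resp vs≈us w′))
    , ks
    , approx-resp {us = us} {vs} {ks} us≈vs ap
    , (λ {ls} ap′ → uniq {ls} (approx-resp {us = vs} {us} {ls} vs≈us ap′))
    where
    vs≈us : ∀ i → vs i ≈ᴹ us i
    vs≈us i = ≈ᴹ-sym (us≈vs i)

  λ-cong : ∀ (em : ExcludedMiddle ℓ) {m} (i : Fin (suc m)) {us vs : Vector Carrierᴹ (suc (suc m))} →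
    (∀ j → us j ≈ᴹ vs j) → λ-value em i us ≈ᴷ λ-value em i vs
  λ-cong em i {us} {vs} us≈vs with em {λ-Case us} | em {λ-Case vs}
  ... | yes (_ , _ , ks , _ , uniq) | yes (_ , _ , ls , ap , _) =
        uniq {ls} (approx-resp {us = vs} {us} {ls} (λ j → ≈ᴹ-sym (us≈vs j)) ap) i
  ... | yes c | no ¬c = ⊥-elim (¬c (λ-Case-resp us≈vs c))
  ... | no ¬c | yes c = ⊥-elim (¬c (λ-Case-resp (λ j → ≈ᴹ-sym (us≈vs j)) c))
  ... | no _  | no _  = K.refl

  dimension-resp : ∀ n {γ δ} → γ ≈ⱽ δ →
    Linear.HasDimension (B γ) n → Linear.HasDimension (B δ) n
  dimension-resp n {γ} {δ} γ≈δ (b , independent , spanning) =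
    b′ , (λ ks e → independent ks (back (raw δ b′ ks) (raw γ b ks) e)) , span
    where
    δ≤ : ∀ {a} → γ ≤ a → δ ≤ a
    δ≤ γ≤a = T.trans (inj₂ (Γ.Eq.sym γ≈δ)) γ≤a

    γ≤ : ∀ {a} → δ ≤ a → γ ≤ a
    γ≤ δ≤a = T.trans (inj₂ γ≈δ) δ≤a

    b′ : Vector (LeftModule.Carrierᴹ (B δ)) n
    b′ i = proj₁ (b i) , δ≤ (proj₂ (b i))

    raw : ∀ {m} ε (c : Vector (LeftModule.Carrierᴹ (B ε)) m) ks →
      proj₁ (Linear.combination (B ε) ks c) ≈ᴹ combination ks (proj₁ ∘ c)
    raw {zero}  ε c ks = ≈ᴹ-refl
    raw {suc m} ε c ks = +ᴹ-cong ≈ᴹ-refl (raw ε (c ∘ suc) (ks ∘ suc))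

    back : ∀ {x y z t} → x ≈ᴹ t → y ≈ᴹ t →
      δ ≈ⱽ ∞ ⊎ δ < val (x -ᴹ z) → γ ≈ⱽ ∞ ⊎ γ < val (y -ᴹ z)
    back _   _   (inj₁ δ≈∞) = inj₁ (Γ.Eq.trans γ≈δ δ≈∞)
    back x≈t y≈t (inj₂ lt)  = inj₂ (Γ.<-respˡ-≈ (Γ.Eq.sym γ≈δ)
      (Γ.<-respʳ-≈ (val-cong (+ᴹ-cong (≈ᴹ-trans x≈t (≈ᴹ-sym y≈t)) ≈ᴹ-refl)) lt))

    forth : ∀ {x y z t} → x ≈ᴹ t → y ≈ᴹ t →
      γ ≈ⱽ ∞ ⊎ γ < val (x -ᴹ z) → δ ≈ⱽ ∞ ⊎ δ < val (y -ᴹ z)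
    forth _   _   (inj₁ γ≈∞) = inj₁ (Γ.Eq.trans (Γ.Eq.sym γ≈δ) γ≈∞)
    forth x≈t y≈t (inj₂ lt)  = inj₂ (Γ.<-respˡ-≈ γ≈δ
      (Γ.<-respʳ-≈ (val-cong (+ᴹ-cong (≈ᴹ-trans x≈t (≈ᴹ-sym y≈t)) ≈ᴹ-refl)) lt))

    span : ∀ x → ∃ λ ks → LeftModule._≈ᴹ_ (B δ) (Linear.combination (B δ) ks b′) x
    span (x , p) with spanning (x , γ≤ p)
    ... | ks , e = ks , forth (raw γ b ks) (raw δ b′ ks) e

------------------------------------------------------------------------
-- The language of valued vector spaces.  Symbols for tuples are indexed
-- from 0: `W-sym n` is W of arity n + 1, and `λ-sym m i` is λ_{m+1,i}.

data VSort : Set where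
  vector scalar value : VSort

data VFun : Set where
  +ᵛ 0ᵛ +ᵏ *ᵏ 0ᵏ 1ᵏ ∞-sym scal-sym val-sym : VFun
  λ-sym : (m : ℕ) → Fin (suc m) → VFun

data VRel : Set where
  <-sym : VRel
  W-sym : ℕ → VRel

module _ where
  private
    arity : VFun → ℕ
    arity +ᵛ          = 2
    arity 0ᵛ          = 0
    arity +ᵏ          = 2
    arity *ᵏ          = 2
    arity 0ᵏ          = 0
    arity 1ᵏ          = 0
    arity ∞-sym       = 0
    arity scal-sym    = 2
    arity val-sym     = 1
    arity (λ-sym m i) = suc (suc m)

    dom : (f : VFun) → Fin (arity f) → VSort
    dom +ᵛ          _       = vector
    dom 0ᵛ          ()
    dom +ᵏ          _       = scalar
    dom *ᵏ          _       = scalar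
    dom 0ᵏ          ()
    dom 1ᵏ          ()
    dom ∞-sym       ()
    dom scal-sym    zero    = scalar
    dom scal-sym    (suc _) = vector
    dom val-sym     _       = vector
    dom (λ-sym m i) _       = vector

    cod : VFun → VSort
    cod +ᵛ          = vector
    cod 0ᵛ          = vector
    cod +ᵏ          = scalar
    cod *ᵏ          = scalar
    cod 0ᵏ          = scalar
    cod 1ᵏ          = scalar
    cod ∞-sym       = value
    cod scal-sym    = vector
    cod val-sym     = value
    cod (λ-sym m i) = scalar

    relArity : VRel → ℕ
    relArity <-sym     = 2
    relArity (W-sym n) = suc n

    relDom : (r : VRel) → Fin (relArity r) → VSort
    relDom <-sym     _ = value
    relDom (W-sym n) _ = vector

  L-Wλ : Signature
  L-Wλ = record
    { Sort = VSort
    ; Fun  = VFun ; funArity = arity    ; funDom = dom ; funCod = cod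
    ; Rel  = VRel ; relArity = relArity ; relDom = relDom
    }

-- Excluded middle is used only to give λ its value by cases.

valuedStructure : ∀ {ℓ} → ExcludedMiddle ℓ → ValuedVectorSpace ℓ → Structure L-Wλ ℓ
valuedStructure {ℓ} em 𝒱 = record
  { sort = sort ; fun = fun ; fun-cong = fun-cong ; rel = rel ; rel-resp = rel-resp }
  where
  open ValuedVectorSpace 𝒱
  open Signature L-Wλ
  private
    module Γ = StrictTotalOrder Γ
    module K = Field K

  sort : VSort → Setoid ℓ ℓ
  sort vector = ≈ᴹ-setoid
  sort scalar = K.setoid
  sort value  = Γ.Eq.setoid

  fun : (f : VFun) → (∀ i → Setoid.Carrier (sort (funDom f i))) →
        Setoid.Carrier (sort (funCod f))
  fun +ᵛ          xs = xs zero +ᴹ xs (suc zero)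
  fun 0ᵛ          xs = 0ᴹ
  fun +ᵏ          xs = xs zero + xs (suc zero)
  fun *ᵏ          xs = xs zero * xs (suc zero)
  fun 0ᵏ          xs = 0#
  fun 1ᵏ          xs = 1#
  fun ∞-sym       xs = ∞
  fun scal-sym    xs = xs zero *ₗ xs (suc zero)
  fun val-sym     xs = val (xs zero)
  fun (λ-sym m i) xs = λ-value 𝒱 em i xs

  fun-cong : ∀ f {xs ys} → (∀ i → Setoid._≈_ (sort (funDom f i)) (xs i) (ys i)) →
             Setoid._≈_ (sort (funCod f)) (fun f xs) (fun f ys)
  fun-cong +ᵛ          e = +ᴹ-cong (e zero) (e (suc zero))
  fun-cong 0ᵛ          e = ≈ᴹ-refl
  fun-cong +ᵏ          e = K.+-cong (e zero) (e (suc zero))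
  fun-cong *ᵏ          e = K.*-cong (e zero) (e (suc zero))
  fun-cong 0ᵏ          e = K.refl
  fun-cong 1ᵏ          e = K.refl
  fun-cong ∞-sym       e = Γ.Eq.refl
  fun-cong scal-sym    e = *ₗ-cong (e zero) (e (suc zero))
  fun-cong val-sym     e = val-cong (e zero)
  fun-cong (λ-sym m i) e = λ-cong 𝒱 em i e

  rel : (r : VRel) → (∀ i → Setoid.Carrier (sort (relDom r i))) → Set ℓ
  rel <-sym     xs = xs zero < xs (suc zero)
  rel (W-sym n) xs = W 𝒱 xs

  rel-resp : ∀ r {xs ys} → (∀ i → Setoid._≈_ (sort (relDom r i)) (xs i) (ys i)) →
             rel r xs → rel r ys
  rel-resp <-sym     e = λ lt → Γ.<-respˡ-≈ (e zero) (Γ.<-respʳ-≈ (e (suc zero)) lt)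
  rel-resp (W-sym n) e = W-resp 𝒱 e

------------------------------------------------------------------------
-- Fields and coloured linear orders as first-order structures

data FieldFun : Set where
  plus times nought one : FieldFun

module _ where
  private
    arity : FieldFun → ℕ
    arity plus   = 2
    arity times  = 2
    arity nought = 0
    arity one    = 0

  L-field : Signature
  L-field = record
    { Sort = ⊤
    ; Fun  = FieldFun ; funArity = arity ; funDom = λ _ _ → tt ; funCod = λ _ → tt
    ; Rel  = ⊥        ; relArity = λ ()  ; relDom = λ ()
    }

fieldStructure : ∀ {ℓ} → Field ℓ → Structure L-field ℓ
fieldStructure {ℓ} K = record
  { sort = λ _ → setoid ; fun = fun ; fun-cong = fun-cong ; rel = λ () ; rel-resp = λ () }
  where
  open Field K hiding (zero)

  fun : (f : FieldFun) → (Fin (Signature.funArity L-field f) → Carrier) → Carrier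
  fun plus   xs = xs zero + xs (suc zero)
  fun times  xs = xs zero * xs (suc zero)
  fun nought xs = 0#
  fun one    xs = 1#

  fun-cong : ∀ f {xs ys} → (∀ i → xs i ≈ ys i) → fun f xs ≈ fun f ys
  fun-cong plus   e = +-cong (e zero) (e (suc zero))
  fun-cong times  e = *-cong (e zero) (e (suc zero))
  fun-cong nought e = refl
  fun-cong one    e = refl

data OrderRel : Set where
  less   : OrderRel
  colour : ℕ → OrderRel

module _ where
  private
    arity : OrderRel → ℕ
    arity less       = 2
    arity (colour n) = 1

  L-colouredOrder : Signature
  L-colouredOrder = record
    { Sort = ⊤
    ; Fun  = ⊥        ; funArity = λ ()  ; funDom = λ () ; funCod = λ ()
    ; Rel  = OrderRel ; relArity = arity ; relDom = λ _ _ → tt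
    }

-- The domain is the whole value set, including ∞.

colouredOrder : ∀ {ℓ} → ValuedVectorSpace ℓ → Structure L-colouredOrder ℓ
colouredOrder {ℓ} 𝒱 = record
  { sort = λ _ → Γ.Eq.setoid ; fun = λ () ; fun-cong = λ () ; rel = rel ; rel-resp = rel-resp }
  where
  open ValuedVectorSpace 𝒱
  private
    module Γ = StrictTotalOrder Γ

  rel : (r : OrderRel) → (Fin (Signature.relArity L-colouredOrder r) → Value) → Set ℓ
  rel less       xs = xs zero < xs (suc zero)
  rel (colour n) xs = Linear.HasDimension (B 𝒱 (xs zero)) n

  rel-resp : ∀ r {xs ys} → (∀ i → xs i ≈ⱽ ys i) → rel r xs → rel r ys
  rel-resp less       e = λ lt → Γ.<-respˡ-≈ (e zero) (Γ.<-respʳ-≈ (e (suc zero)) lt)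
  rel-resp (colour n) e = dimension-resp 𝒱 n (e zero)

{-# OPTIONS --safe #-}

-- A tuple b of nonzero vectors is separated if, for all scalars kᵢ, val (Σ kᵢ bᵢ)
-- is the minimum of the val bᵢ with kᵢ ≠ 0.  Every vector x can be written as Σ kᵢ bᵢ + r with r = 0
-- or (r , b) separated, and an r of value γ with (r , b) separated exists iff
-- dim B γ is not the number of the bᵢ of value γ.  Hence, if vectors are
-- described by their coordinates in a separated basis, a quantifier over
-- vectors becomes quantifiers over scalars and values, and every formula
-- becomes a formula about the field K and the coloured order Γ, which do not
-- interact.  This translation is uniform in the valued vector space, and an
-- extension preserves separated tuples because it preserves W; so V ≼ W follows
-- from K ≼ L and Γ ≼ Δ.  Conversely, the colours are definable by means of W.

module Submission where

open import Defs
open import Algebra.Bundles using (CommutativeMonoid)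
import Algebra.Construct.NaturalChoice.Min as Min
open import Algebra.Module.Bundles using (LeftModule)
import Algebra.Properties.AbelianGroup as AbelianGroupProperties
import Algebra.Properties.CommutativeSemigroup as CommutativeSemigroupProperties
import Algebra.Properties.Ring as RingProperties
open import Axiom.ExcludedMiddle using (ExcludedMiddle)
open import Data.Empty using (⊥; ⊥-elim)
open import Data.Fin.Base using (Fin; zero; suc)
open import Data.Fin.Properties using (∀-cons)
open import Data.List.Base using (List; []; _∷_; _++_; cartesianProductWith) renaming (map to mapList)
open import Data.List.Membership.Propositional using (_∈_)
open import Data.List.Membership.Propositional.Properties using (∈-map⁺)
open import Data.List.Relation.Unary.All as All using (All; []; _∷_)
open import Data.List.Relation.Unary.All.Properties using (lookup-map; map⁺)
open import Data.List.Relation.Unary.Any as Any using (Any; here; there)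
import Data.List.Relation.Unary.Any.Properties as AnyP
open import Data.Nat.Base using (ℕ; zero; suc) renaming (_+_ to _+ℕ_)
open import Data.Nat.Properties using (+-suc; +-identityʳ)
open import Data.Product.Base using (Σ; ∃; _×_; _,_; proj₁; proj₂)
open import Data.Product.Function.NonDependent.Propositional using (_×-⇔_)
open import Data.Sum.Base as Sum using (_⊎_; inj₁; inj₂)
open import Data.Sum.Function.Propositional using (_⊎-⇔_)
import Data.Unit.Base as Unit
open import Data.Unit.Polymorphic.Base using (⊤; tt)
open import Data.Vec.Functional using (Vector; head; tail) renaming (_∷_ to _◃_)
open import Function.Base using (_∘_; id)
open import Function.Bundles using (_⇔_; mk⇔; Equivalence)
import Function.Properties.Equivalence as ⇔
open import Level using (Level) renaming (suc to lsuc)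
open import Relation.Binary.Bundles using (Setoid; StrictTotalOrder; TotalOrder)
open import Relation.Binary.Definitions using (tri<; tri≈; tri>)
import Relation.Binary.Properties.StrictTotalOrder as StrictTotalOrderProperties
open import Relation.Binary.PropositionalEquality.Core using (_≡_; refl; subst; sym; trans; cong)
import Relation.Binary.Reasoning.Setoid as SetoidReasoning
open import Relation.Nullary using (¬_; yes; no)
open import Relation.Nullary.Decidable using (decidable-stable)
open import Relation.Unary using (Pred)

-- Linear algebra

-- An infinite-dimensional `V` need not have a separated basis, but a formula meets only finitely
-- many vectors at a time: an environment is described over a finite separated tuple, and each
-- vector quantifier enlarges it by at most one vector. Hence `dim B γ` is only ever compared with a
-- count of finitely many basis vectors, and the finite colours suffice even where `B γ` is
-- infinite-dimensional. Witnesses found in the extension need not come from the smaller space. A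
-- syntactic translation, correct in each space separately, avoids lifting them, so neither
-- saturation nor a back-and-forth argument occurs. The two hypotheses are combined as in the
-- Feferman-Vaught theorem: a formula about the pair (K, Γ) is brought into a form in which each
-- hypothesis acts on its own component. The symbols `W` and `λ` are expanded by their definitions,
-- whose quantifiers range over scalars only.

data Thinning : ℕ → ℕ → Set where
  done : Thinning zero zero
  keep : ∀ {k n} → Thinning k n → Thinning (suc k) (suc n)
  skip : ∀ {k n} → Thinning k n → Thinning k (suc n)

select : ∀ {k n} → Thinning k n → Fin k → Fin n
select (keep t) zero    = zero
select (keep t) (suc j) = suc (select t j)
select (skip t) j       = suc (select t j)

-- The image of the thinning is exactly `P`, so `k` is the cardinality of `P`. With `P` the set of
-- basis vectors of a given value, `k` is the number to compare with a colour.
Picks : ∀ {ℓ k n} → Thinning k n → Pred (Fin n) ℓ → Set ℓ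
Picks done     P = ⊤
Picks (keep t) P = P zero × Picks t (P ∘ suc)
Picks (skip t) P = ¬ P zero × Picks t (P ∘ suc)

picked : ∀ {ℓ k n} (t : Thinning k n) {P : Pred (Fin n) ℓ} → Picks t P → ∀ j → P (select t j)
picked (keep t) (p , pk) zero    = p
picked (keep t) (p , pk) (suc j) = picked t pk j
picked (skip t) (_ , pk) j       = picked t pk j

picks-resp : ∀ {ℓ k n} (t : Thinning k n) {P Q : Pred (Fin n) ℓ} →
  (∀ i → P i → Q i) → (∀ i → Q i → P i) → Picks t P → Picks t Q
picks-resp done     f g pk        = tt
picks-resp (keep t) f g (p , pk)  = f zero p , picks-resp t (f ∘ suc) (g ∘ suc) pk
picks-resp (skip t) f g (¬p , pk) = ¬p ∘ g zero , picks-resp t (f ∘ suc) (g ∘ suc) pk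

thinning : ∀ {ℓ} → ExcludedMiddle ℓ → ∀ {n} (P : Pred (Fin n) ℓ) →
  ∃ λ k → Σ (Thinning k n) λ t → Picks t P
thinning em {zero}  P = zero , done , tt
thinning em {suc n} P with thinning em (P ∘ suc) | em {P zero}
... | k , t , pk | yes p = suc k , keep t , p , pk
... | k , t , pk | no ¬p = k , skip t , ¬p , pk

module LinearAlgebra {ℓ : Level} (em : ExcludedMiddle ℓ)
                     (K : Field ℓ) (M : LeftModule (Field.ring K) ℓ ℓ) where
  open Field K using (Carrier; _≈_; _+_; _*_; -_; 0#; 1#; 1≉0; inverses)
  private module K = Field K
  open LeftModule M
  open Linear M
  private
    module R = RingProperties K.ring
    module C = CommutativeSemigroupProperties
      (CommutativeMonoid.commutativeSemigroup +ᴹ-commutativeMonoid)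
    open SetoidReasoning ≈ᴹ-setoid

  Nonzero : ∀ {n} → Vector Carrier n → Set ℓ
  Nonzero ks = ∃ λ i → ¬ ks i ≈ 0#

  Spans : ∀ {n} → Vector Carrierᴹ n → Carrierᴹ → Set ℓ
  Spans {n} b x = ∃ λ (ks : Vector Carrier n) → combination ks b ≈ᴹ x

  Independent : ∀ {n} → Vector Carrierᴹ n → Set ℓ
  Independent {n} b = ∀ (ks : Vector Carrier n) → combination ks b ≈ᴹ 0ᴹ → ∀ i → ks i ≈ 0#

  combination-congˡ : ∀ {n} {ks ls : Vector Carrier n} {b : Vector Carrierᴹ n} →
    (∀ i → ks i ≈ ls i) → combination ks b ≈ᴹ combination ls b
  combination-congˡ {b = b} e = combination-cong {us = b} e (λ _ → ≈ᴹ-refl)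

  combination-+ : ∀ {n} (ks ls : Vector Carrier n) (b : Vector Carrierᴹ n) →
    combination (λ i → ks i + ls i) b ≈ᴹ combination ks b +ᴹ combination ls b
  combination-+ {zero}  ks ls b = ≈ᴹ-sym (+ᴹ-identityˡ 0ᴹ)
  combination-+ {suc n} ks ls b = ≈ᴹ-trans
    (+ᴹ-cong (*ₗ-distribʳ (head b) (head ks) (head ls)) (combination-+ (tail ks) (tail ls) (tail b)))
    (C.interchange _ _ _ _)

  combination-* : ∀ {n} k (ks : Vector Carrier n) (b : Vector Carrierᴹ n) →
    combination (λ i → k * ks i) b ≈ᴹ k *ₗ combination ks b
  combination-* {zero}  k ks b = ≈ᴹ-sym (*ₗ-zeroʳ k)
  combination-* {suc n} k ks b = ≈ᴹ-trans
    (+ᴹ-cong (*ₗ-assoc k (head ks) (head b)) (combination-* k (tail ks) (tail b)))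
    (≈ᴹ-sym (*ₗ-distribˡ k _ _))

  combination-neg : ∀ {n} (ks : Vector Carrier n) (b : Vector Carrierᴹ n) →
    combination (λ i → - 1# * ks i) b ≈ᴹ -ᴹ combination ks b
  combination-neg ks b = begin
    combination (λ i → - 1# * ks i) b  ≈⟨ combination-* (- 1#) ks b ⟩
    - 1# *ₗ x                          ≈⟨ G.inverseʳ-unique x (- 1# *ₗ x) (begin
      x +ᴹ - 1# *ₗ x            ≈⟨ +ᴹ-congʳ (*ₗ-identityˡ x) ⟨
      1# *ₗ x +ᴹ - 1# *ₗ x      ≈⟨ *ₗ-distribʳ x 1# (- 1#) ⟨
      (1# + - 1#) *ₗ x          ≈⟨ *ₗ-cong (K.-‿inverseʳ 1#) ≈ᴹ-refl ⟩
      0# *ₗ x                   ≈⟨ *ₗ-zeroˡ x ⟩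
      0ᴹ                        ∎) ⟩
    -ᴹ x                               ∎
    where
    x = combination ks b
    module G = AbelianGroupProperties +ᴹ-abelianGroup

  combination-zero : ∀ {n} {ks : Vector Carrier n} (b : Vector Carrierᴹ n) →
    (∀ i → ks i ≈ 0#) → combination ks b ≈ᴹ 0ᴹ
  combination-zero {zero}  b e = ≈ᴹ-refl
  combination-zero {suc n} b e = ≈ᴹ-trans
    (+ᴹ-cong (≈ᴹ-trans (*ₗ-cong (e zero) ≈ᴹ-refl) (*ₗ-zeroˡ _)) (combination-zero (tail b) (e ∘ suc)))
    (+ᴹ-identityˡ 0ᴹ)

  combination-head≈0 : ∀ {n} (ks : Vector Carrier (suc n)) (b : Vector Carrierᴹ (suc n)) →
    head ks ≈ 0# → combination ks b ≈ᴹ combination (tail ks) (tail b)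
  combination-head≈0 ks b e = ≈ᴹ-trans
    (+ᴹ-congʳ (≈ᴹ-trans (*ₗ-cong e ≈ᴹ-refl) (*ₗ-zeroˡ _))) (+ᴹ-identityˡ _)

  combination-head≈1 : ∀ {n} (ks : Vector Carrier (suc n)) (b : Vector Carrierᴹ (suc n)) →
    head ks ≈ 1# → combination ks b ≈ᴹ head b +ᴹ combination (tail ks) (tail b)
  combination-head≈1 ks b e = +ᴹ-congʳ (≈ᴹ-trans (*ₗ-cong e ≈ᴹ-refl) (*ₗ-identityˡ _))

  -- Only the existence of `s` matters: in `eliminate` it becomes the coefficient of the pivot `z`,
  -- while the unchanged `ks` witness that the relation stays nontrivial.
  combination-shift : ∀ {n} (ks m : Vector Carrier n) (y : Vector Carrierᴹ n) z →
    ∃ λ s → combination ks (λ j → y j +ᴹ m j *ₗ z) ≈ᴹ s *ₗ z +ᴹ combination ks y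
  combination-shift {zero} ks m y z = 0# , ≈ᴹ-sym (≈ᴹ-trans (+ᴹ-identityʳ _) (*ₗ-zeroˡ z))
  combination-shift {suc n} ks m y z with combination-shift (tail ks) (tail m) (tail y) z
  ... | s , e = k * m₀ + s , (begin
    k *ₗ (y₀ +ᴹ m₀ *ₗ z) +ᴹ combination (tail ks) (λ j → tail y j +ᴹ tail m j *ₗ z)
      ≈⟨ +ᴹ-cong (*ₗ-distribˡ k y₀ (m₀ *ₗ z)) e ⟩
    (k *ₗ y₀ +ᴹ k *ₗ m₀ *ₗ z) +ᴹ (s *ₗ z +ᴹ rest)
      ≈⟨ +ᴹ-congʳ (+ᴹ-comm _ _) ⟩
    (k *ₗ m₀ *ₗ z +ᴹ k *ₗ y₀) +ᴹ (s *ₗ z +ᴹ rest)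
      ≈⟨ C.interchange _ _ _ _ ⟩
    (k *ₗ m₀ *ₗ z +ᴹ s *ₗ z) +ᴹ (k *ₗ y₀ +ᴹ rest)
      ≈⟨ +ᴹ-congʳ (+ᴹ-congʳ (*ₗ-assoc k m₀ z)) ⟨
    ((k * m₀) *ₗ z +ᴹ s *ₗ z) +ᴹ (k *ₗ y₀ +ᴹ rest)
      ≈⟨ +ᴹ-congʳ (*ₗ-distribʳ z (k * m₀) s) ⟨
    (k * m₀ + s) *ₗ z +ᴹ (k *ₗ y₀ +ᴹ rest) ∎)
    where
    k = head ks
    m₀ = head m
    y₀ = head y
    rest = combination (tail ks) (tail y)

  add∈ : ∀ {P : Pred Carrierᴹ ℓ} → IsSubmodule P → ∀ {x y} → P x → P y → P (x +ᴹ y)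
  add∈ isP {x} {y} p q = resp (add-as-sub x y) (sub∈ p (sub∈ zero∈ q))
    where open IsSubmodule isP

  combination∈ : ∀ {P : Pred Carrierᴹ ℓ} → IsSubmodule P → ∀ {n} (ks : Vector Carrier n) b →
    (∀ i → P (ks i *ₗ b i)) → P (combination ks b)
  combination∈ isP {zero}  ks b p = IsSubmodule.zero∈ isP
  combination∈ isP {suc n} ks b p =
    add∈ isP (p zero) (combination∈ isP (tail ks) (tail b) (p ∘ suc))

  -- Gaussian elimination, dependence and dimension

  Eliminated : ∀ {n m} → Vector Carrierᴹ n → Vector Carrierᴹ m → Set ℓ
  Eliminated {n} {m} x′ x = ∀ (ks : Vector Carrier n) → ∃ λ (ls : Vector Carrier m) →
    combination ks x′ ≈ᴹ combination ls x × (Nonzero ks → Nonzero ls)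

  -- One column of Gaussian elimination. The first vector with nonzero coordinate along `head b` is
  -- the pivot: it is dropped, and the later vectors are cleared by multiples of it. If no pivot
  -- turns up before the last vector, that one is dropped.
  eliminate : ∀ {k} (b : Vector Carrierᴹ (suc k)) {n} (x : Vector Carrierᴹ (suc n)) →
    (∀ j → Spans b (x j)) →
    ∃ λ (x′ : Vector Carrierᴹ n) → (∀ j → Spans (tail b) (x′ j)) × Eliminated x′ x
  eliminate b {zero} x sp = (λ ()) , (λ ()) ,
    λ ks → (λ _ → 0#) , ≈ᴹ-sym (combination-zero x (λ _ → K.refl)) , λ { (() , _) }
  eliminate b {suc n} x sp with em {proj₁ (sp zero) zero ≈ 0#}
  ... | yes a≈0 = (head x ◃ x′)
      , (λ { zero → tail (proj₁ (sp zero))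
                  , ≈ᴹ-trans (≈ᴹ-sym (combination-head≈0 (proj₁ (sp zero)) b a≈0)) (proj₂ (sp zero))
           ; (suc j) → sp′ j })
      , λ ks → let ls , e , nz = lifts (tail ks) in
          (head ks ◃ ls) , +ᴹ-congˡ e ,
          λ { (zero , p) → zero , p
            ; (suc i , p) → let j , q = nz (i , p) in suc j , q }
    where
    rec = eliminate b (tail x) (sp ∘ suc)
    x′ = proj₁ rec
    sp′ = proj₁ (proj₂ rec)
    lifts = proj₂ (proj₂ rec)
  ... | no a≉0 = x′ , sp′ , λ ks →
      let s , e = combination-shift ks m (tail x) (head x) in
      (s ◃ ks) , e , λ { (i , p) → suc i , p }
    where
    a = proj₁ (sp zero)
    c = proj₁ (inverses (head a) a≉0)
    -- The multiple of the pivot `x zero` that cancels the coordinate along `head b`; `c` inverts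
    -- the coordinate of the pivot.
    m : Vector Carrier (suc n)
    m j = - (head (proj₁ (sp (suc j))) * c)
    x′ : Vector Carrierᴹ (suc n)
    x′ j = x (suc j) +ᴹ m j *ₗ x zero
    head≈0 : ∀ j → head (proj₁ (sp (suc j))) + m j * head a ≈ 0#
    head≈0 j = let d = head (proj₁ (sp (suc j))) in K.trans
      (K.+-congˡ (K.trans (K.sym (R.-‿distribˡ-* (d * c) (head a)))
        (K.-‿cong (K.trans (K.*-assoc d c (head a))
          (K.trans (K.*-congˡ (K.trans (K.*-comm c (head a)) (proj₂ (inverses (head a) a≉0))))
            (K.*-identityʳ d))))))
      (K.-‿inverseʳ d)
    sp′ : ∀ j → Spans (tail b) (x′ j)
    sp′ j = let d = proj₁ (sp (suc j)) ; f = λ i → d i + m j * a i in tail f , (begin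
      combination (tail f) (tail b)     ≈⟨ combination-head≈0 f b (head≈0 j) ⟨
      combination f b                   ≈⟨ combination-+ d (λ i → m j * a i) b ⟩
      combination d b +ᴹ combination (λ i → m j * a i) b
        ≈⟨ +ᴹ-cong (proj₂ (sp (suc j)))
                   (≈ᴹ-trans (combination-* (m j) a b) (*ₗ-cong K.refl (proj₂ (sp zero)))) ⟩
      x′ j                              ∎)

  -- Each elimination removes one spanning vector and one of the `x`. At the end a single vector
  -- spanned by nothing is left; it is zero, and its trivial relation with coefficient 1 lifts back.
  dependent : ∀ {k} (b : Vector Carrierᴹ k) (x : Vector Carrierᴹ (suc k)) →
    (∀ j → Spans b (x j)) → ∃ λ ks → combination ks x ≈ᴹ 0ᴹ × Nonzero ks
  dependent {zero} b x sp = (λ _ → 1#)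
    , ≈ᴹ-trans (+ᴹ-identityʳ _) (≈ᴹ-trans (*ₗ-identityˡ _) (≈ᴹ-sym (proj₂ (sp zero))))
    , zero , 1≉0
  dependent {suc k} b x sp =
    let x′ , sp′ , lifts = eliminate b x sp
        ks , e , nz = dependent (tail b) x′ sp′
        ls , e′ , nz′ = lifts ks
    in ls , ≈ᴹ-trans (≈ᴹ-sym e′) e , nz′ nz

  ¬independent : ∀ {k} → HasDimension k → (x : Vector Carrierᴹ (suc k)) → ¬ Independent x
  ¬independent (b , _ , spanning) x ind =
    let ks , e , i , nz = dependent b x (spanning ∘ x) in nz (ind ks e i)

  -- If `b` spanned, it would be a basis of length `k`. A vector `x` outside the span can be added,
  -- since a relation with nonzero coefficient at `x` could be solved for `x`. Infinite dimension is
  -- covered as well.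
  ¬dimension⇒extend : ∀ {k} (b : Vector Carrierᴹ k) → Independent b → ¬ HasDimension k →
    ∃ λ x → Independent (x ◃ b)
  ¬dimension⇒extend b ind ¬dim with em {∃ λ x → ¬ Spans b x}
  ... | no all = ⊥-elim (¬dim (b , ind , spanning))
    where
    spanning : ∀ x → Spans b x
    spanning x with em {Spans b x}
    ... | yes p = p
    ... | no ¬p = ⊥-elim (all (x , ¬p))
  ... | yes (x , ¬spans) = x , ind′
    where
    ind′ : Independent (x ◃ b)
    ind′ ks e with em {head ks ≈ 0#}
    ... | yes k≈0 = λ { zero → k≈0
                      ; (suc i) → ind (tail ks) (≈ᴹ-trans (≈ᴹ-sym (combination-head≈0 ks (x ◃ b) k≈0)) e) i }
    ... | no k≉0 = ⊥-elim (¬spans ((λ i → - 1# * (c * tail ks i)) , (begin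
      combination (λ i → - 1# * (c * tail ks i)) b   ≈⟨ combination-neg (λ i → c * tail ks i) b ⟩
      -ᴹ y                                           ≈⟨ G.inverseˡ-unique x y (begin
        x +ᴹ y                                  ≈⟨ combination-head≈1 ls (x ◃ b) ck≈1 ⟨
        combination ls (x ◃ b)                  ≈⟨ combination-* c ks (x ◃ b) ⟩
        c *ₗ combination ks (x ◃ b)             ≈⟨ *ₗ-cong K.refl e ⟩
        c *ₗ 0ᴹ                                 ≈⟨ *ₗ-zeroʳ c ⟩
        0ᴹ                                      ∎) ⟨
      x                                              ∎)))
      where
      module G = AbelianGroupProperties +ᴹ-abelianGroup
      c = proj₁ (inverses (head ks) k≉0)
      ck≈1 = K.trans (K.*-comm c (head ks)) (proj₂ (inverses (head ks) k≉0))
      ls = λ i → c * ks i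
      y = combination (tail ls) b

  unit : ∀ {n} → Fin n → Vector Carrier n
  unit zero    = 1# ◃ λ _ → 0#
  unit (suc i) = 0# ◃ unit i

  unit-diagonal : ∀ {n} (i : Fin n) → unit i i ≈ 1#
  unit-diagonal zero    = K.refl
  unit-diagonal (suc i) = unit-diagonal i

  combination-unit : ∀ {n} (b : Vector Carrierᴹ n) i → combination (unit i) b ≈ᴹ b i
  combination-unit b zero = ≈ᴹ-trans (combination-head≈1 (unit zero) b K.refl)
    (≈ᴹ-trans (+ᴹ-congˡ (combination-zero (tail b) (λ _ → K.refl))) (+ᴹ-identityʳ _))
  combination-unit b (suc i) =
    ≈ᴹ-trans (combination-head≈0 (unit (suc i)) b K.refl) (combination-unit (tail b) i)

  extendByZero : ∀ {k n} → Thinning k n → Vector Carrier k → Vector Carrier n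
  extendByZero done     ls = ls
  extendByZero (keep t) ls = head ls ◃ extendByZero t (tail ls)
  extendByZero (skip t) ls = 0# ◃ extendByZero t ls

  extendByZero-select : ∀ {k n} (t : Thinning k n) ls j → extendByZero t ls (select t j) ≡ ls j
  extendByZero-select (keep t) ls zero    = refl
  extendByZero-select (keep t) ls (suc j) = extendByZero-select t (tail ls) j
  extendByZero-select (skip t) ls j       = extendByZero-select t ls j

  combination-extendByZero : ∀ {k n} (t : Thinning k n) ls (b : Vector Carrierᴹ n) →
    combination (extendByZero t ls) b ≈ᴹ combination ls (b ∘ select t)
  combination-extendByZero done     ls b = ≈ᴹ-refl
  combination-extendByZero (keep t) ls b = +ᴹ-congˡ (combination-extendByZero t (tail ls) (tail b))
  combination-extendByZero (skip t) ls b = ≈ᴹ-trans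
    (combination-head≈0 (extendByZero (skip t) ls) b K.refl)
    (combination-extendByZero t ls (tail b))

  -- To be used with `Q` the vectors of value above `γ` and `P` the positions of value `γ`: modulo
  -- `Q` only these positions count.
  combination-select : ∀ {k n} {t : Thinning k n} {P : Pred (Fin n) ℓ} → Picks t P →
    ∀ {Q : Pred Carrierᴹ ℓ} → IsSubmodule Q → ∀ ks b → (∀ i → ¬ P i → Q (ks i *ₗ b i)) →
    ∃ λ z → Q z × combination ks b ≈ᴹ combination (ks ∘ select t) (b ∘ select t) +ᴹ z
  combination-select {t = done}   pk isQ ks b q = 0ᴹ , IsSubmodule.zero∈ isQ , ≈ᴹ-sym (+ᴹ-identityʳ _)
  combination-select {t = keep t} (_ , pk) isQ ks b q
    with combination-select {t = t} pk isQ (tail ks) (tail b) (q ∘ suc)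
  ... | z , Qz , e = z , Qz , ≈ᴹ-trans (+ᴹ-congˡ e) (≈ᴹ-sym (+ᴹ-assoc _ _ z))
  combination-select {t = skip t} (¬p , pk) isQ ks b q
    with combination-select {t = t} pk isQ (tail ks) (tail b) (q ∘ suc)
  ... | z , Qz , e = head ks *ₗ head b +ᴹ z , add∈ isQ (q zero ¬p) Qz ,
    ≈ᴹ-trans (+ᴹ-congˡ e) (C.x∙yz≈y∙xz _ _ z)

-- Separated tuples

module Valuation {ℓ : Level} (em : ExcludedMiddle ℓ) (𝒱 : ValuedVectorSpace ℓ) where
  open ValuedVectorSpace 𝒱
  open Linear V using (IsSubmodule)
  open LinearAlgebra em K V
  module K = Field K
  module T = TotalOrder (StrictTotalOrderProperties.totalOrder Γ)
  private module Γ = StrictTotalOrder Γ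
  open Min (StrictTotalOrderProperties.totalOrder Γ) using (x≤y⇒x⊓y≈x; x≤y⇒y⊓x≈x)
  module G = AbelianGroupProperties +ᴹ-abelianGroup
  open SetoidReasoning ≈ᴹ-setoid

  <-≤-trans : ∀ {α β γ} → α < β → β ≤ γ → α < γ
  <-≤-trans α<β (inj₁ β<γ) = Γ.trans α<β β<γ
  <-≤-trans α<β (inj₂ β≈γ) = Γ.<-respʳ-≈ β≈γ α<β

  ≤-<-trans : ∀ {α β γ} → α ≤ β → β < γ → α < γ
  ≤-<-trans (inj₁ α<β) β<γ = Γ.trans α<β β<γ
  ≤-<-trans (inj₂ α≈β) β<γ = Γ.<-respˡ-≈ (Γ.Eq.sym α≈β) β<γ

  ≮⇒≥ : ∀ {α β} → ¬ α < β → β ≤ α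
  ≮⇒≥ {α} {β} α≮β with Γ.compare α β
  ... | tri< α<β _ _ = ⊥-elim (α≮β α<β)
  ... | tri≈ _ α≈β _ = inj₂ (Γ.Eq.sym α≈β)
  ... | tri> _ _ β<α = inj₁ β<α

  ≤⇒≯ : ∀ {α β} → α ≤ β → ¬ β < α
  ≤⇒≯ α≤β β<α = Γ.irrefl Γ.Eq.refl (≤-<-trans α≤β β<α)

  <⇒≉∞ : ∀ {α β} → α < β → ¬ α ≈ⱽ ∞
  <⇒≉∞ {β = β} α<β α≈∞ = ≤⇒≯ (∞-last β) (Γ.<-respˡ-≈ α≈∞ α<β)

  upSet-isSubmodule : {U : Pred Value ℓ} → (∀ {α β} → α ≤ β → U α → U β) → U ∞ →
    IsSubmodule (U ∘ val)
  upSet-isSubmodule {U} up U∞ = record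
    { resp  = λ x≈y → up (inj₂ (val-cong x≈y))
    ; zero∈ = U0
    ; sub∈  = λ {x} {y} p q → up (val-sub x y) (meet (T.total (val x) (val y)) p q)
    ; scal∈ = scal
    }
    where
    U0 : U (val 0ᴹ)
    U0 = up (inj₂ (Γ.Eq.sym (Equivalence.from (val-∞ 0ᴹ) ≈ᴹ-refl))) U∞
    meet : ∀ {α β} → α ≤ β ⊎ β ≤ α → U α → U β → U (α ⊓ β)
    meet (inj₁ α≤β) p q = up (inj₂ (Γ.Eq.sym (x≤y⇒x⊓y≈x α≤β))) p
    meet (inj₂ β≤α) p q = up (inj₂ (Γ.Eq.sym (x≤y⇒y⊓x≈x β≤α))) q
    scal : ∀ k {x} → U (val x) → U (val (k *ₗ x))
    scal k {x} p with em {k ≈ᴷ 0#}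
    ... | no k≉0 = up (inj₂ (Γ.Eq.sym (val-scal k x k≉0))) p
    ... | yes k≈0 = up (inj₂ (val-cong
      (≈ᴹ-sym (≈ᴹ-trans (*ₗ-cong k≈0 ≈ᴹ-refl) (*ₗ-zeroˡ x))))) U0

  above : ∀ γ → IsSubmodule (λ x → γ ≤ val x)
  above γ = upSet-isSubmodule (λ α≤β γ≤α → T.trans γ≤α α≤β) (∞-last γ)

  -- Agrees by computation with the denominator of `B 𝒱 γ`, including the disjunct for `∞`, so that
  -- equality of classes unfolds to it.
  Over : Value → Pred Carrierᴹ ℓ
  Over γ x = γ ≈ⱽ ∞ ⊎ γ < val x

  strictlyAbove : ∀ γ → IsSubmodule (Over γ)
  strictlyAbove γ = upSet-isSubmodule {λ α → γ ≈ⱽ ∞ ⊎ γ < α}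
    (λ { α≤β (inj₁ γ≈∞) → inj₁ γ≈∞ ; α≤β (inj₂ γ<α) → inj₂ (<-≤-trans γ<α α≤β) })
    (at-∞ (∞-last γ))
    where
    at-∞ : γ ≤ ∞ → γ ≈ⱽ ∞ ⊎ γ < ∞
    at-∞ (inj₁ γ<∞) = inj₂ γ<∞
    at-∞ (inj₂ γ≈∞) = inj₁ γ≈∞

  over : ∀ {γ x} → ¬ γ ≈ⱽ ∞ → Over γ x → γ < val x
  over γ≉∞ (inj₁ γ≈∞) = ⊥-elim (γ≉∞ γ≈∞)
  over γ≉∞ (inj₂ γ<x) = γ<x

  val-+-≤ : ∀ {γ x y} → γ ≤ val x → γ ≤ val y → γ ≤ val (x +ᴹ y)
  val-+-≤ {γ} = add∈ (above γ)

  val-+-< : ∀ {γ x y} → γ < val x → γ < val y → γ < val (x +ᴹ y)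
  val-+-< {γ} p q = over (<⇒≉∞ p) (add∈ (strictlyAbove γ) (inj₂ p) (inj₂ q))

  val-neg-≤ : ∀ x → val x ≤ val (-ᴹ x)
  val-neg-≤ x = resp (Linear.neg-zero V x) (sub∈ zero∈ T.refl)
    where open IsSubmodule (above (val x))

  val-neg : ∀ x → val (-ᴹ x) ≈ⱽ val x
  val-neg x = T.antisym
    (T.trans (val-neg-≤ (-ᴹ x)) (inj₂ (val-cong (G.⁻¹-involutive x)))) (val-neg-≤ x)

  val-0 : val 0ᴹ ≈ⱽ ∞
  val-0 = Equivalence.from (val-∞ 0ᴹ) ≈ᴹ-refl

  ≉0⇒≉∞ : ∀ {x} → ¬ x ≈ᴹ 0ᴹ → ¬ val x ≈ⱽ ∞
  ≉0⇒≉∞ {x} x≉0 = x≉0 ∘ Equivalence.to (val-∞ x)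

  ≉∞⇒≉0 : ∀ {x} → ¬ val x ≈ⱽ ∞ → ¬ x ≈ᴹ 0ᴹ
  ≉∞⇒≉0 {x} x≉∞ = x≉∞ ∘ Equivalence.from (val-∞ x)

  x+y-y : ∀ x y → (x +ᴹ y) -ᴹ y ≈ᴹ x
  x+y-y x y = ≈ᴹ-trans (+ᴹ-assoc x y (-ᴹ y))
    (≈ᴹ-trans (+ᴹ-congˡ (-ᴹ‿inverseʳ y)) (+ᴹ-identityʳ x))

  x-y+y : ∀ x y → (x -ᴹ y) +ᴹ y ≈ᴹ x
  x-y+y x y = ≈ᴹ-trans (+ᴹ-assoc x (-ᴹ y) y)
    (≈ᴹ-trans (+ᴹ-congˡ (-ᴹ‿inverseˡ y)) (+ᴹ-identityʳ x))

  -- A sum can exceed the value of a summand only by cancellation. As `y` is `(x + y) - x`, its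
  -- value is at least `val x`; were it larger, `x`, being `(x + y) - y`, would have value above its
  -- own.
  val-+-absorb : ∀ {x y} → val x < val (x +ᴹ y) → val y ≈ⱽ val x
  val-+-absorb {x} {y} lt = T.antisym (≮⇒≥ x≮y) x≤y
    where
    back : (x +ᴹ y) -ᴹ x ≈ᴹ y
    back = ≈ᴹ-trans (+ᴹ-congʳ (+ᴹ-comm x y)) (x+y-y y x)
    x≤y : val x ≤ val y
    x≤y = T.trans (val-+-≤ {y = -ᴹ x} (inj₁ lt) (inj₂ (Γ.Eq.sym (val-neg x)))) (inj₂ (val-cong back))
    x≮y : ¬ val x < val y
    x≮y x<y = Γ.irrefl Γ.Eq.refl (Γ.<-respʳ-≈ (val-cong (x+y-y x y))
      (val-+-< lt (Γ.<-respʳ-≈ (Γ.Eq.sym (val-neg y)) x<y)))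

  scal-∈ : ∀ {Q : Pred Carrierᴹ ℓ} → IsSubmodule Q → ∀ k x → (¬ k ≈ᴷ 0# → Q x) → Q (k *ₗ x)
  scal-∈ isQ k x q with em {k ≈ᴷ 0#}
  ... | yes k≈0 = IsSubmodule.resp isQ
    (≈ᴹ-sym (≈ᴹ-trans (*ₗ-cong k≈0 ≈ᴹ-refl) (*ₗ-zeroˡ x))) (IsSubmodule.zero∈ isQ)
  ... | no k≉0 = IsSubmodule.scal∈ isQ k (q k≉0)

  combination-≥ : ∀ {n} (ks : Vector Scalar n) b {γ} →
    (∀ i → ¬ ks i ≈ᴷ 0# → γ ≤ val (b i)) → γ ≤ val (combination ks b)
  combination-≥ ks b {γ} p =
    combination∈ (above γ) ks b (λ i → scal-∈ (above γ) (ks i) (b i) (p i))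

  combination-> : ∀ {n} (ks : Vector Scalar n) b {γ} →
    (∀ i → ¬ ks i ≈ᴷ 0# → γ < val (b i)) → Over γ (combination ks b)
  combination-> ks b {γ} p = combination∈ (strictlyAbove γ) ks b
    (λ i → scal-∈ (strictlyAbove γ) (ks i) (b i) (λ k≉0 → inj₂ (p i k≉0)))

  -- Encoded one vector at a time: no correction of the head by the span of the tail raises its
  -- value. This is what `approximate` produces when it stops; `val-combination` recovers the
  -- formula with the minimum.
  Separated : ∀ {n} → Vector Carrierᴹ n → Set ℓ
  Separated {zero}  b = ⊤
  Separated {suc n} b = Separated (tail b) × ¬ head b ≈ᴹ 0ᴹ ×
    (∀ ks → ¬ val (head b) < val (head b +ᴹ combination ks (tail b)))

  separated-≉0 : ∀ {n} {b : Vector Carrierᴹ n} → Separated b → ∀ i → ¬ b i ≈ᴹ 0ᴹ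
  separated-≉0 (_ , nz , _) zero    = nz
  separated-≉0 (s , _ , _)  (suc i) = separated-≉0 s i

  -- If the head coefficient is nonzero, scaling by its inverse gives the bound at the head. At a
  -- later position, induction bounds the value of the tail `X` by that of the basis vector; were
  -- this below `val S`, the head term would cancel against `X` and so have the value of `X`, below
  -- `val S`, against the bound at the head.
  separated-bound : ∀ {n} {b : Vector Carrierᴹ n} → Separated b → ∀ ks i → ¬ ks i ≈ᴷ 0# →
    ¬ val (b i) < val (combination ks b)
  separated-bound {suc n} {b} (s , nz , orth) ks i ki≉0 lt with em {head ks ≈ᴷ 0#}
  separated-bound {suc n} {b} (s , nz , orth) ks zero ki≉0 lt | yes k≈0 = ki≉0 k≈0
  separated-bound {suc n} {b} (s , nz , orth) ks (suc i) ki≉0 lt | yes k≈0 =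
    separated-bound s (tail ks) i ki≉0
      (Γ.<-respʳ-≈ (val-cong (combination-head≈0 ks b k≈0)) lt)
  ... | no k≉0 = bad i ki≉0 lt
    where
    S = combination ks b
    X = combination (tail ks) (tail b)
    c = proj₁ (K.inverses (head ks) k≉0)
    kc≈1 = proj₂ (K.inverses (head ks) k≉0)
    c≉0 : ¬ c ≈ᴷ 0#
    c≉0 c≈0 = K.1≉0 (K.trans (K.sym kc≈1) (K.trans (K.*-congˡ c≈0) (K.zeroʳ _)))
    scaled : val (head b +ᴹ combination (λ j → c * tail ks j) (tail b)) ≈ⱽ val S
    scaled = Γ.Eq.trans (val-cong (≈ᴹ-trans
      (≈ᴹ-sym (combination-head≈1 (λ j → c * ks j) b (K.trans (K.*-comm c _) kc≈1)))
      (combination-* c ks b))) (val-scal c S c≉0)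
    S≯ : ¬ val (head b) < val S
    S≯ p = orth (λ j → c * tail ks j) (Γ.<-respʳ-≈ (Γ.Eq.sym scaled) p)
    bad : ∀ i → ¬ ks i ≈ᴷ 0# → ¬ val (b i) < val S
    bad zero    _    p = S≯ p
    bad (suc j) kj≉0 p = Γ.irrefl Γ.Eq.refl (≤-<-trans S≤v v<S)
      where
      X<S : val X < val S
      X<S = ≤-<-trans (≮⇒≥ (separated-bound s (tail ks) j kj≉0)) p
      v<S : val (head b) < val S
      v<S = Γ.<-respˡ-≈ (Γ.Eq.trans
        (Γ.Eq.sym (val-+-absorb (Γ.<-respʳ-≈ (val-cong (+ᴹ-comm _ X)) X<S)))
        (val-scal (head ks) (head b) k≉0)) X<S
      S≤v : val S ≤ val (head b)
      S≤v = ≮⇒≥ S≯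

  separated⇒independent : ∀ {n} {b : Vector Carrierᴹ n} → Separated b → Independent b
  separated⇒independent {b = b} s ks e i with em {ks i ≈ᴷ 0#}
  ... | yes p = p
  ... | no ¬p = ⊥-elim (separated-bound s ks i ¬p (≤∧≉⇒< (∞-last _)
        (≉0⇒≉∞ (separated-≉0 s i))))
    where
    ≤∧≉⇒< : ∀ {α} → α ≤ ∞ → ¬ α ≈ⱽ ∞ → α < val (combination ks b)
    ≤∧≉⇒< (inj₁ lt) _ = Γ.<-respʳ-≈ (Γ.Eq.sym (Γ.Eq.trans (val-cong e) val-0)) lt
    ≤∧≉⇒< (inj₂ eq) p = ⊥-elim (p eq)

  independent-≋ : ∀ {n} {b : Vector Carrierᴹ n} → Separated b → ∀ ks ls →
    combination ks b ≈ᴹ combination ls b → ∀ i → ks i ≈ᴷ ls i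
  independent-≋ {b = b} s ks ls e i = K.trans (K.sym (K.+-identityʳ _)) (K.trans
    (K.+-congˡ (K.sym (K.-‿inverseˡ _))) (K.trans (K.sym (K.+-assoc _ _ _)) (K.trans
    (K.+-congʳ (K.trans (K.+-congˡ (K.sym -1*l≈-l)) (separated⇒independent s _ diff i)))
    (K.+-identityˡ _))))
    where
    -1*l≈-l = RingProperties.-1*x≈-x K.ring (ls i)
    diff : combination (λ i → ks i + (K.- 1#) * ls i) b ≈ᴹ 0ᴹ
    diff = begin
      combination (λ i → ks i + (K.- 1#) * ls i) b  ≈⟨ combination-+ ks (λ i → (K.- 1#) * ls i) b ⟩
      combination ks b +ᴹ combination (λ i → (K.- 1#) * ls i) b
                                               ≈⟨ +ᴹ-cong e (combination-neg ls b) ⟩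
      combination ls b -ᴹ combination ls b     ≈⟨ -ᴹ‿inverseʳ _ ⟩
      0ᴹ                                       ∎

  -- The minimum of the `g i` with `ks i` nonzero, which is `∞` for the empty set. It is phrased by
  -- zero tests on scalars and comparisons of values, so that it can be read as a formula about K
  -- and Γ.
  MinimalValue : ∀ {n} → Vector Scalar n → Vector Value n → Value → Set ℓ
  MinimalValue ks g γ = (∀ i → ¬ ks i ≈ᴷ 0# → γ ≤ g i) ×
    (γ ≈ⱽ ∞ ⊎ ∃ λ i → ¬ ks i ≈ᴷ 0# × γ ≈ⱽ g i)

  val-combination : ∀ {n} {b : Vector Carrierᴹ n} → Separated b → ∀ ks {γ} →
    val (combination ks b) ≈ⱽ γ ⇔ MinimalValue ks (val ∘ b) γ
  val-combination {b = b} s ks {γ} = mk⇔ to from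
    where
    x = combination ks b
    to : val x ≈ⱽ γ → MinimalValue ks (val ∘ b) γ
    to x≈γ = (λ i k≉0 → T.trans (inj₂ (Γ.Eq.sym x≈γ)) (≮⇒≥ (separated-bound s ks i k≉0))) , min
      where
      min : γ ≈ⱽ ∞ ⊎ ∃ λ i → ¬ ks i ≈ᴷ 0# × γ ≈ⱽ val (b i)
      min with em {∃ λ i → ¬ ks i ≈ᴷ 0# × ¬ val x < val (b i)}
      ... | yes (i , k≉0 , x≮) = inj₂ (i , k≉0 , Γ.Eq.trans (Γ.Eq.sym x≈γ)
              (T.antisym (≮⇒≥ (separated-bound s ks i k≉0)) (≮⇒≥ x≮)))
      -- If no basis vector with nonzero coefficient attains the bound, all of them lie strictly
      -- above `val x`, and so does `x` itself, which is possible only for `∞`.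
      ... | no none with combination-> ks b {val x} above-all
        where
        above-all : ∀ i → ¬ ks i ≈ᴷ 0# → val x < val (b i)
        above-all i k≉0 with em {val x < val (b i)}
        ... | yes p = p
        ... | no ¬p = ⊥-elim (none (i , k≉0 , ¬p))
      ...   | inj₁ x≈∞ = inj₁ (Γ.Eq.trans (Γ.Eq.sym x≈γ) x≈∞)
      ...   | inj₂ x<x = ⊥-elim (Γ.irrefl Γ.Eq.refl x<x)
    from : MinimalValue ks (val ∘ b) γ → val x ≈ⱽ γ
    from (lower , inj₁ γ≈∞) = T.antisym
      (T.trans (∞-last _) (inj₂ (Γ.Eq.sym γ≈∞))) (combination-≥ ks b lower)
    from (lower , inj₂ (i , k≉0 , γ≈)) = T.antisym
      (T.trans (≮⇒≥ (separated-bound s ks i k≉0)) (inj₂ (Γ.Eq.sym γ≈))) (combination-≥ ks b lower)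

  greatest : ∀ {n} (g : Vector Value n) (P : Pred (Fin n) ℓ) →
    (∀ i → ¬ P i) ⊎ ∃ λ i → P i × (∀ j → P j → g j ≤ g i)
  greatest {zero}  g P = inj₁ λ ()
  greatest {suc n} g P with em {P zero} | greatest (g ∘ suc) (P ∘ suc)
  ... | no ¬p | inj₁ none = inj₁ λ { zero → ¬p ; (suc i) → none i }
  ... | no ¬p | inj₂ (i , p , max) =
    inj₂ (suc i , p , λ { zero p → ⊥-elim (¬p p) ; (suc j) → max j })
  ... | yes p | inj₁ none =
    inj₂ (zero , p , λ { zero _ → T.refl ; (suc j) q → ⊥-elim (none j q) })
  ... | yes p | inj₂ (i , q , max) with T.total (g zero) (g (suc i))
  ...   | inj₁ le = inj₂ (suc i , q , λ { zero _ → le ; (suc j) → max j })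
  ...   | inj₂ ge = inj₂ (zero , p , λ { zero _ → T.refl ; (suc j) r → T.trans (max j r) ge })

  -- A failure of separation improves the approximation past one of the
  -- finitely many values val (b i), so an approximation past the greatest
  -- value that can be passed is optimal.
  approximate : ∀ {n} {b : Vector Carrierᴹ n} → Separated b → ∀ x →
    ∃ λ ks → ∃ λ r → x ≈ᴹ r +ᴹ combination ks b × (r ≈ᴹ 0ᴹ ⊎ Separated (r ◃ b))
  approximate {n} {b} s x = finish (greatest (val ∘ b) Passed)
    where
    Approx : Carrierᴹ → Set ℓ
    Approx r = ∃ λ ks → x ≈ᴹ r +ᴹ combination ks b
    Passed : Pred (Fin n) ℓ
    Passed i = ∃ λ r → Approx r × val (b i) < val r
    improve : ∀ {r} → Approx r → ∀ ls → Approx (r +ᴹ combination ls b)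
    improve {r} (ks , e) ls = (λ i → (K.- 1#) * ls i + ks i) , (begin
      x                                      ≈⟨ e ⟩
      r +ᴹ combination ks b                  ≈⟨ +ᴹ-congʳ (x+y-y r u) ⟨
      ((r +ᴹ u) -ᴹ u) +ᴹ combination ks b    ≈⟨ +ᴹ-assoc _ _ _ ⟩
      (r +ᴹ u) +ᴹ ((-ᴹ u) +ᴹ combination ks b) ≈⟨ +ᴹ-congˡ (+ᴹ-congʳ (combination-neg ls b)) ⟨
      (r +ᴹ u) +ᴹ (combination (λ i → (K.- 1#) * ls i) b +ᴹ combination ks b)
                                             ≈⟨ +ᴹ-congˡ (combination-+ (λ i → (K.- 1#) * ls i) ks b) ⟨
      (r +ᴹ u) +ᴹ combination (λ i → (K.- 1#) * ls i + ks i) b ∎)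
      where u = combination ls b
    -- If a correction raises `val r`, it has value `val r` by cancellation. A combination of `b`
    -- has value `∞` or some `val (b j)`, so the corrected remainder passes this `val (b j)`.
    step : ∀ r → Approx r → (r ≈ᴹ 0ᴹ ⊎ Separated (r ◃ b)) ⊎
      ∃ λ j → val r ≈ⱽ val (b j) × Passed j
    step r ap with em {r ≈ᴹ 0ᴹ} | em {∃ λ ks → val r < val (r +ᴹ combination ks b)}
    ... | yes r≈0 | _ = inj₁ (inj₁ r≈0)
    ... | no r≉0 | no ¬p = inj₁ (inj₂ (s , r≉0 , λ ks p → ¬p (ks , p)))
    ... | no r≉0 | yes (ls , lt)
      with proj₂ (Equivalence.to (val-combination s ls) (val-+-absorb lt))
    ...   | inj₁ r≈∞ = ⊥-elim (≉0⇒≉∞ r≉0 r≈∞)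
    ...   | inj₂ (j , _ , r≈) =
      inj₂ (j , r≈ , r +ᴹ combination ls b , improve ap ls , Γ.<-respˡ-≈ r≈ lt)
    finish : _ → _
    finish (inj₁ none) with step x ((λ _ → 0#) ,
      ≈ᴹ-sym (≈ᴹ-trans (+ᴹ-congˡ (combination-zero b (λ _ → K.refl))) (+ᴹ-identityʳ x)))
    ... | inj₁ p = (λ _ → 0#) , x ,
      ≈ᴹ-sym (≈ᴹ-trans (+ᴹ-congˡ (combination-zero b (λ _ → K.refl))) (+ᴹ-identityʳ x)) , p
    ... | inj₂ (j , _ , pass) = ⊥-elim (none j pass)
    finish (inj₂ (i , (r , (ks , e) , lt) , max)) with step r (ks , e)
    ... | inj₁ p = ks , r , e , p
    -- The remainder lies above the greatest value that can be passed, and yet has the value of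
    -- `b j`, which can be passed.
    ... | inj₂ (j , r≈ , pass) = ⊥-elim (≤⇒≯ (max j pass) (Γ.<-respʳ-≈ r≈ lt))

  -- Separated tuples and the spaces `B γ`

  module _ {γ : Value} where
    module BL = LinearAlgebra em K (B 𝒱 γ)

    classes : ∀ {n} (y : Vector Carrierᴹ n) → (∀ i → γ ≤ val (y i)) →
      Vector (LeftModule.Carrierᴹ (B 𝒱 γ)) n
    classes y p i = y i , p i

    combination-rep : ∀ {n} ks (y : Vector (LeftModule.Carrierᴹ (B 𝒱 γ)) n) →
      proj₁ (Linear.combination (B 𝒱 γ) ks y) ≈ᴹ combination ks (proj₁ ∘ y)
    combination-rep {zero}  ks y = ≈ᴹ-refl
    combination-rep {suc n} ks y = +ᴹ-congˡ (combination-rep (tail ks) (tail y))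

    x-0 : ∀ {x y} → x ≈ᴹ y → x -ᴹ 0ᴹ ≈ᴹ y
    x-0 {x} e = ≈ᴹ-trans (≈ᴹ-trans (+ᴹ-congˡ G.ε⁻¹≈ε) (+ᴹ-identityʳ x)) e

    class≈0 : ∀ {n} ks (y : Vector (LeftModule.Carrierᴹ (B 𝒱 γ)) n) →
      LeftModule._≈ᴹ_ (B 𝒱 γ) (Linear.combination (B 𝒱 γ) ks y) (LeftModule.0ᴹ (B 𝒱 γ)) ⇔
      Over γ (combination ks (proj₁ ∘ y))
    class≈0 ks y = mk⇔ (resp (x-0 (combination-rep ks y))) (resp (≈ᴹ-sym (x-0 (combination-rep ks y))))
      where open IsSubmodule (strictlyAbove γ)

    -- `B ∞` is zero, so there even the relation with all coefficients 1 holds.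
    independent⇒≉∞ : ∀ {n} (y : Vector (LeftModule.Carrierᴹ (B 𝒱 γ)) (suc n)) →
      BL.Independent y → ¬ γ ≈ⱽ ∞
    independent⇒≉∞ y ind γ≈∞ = K.1≉0 (ind (λ _ → 1#) (inj₁ γ≈∞) zero)

    -- A representative of value above `γ` has class zero, and its unit vector would be a nontrivial
    -- relation.
    independent⇒val : ∀ {n} (y : Vector (LeftModule.Carrierᴹ (B 𝒱 γ)) n) →
      BL.Independent y → ∀ i → val (proj₁ (y i)) ≈ⱽ γ
    independent⇒val y ind i with proj₂ (y i)
    ... | inj₂ γ≈ = Γ.Eq.sym γ≈
    ... | inj₁ γ< = ⊥-elim (K.1≉0 (K.trans (K.sym (unit-diagonal i)) (ind (unit i)
      (Equivalence.from (class≈0 (unit i) y)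
        (inj₂ (Γ.<-respʳ-≈ (val-cong (≈ᴹ-sym (combination-unit (proj₁ ∘ y) i))) γ<))) i)))

    -- Together with its converse below, this identifies `W` with independence in `B γ`. Hence the
    -- symbols `W` carry independence from one structure to another and express dimension in the
    -- language.
    independent⇒W : ∀ {n} (y : Vector (LeftModule.Carrierᴹ (B 𝒱 γ)) (suc n)) →
      BL.Independent y → W 𝒱 (proj₁ ∘ y)
    independent⇒W y ind =
      (λ i → ≉∞⇒≉0 (λ p → independent⇒≉∞ y ind (Γ.Eq.trans (Γ.Eq.sym (independent⇒val y ind i)) p))) ,
      (λ i j → Γ.Eq.trans (independent⇒val y ind i) (Γ.Eq.sym (independent⇒val y ind j))) ,
      λ ks lt → ind ks (Equivalence.from (class≈0 ks y) (inj₂ (Γ.<-respˡ-≈ (independent⇒val y ind zero) lt)))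

    W⇒independent : ∀ {n} (y : Vector (LeftModule.Carrierᴹ (B 𝒱 γ)) (suc n)) →
      val (proj₁ (y zero)) ≈ⱽ γ → W 𝒱 (proj₁ ∘ y) → BL.Independent y
    W⇒independent y y≈γ (nz , _ , ind) ks e = ind ks (Γ.<-respˡ-≈ (Γ.Eq.sym y≈γ)
      (over (λ γ≈∞ → ≉0⇒≉∞ (nz zero) (Γ.Eq.trans y≈γ γ≈∞)) (Equivalence.to (class≈0 ks y) e)))

    module _ {k n} {b : Vector Carrierᴹ n} (s : Separated b) (t : Thinning k n)
             (pk : Picks t (λ i → val (b i) ≈ⱽ γ)) where

      selected : Vector (LeftModule.Carrierᴹ (B 𝒱 γ)) k
      selected = classes (b ∘ select t) (λ j → inj₂ (Γ.Eq.sym (picked t pk j)))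

      -- By separation, a combination of value at least `γ` involves only basis vectors of value at
      -- least `γ`; those strictly above vanish in `B γ`.
      combination-restrict : ∀ ks → γ ≤ val (combination ks b) →
        ∃ λ z → Over γ z ×
          combination ks b ≈ᴹ combination (ks ∘ select t) (b ∘ select t) +ᴹ z
      combination-restrict ks le = combination-select pk (strictlyAbove γ) ks b
        λ i ≉γ → scal-∈ (strictlyAbove γ) (ks i) (b i) λ k≉0 →
          big ≉γ (T.trans le (≮⇒≥ (separated-bound s ks i k≉0)))
        where
        big : ∀ {i} → ¬ val (b i) ≈ⱽ γ → γ ≤ val (b i) → Over γ (b i)
        big ≉γ (inj₁ lt) = inj₂ lt
        big ≉γ (inj₂ eq) = ⊥-elim (≉γ (Γ.Eq.sym eq))

      -- A relation between the classes, padded with zeros, is a combination of `b` of value above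
      -- `γ`; a nonzero coefficient at a vector of value `γ` would violate `separated-bound`.
      selected-independent : ¬ γ ≈ⱽ ∞ → BL.Independent selected
      selected-independent γ≉∞ ks e j with em {ks j ≈ᴷ 0#}
      ... | yes p = p
      ... | no ¬p = ⊥-elim (separated-bound s (extendByZero t ks) (select t j)
        (subst (λ c → ¬ c ≈ᴷ 0#) (sym (extendByZero-select t ks j)) ¬p)
        (Γ.<-respˡ-≈ (Γ.Eq.sym (picked t pk j)) (Γ.<-respʳ-≈
          (val-cong (≈ᴹ-sym (combination-extendByZero t ks b)))
          (over γ≉∞ (Equivalence.to (class≈0 ks selected) e)))))

      -- A combination that raises the value of the new vector must itself have value `γ`. Modulo
      -- vectors above `γ` it reduces to the selected ones, which gives a relation in `B γ` with
      -- coefficient 1 at `x`.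
      independent⇒separated : ∀ {x} → BL.Independent (x ◃ selected) → Separated (proj₁ x ◃ b)
      independent⇒separated {x} ind = s , ≉∞⇒≉0 (λ p → γ≉∞ (Γ.Eq.trans (Γ.Eq.sym x≈γ) p)) , orth
        where
        γ≉∞ = independent⇒≉∞ (x ◃ selected) ind
        x≈γ = independent⇒val (x ◃ selected) ind zero
        y = proj₁ x
        orth : ∀ ks → ¬ val y < val (y +ᴹ combination ks b)
        orth ks lt with combination-restrict ks (inj₂ (Γ.Eq.sym (Γ.Eq.trans (val-+-absorb lt) x≈γ)))
        ... | z , z∈ , e = K.1≉0 (ind (1# ◃ (ks ∘ select t)) (Equivalence.from
              (class≈0 (1# ◃ (ks ∘ select t)) (x ◃ selected))
              (inj₂ (Γ.<-respʳ-≈ (val-cong rest) (val-+-< (Γ.<-respˡ-≈ x≈γ lt)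
                (Γ.<-respʳ-≈ (Γ.Eq.sym (val-neg z)) (over γ≉∞ z∈)))))) zero)
          where
          rest : (y +ᴹ combination ks b) -ᴹ z ≈ᴹ
            combination (1# ◃ (ks ∘ select t)) (proj₁ ∘ (x ◃ selected))
          rest = begin
            (y +ᴹ combination ks b) -ᴹ z    ≈⟨ +ᴹ-congʳ (+ᴹ-congˡ e) ⟩
            (y +ᴹ (u +ᴹ z)) -ᴹ z            ≈⟨ +ᴹ-congʳ (+ᴹ-assoc y u z) ⟨
            ((y +ᴹ u) +ᴹ z) -ᴹ z            ≈⟨ x+y-y (y +ᴹ u) z ⟩
            y +ᴹ u                          ≈⟨ combination-head≈1 (1# ◃ (ks ∘ select t)) (proj₁ ∘ (x ◃ selected)) K.refl ⟨
            combination (1# ◃ (ks ∘ select t)) (proj₁ ∘ (x ◃ selected)) ∎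
            where u = combination (ks ∘ select t) (b ∘ select t)

  separated-◃-independent : ∀ {γ k n} {b : Vector Carrierᴹ n} {r} (s : Separated (r ◃ b))
    (t : Thinning k n) (pk : Picks t (λ i → val (b i) ≈ⱽ γ)) (r≈γ : val r ≈ⱽ γ) →
    BL.Independent {γ} ((r , inj₂ (Γ.Eq.sym r≈γ)) ◃ selected {b = b} (proj₁ s) t pk)
  separated-◃-independent {γ} {k} {b = b} {r} s t pk r≈γ ks e =
    selected-independent {b = r ◃ b} s (keep t) (r≈γ , pk)
      (λ γ≈∞ → ≉0⇒≉∞ (separated-≉0 {b = r ◃ b} s zero) (Γ.Eq.trans r≈γ γ≈∞)) ks
      -- The two tuples of classes have the same representatives and differ only in how they are
      -- assembled, so the relation is passed through its meaning in the vector space.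
      (Equivalence.from (class≈0 ks (selected {b = r ◃ b} s (keep t) (r≈γ , pk)))
        (Equivalence.to (class≈0 ks y) e))
    where
    y : Vector (LeftModule.Carrierᴹ (B 𝒱 γ)) (suc k)
    y = (r , inj₂ (Γ.Eq.sym r≈γ)) ◃ selected {b = b} (proj₁ s) t pk

  -- The `k` selected classes are independent. A new vector would give `k + 1` independent classes,
  -- impossible in dimension `k`. If the dimension is not `k`, they do not span, and any
  -- representative of a class outside their span is a new vector.
  separated-extends : ∀ {γ k n} {b : Vector Carrierᴹ n} → Separated b →
    (t : Thinning k n) → Picks t (λ i → val (b i) ≈ⱽ γ) →
    (∃ λ r → val r ≈ⱽ γ × Separated (r ◃ b)) ⇔ (¬ Linear.HasDimension (B 𝒱 γ) k)
  separated-extends {γ} {k} {b = b} s t pk = mk⇔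
    (λ { (r , r≈γ , s′) dim → BL.¬independent dim
      ((r , inj₂ (Γ.Eq.sym r≈γ)) ◃ selected {b = b} (proj₁ s′) t pk)
      (separated-◃-independent {b = b} s′ t pk r≈γ) })
    from
    where
    from : ¬ Linear.HasDimension (B 𝒱 γ) k → ∃ λ r → val r ≈ⱽ γ × Separated (r ◃ b)
    from ¬dim = proj₁ x , independent⇒val (x ◃ selected s t pk) ind zero , independent⇒separated s t pk {x} ind
      where
      -- Excludes `γ` being `∞`: basis vectors are nonzero, so none has value `∞`, and the count 0
      -- is the dimension of `B ∞`.
      pick-∞ : ∀ {k n} {b : Vector Carrierᴹ n} → Separated b → (t : Thinning k n) →
        Picks t (λ i → val (b i) ≈ⱽ γ) → γ ≈ⱽ ∞ → Linear.HasDimension (B 𝒱 γ) k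
      pick-∞ s done     pk γ≈∞ = (λ ()) , (λ _ _ ()) , λ x → (λ ()) , inj₁ γ≈∞
      pick-∞ (s , nz , _) (keep t) (p , pk) γ≈∞ = ⊥-elim (≉0⇒≉∞ nz (Γ.Eq.trans p γ≈∞))
      pick-∞ (s , _ , _)  (skip t) (_ , pk) γ≈∞ = pick-∞ s t pk γ≈∞
      ext = BL.¬dimension⇒extend (selected s t pk) (selected-independent s t pk (¬dim ∘ pick-∞ s t pk)) ¬dim
      x = proj₁ ext
      ind = proj₂ ext

  -- Every value is attained, and a vector of value `γ` other than `∞` has nonzero class in `B γ`.
  hasDimension-zero : ∀ {γ} → Linear.HasDimension (B 𝒱 γ) 0 ⇔ γ ≈ⱽ ∞
  hasDimension-zero {γ} = mk⇔ to (λ γ≈∞ → (λ ()) , (λ _ _ ()) , λ x → (λ ()) , inj₁ γ≈∞)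
    where
    to : Linear.HasDimension (B 𝒱 γ) 0 → γ ≈ⱽ ∞
    to (b , _ , spanning) with val-surjective γ
    ... | x , v with spanning (x , inj₂ (Γ.Eq.sym (v ≈ᴹ-refl)))
    ...   | _ , inj₁ γ≈∞ = γ≈∞
    ...   | _ , inj₂ γ<  = ⊥-elim (Γ.irrefl (Γ.Eq.sym (Γ.Eq.trans (Γ.Eq.trans
              (val-cong (+ᴹ-identityˡ (-ᴹ x))) (val-neg x)) (v ≈ᴹ-refl))) γ<)

  -- A basis of `B γ` is a maximal independent tuple, and maximality amounts to having no extension
  -- by one vector. This makes the positive colours first-order definable.
  hasDimension-suc : ∀ {γ m} → Linear.HasDimension (B 𝒱 γ) (suc m) ⇔
    ∃ λ (vs : Vector Carrierᴹ (suc m)) → val (head vs) ≈ⱽ γ × W 𝒱 vs × ¬ ∃ λ v → W 𝒱 (v ◃ vs)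
  hasDimension-suc {γ} {m} = mk⇔ to from
    where
    to : _ → _
    to (b , ind , spanning) = proj₁ ∘ b , independent⇒val b ind zero , w ,
      λ { (v , w′) → let v≈γ = Γ.Eq.trans (proj₁ (proj₂ w′) zero (suc zero)) (independent⇒val b ind zero)
                         y = (v , inj₂ (Γ.Eq.sym v≈γ)) ◃ b
                     in BL.¬independent (b , ind , spanning) y
                          (W⇒independent y v≈γ (W-resp 𝒱 (λ { zero → ≈ᴹ-refl ; (suc i) → ≈ᴹ-refl }) w′)) }
      where
      w : W 𝒱 (proj₁ ∘ b)
      w = independent⇒W b ind
    from : _ → _
    from (vs , v≈γ , w , none) with em {Linear.HasDimension (B 𝒱 γ) (suc m)}
    ... | yes dim = dim
    ... | no ¬dim = ⊥-elim (none (proj₁ x , W-resp 𝒱 (λ { zero → ≈ᴹ-refl ; (suc i) → ≈ᴹ-refl })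
                      (independent⇒W (x ◃ y) ind)))
      where
      y = classes vs (λ i → inj₂ (Γ.Eq.trans (Γ.Eq.sym v≈γ) (proj₁ (proj₂ w) zero i)))
      ext = BL.¬dimension⇒extend y (W⇒independent y v≈γ w) ¬dim
      x = proj₁ ext
      ind = proj₂ ext

open Equivalence using (to; from)

∃-⇔ : ∀ {a p q} {A : Set a} {P : A → Set p} {Q : A → Set q} → (∀ x → P x ⇔ Q x) → ∃ P ⇔ ∃ Q
∃-⇔ e = mk⇔ (λ { (x , p) → x , to (e x) p }) (λ { (x , q) → x , from (e x) q })

∀-⇔ : ∀ {a p q} {A : Set a} {P : A → Set p} {Q : A → Set q} →
  (∀ x → P x ⇔ Q x) → (∀ x → P x) ⇔ (∀ x → Q x)
∀-⇔ e = mk⇔ (λ p x → to (e x) (p x)) (λ q x → from (e x) (q x))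

¬-⇔ : ∀ {a b} {A : Set a} {B : Set b} → A ⇔ B → (¬ A) ⇔ (¬ B)
¬-⇔ e = mk⇔ (_∘ from e) (_∘ to e)

-- Contexts and environments

module _ {a} {A : Set a} where

  extend : ∀ {n} → Vector A n → List A → List A
  extend {zero}  d Γ = Γ
  extend {suc n} d Γ = head d ∷ extend (tail d) Γ

  fresh : ∀ {n} {d : Vector A n} {Γ} i → d i ∈ extend d Γ
  fresh zero    = here refl
  fresh (suc i) = there (fresh i)

  old : ∀ {n} {d : Vector A n} {Γ s} → s ∈ Γ → s ∈ extend d Γ
  old {zero}  x = x
  old {suc n} x = there (old x)

  module _ {p} {P : A → Set p} where

    push : ∀ {n} {d : Vector A n} {Γ} → (∀ i → P (d i)) → All P Γ → All P (extend d Γ)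
    push {zero}  ys ρ = ρ
    push {suc n} ys ρ = ys zero ∷ push (ys ∘ suc) ρ

    drop : ∀ {n} {d : Vector A n} {Γ} → All P (extend d Γ) → All P Γ
    drop {zero}  ρ = ρ
    drop {suc n} ρ = drop (All.tail ρ)

    drop-push : ∀ {n} {d : Vector A n} {Γ} (ys : ∀ i → P (d i)) (ρ : All P Γ) →
      drop (push ys ρ) ≡ ρ
    drop-push {zero}  ys ρ = refl
    drop-push {suc n} ys ρ = drop-push (ys ∘ suc) ρ

    lookup-fresh : ∀ {n} {d : Vector A n} {Γ} (ys : ∀ i → P (d i)) (ρ : All P Γ) i →
      All.lookup (push ys ρ) (fresh i) ≡ ys i
    lookup-fresh ys ρ zero    = refl
    lookup-fresh ys ρ (suc i) = lookup-fresh (ys ∘ suc) ρ i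

    lookup-old : ∀ {n} {d : Vector A n} {Γ} (ys : ∀ i → P (d i)) (ρ : All P Γ) {s} (x : s ∈ Γ) →
      All.lookup (push ys ρ) (old x) ≡ All.lookup ρ x
    lookup-old {zero}  ys ρ x = refl
    lookup-old {suc n} ys ρ x = lookup-old (ys ∘ suc) ρ x

    lookup-tail : ∀ {Γ s t} (ρ : All P (t ∷ Γ)) (x : s ∈ Γ) →
      All.lookup (All.tail ρ) x ≡ All.lookup ρ (there x)
    lookup-tail (_ ∷ ρ) x = refl

    lookup-drop : ∀ {n} {d : Vector A n} {Γ} (ρ : All P (extend d Γ)) {s} (x : s ∈ Γ) →
      All.lookup (drop ρ) x ≡ All.lookup ρ (old x)
    lookup-drop {zero}  ρ x = refl
    lookup-drop {suc n} ρ x = trans (lookup-drop (All.tail ρ) x) (lookup-tail ρ (old x))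

-- Formulas about a pair of structures

Tags : Set
Tags = List Unit.⊤

FieldFormula : Tags → Set
FieldFormula = Syntax.Formula L-field

OrderFormula : Tags → Set
OrderFormula = Syntax.Formula L-colouredOrder

-- Disjunctions of conjunctions of a formula about K and a formula about Γ.  As
-- K and Γ do not interact, a quantifier over either passes into the clauses.
Clauses : Tags → Tags → Set
Clauses kc gc = List (FieldFormula kc × OrderFormula gc)

module _ where
  open Syntax

  trueᴷ : ∀ {kc} → FieldFormula kc
  trueᴷ = app nought (λ ()) ≐ app nought (λ ())

  -- The coloured order has no constants and the context may be empty, so truth needs a quantifier;
  -- it holds because `∞` exists.
  trueᴳ : ∀ {gc} → OrderFormula gc
  trueᴳ = ∃′ Unit.tt (var (here refl) ≐ var (here refl))

  fieldClause : ∀ {kc gc} → FieldFormula kc → Clauses kc gc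
  fieldClause φ = (φ , trueᴳ) ∷ []

  orderClause : ∀ {kc gc} → OrderFormula gc → Clauses kc gc
  orderClause ψ = (trueᴷ , ψ) ∷ []

  infixr 6 _∩_
  infixr 5 _∪_

  _∪_ : ∀ {kc gc} → Clauses kc gc → Clauses kc gc → Clauses kc gc
  _∪_ = _++_

  _∩_ : ∀ {kc gc} → Clauses kc gc → Clauses kc gc → Clauses kc gc
  _∩_ = cartesianProductWith (λ { (φ , ψ) (φ′ , ψ′) → φ ∧′ φ′ , ψ ∧′ ψ′ })

  -- De Morgan: a negated clause is a negated field part or a negated order part, and `∩`
  -- distributes the result into clauses again.
  complement : ∀ {kc gc} → Clauses kc gc → Clauses kc gc
  complement []            = orderClause trueᴳ
  complement ((φ , ψ) ∷ D) = (fieldClause (¬′ φ) ∪ orderClause (¬′ ψ)) ∩ complement D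

  existsᴷ : ∀ {kc gc} → Clauses (Unit.tt ∷ kc) gc → Clauses kc gc
  existsᴷ = mapList (λ { (φ , ψ) → ∃′ Unit.tt φ , ψ })

  existsᴳ : ∀ {kc gc} → Clauses kc (Unit.tt ∷ gc) → Clauses kc gc
  existsᴳ = mapList (λ { (φ , ψ) → φ , ∃′ Unit.tt ψ })

  existsᴷ* : ∀ {n kc gc} → Clauses (extend {n = n} (λ _ → Unit.tt) kc) gc → Clauses kc gc
  existsᴷ* {zero}  D = D
  existsᴷ* {suc n} D = existsᴷ* {n} (existsᴷ D)

  meet : ∀ {n kc gc} → (Fin n → Clauses kc gc) → Clauses kc gc
  meet {zero}  D = orderClause trueᴳ
  meet {suc n} D = D zero ∩ meet (D ∘ suc)

  join : ∀ {n kc gc} → (Fin n → Clauses kc gc) → Clauses kc gc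
  join {zero}  D = []
  join {suc n} D = D zero ∪ join (D ∘ suc)

-- Separates the translation of the language from the distribution into clauses. Finite conjunctions
-- and disjunctions run over the basis, and scalars are quantified in blocks because a vector is
-- given by `n` coordinates.
data PairFormula : Tags → Tags → Set where
  inᴷ     : ∀ {kc gc} → FieldFormula kc → PairFormula kc gc
  inᴳ     : ∀ {kc gc} → OrderFormula gc → PairFormula kc gc
  _∧_ _∨_ : ∀ {kc gc} → PairFormula kc gc → PairFormula kc gc → PairFormula kc gc
  ∼_      : ∀ {kc gc} → PairFormula kc gc → PairFormula kc gc
  ⋀ ⋁     : ∀ {kc gc n} → (Fin n → PairFormula kc gc) → PairFormula kc gc
  ∃ᴷ*     : ∀ {kc gc} n → PairFormula (extend {n = n} (λ _ → Unit.tt) kc) gc → PairFormula kc gc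
  ∃ᴳ      : ∀ {kc gc} → PairFormula kc (Unit.tt ∷ gc) → PairFormula kc gc

infixr 6 _∧_
infixr 5 _∨_
infix  7 ∼_

normalise : ∀ {kc gc} → PairFormula kc gc → Clauses kc gc
normalise (inᴷ φ)   = fieldClause φ
normalise (inᴳ ψ)   = orderClause ψ
normalise (D ∧ E)   = normalise D ∩ normalise E
normalise (D ∨ E)   = normalise D ∪ normalise E
normalise (∼ D)     = complement (normalise D)
normalise (⋀ D)     = meet (λ i → normalise (D i))
normalise (⋁ D)     = join (λ i → normalise (D i))
normalise (∃ᴷ* n D) = existsᴷ* {n} (normalise D)
normalise (∃ᴳ D)    = existsᴳ (normalise D)

FieldEnv : ∀ {ℓ} → ValuedVectorSpace ℓ → Tags → Set ℓ
FieldEnv U = All (Structure.∣_∣ (fieldStructure (ValuedVectorSpace.K U)))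

OrderEnv : ∀ {ℓ} → ValuedVectorSpace ℓ → Tags → Set ℓ
OrderEnv U = All (Structure.∣_∣ (colouredOrder U))

module Truth {ℓ : Level} (em : ExcludedMiddle ℓ) (U : ValuedVectorSpace ℓ) where
  private
    module 𝕂 = Semantics (fieldStructure (ValuedVectorSpace.K U))
    module 𝔾 = Semantics (colouredOrder U)

  Clause : ∀ {kc gc} → FieldEnv U kc → OrderEnv U gc → FieldFormula kc × OrderFormula gc → Set ℓ
  Clause e h (φ , ψ) = 𝕂.Sat φ e × 𝔾.Sat ψ h

  HoldsClauses : ∀ {kc gc} → Clauses kc gc → FieldEnv U kc → OrderEnv U gc → Set ℓ
  HoldsClauses D e h = Any (Clause e h) D

  trueᴳ-holds : ∀ {gc} (h : OrderEnv U gc) → 𝔾.Sat trueᴳ h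
  trueᴳ-holds _ = ValuedVectorSpace.∞ U , Setoid.refl (Structure.sort (colouredOrder U) Unit.tt)

  trueᴷ-holds : ∀ {kc} (e : FieldEnv U kc) → 𝕂.Sat trueᴷ e
  trueᴷ-holds _ = Field.refl (ValuedVectorSpace.K U)

  clauses-existsᴷ : ∀ {kc gc} {e : FieldEnv U kc} {h : OrderEnv U gc} D → HoldsClauses (existsᴷ D) e h ⇔ ∃ λ k → HoldsClauses D (k ∷ e) h
  clauses-existsᴷ D = mk⇔ (f D) (λ { (k , p) → AnyP.map⁺ (Any.map (λ { (q , q′) → (k , q) , q′ }) p) })
    where
    f : ∀ {kc gc} {e : FieldEnv U kc} {h : OrderEnv U gc} D → HoldsClauses (existsᴷ D) e h → ∃ λ k → HoldsClauses D (k ∷ e) h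
    f (_ ∷ D) (here ((k , q) , q′)) = k , here (q , q′)
    f (_ ∷ D) (there p) = let k , q = f D p in k , there q

  module _ {kc gc} {e : FieldEnv U kc} {h : OrderEnv U gc} where

    clauses-field : ∀ {φ} → HoldsClauses (fieldClause φ) e h ⇔ 𝕂.Sat φ e
    clauses-field = mk⇔ (λ { (here (p , _)) → p }) (λ p → here (p , trueᴳ-holds h))

    clauses-order : ∀ {ψ} → HoldsClauses (orderClause ψ) e h ⇔ 𝔾.Sat ψ h
    clauses-order = mk⇔ (λ { (here (_ , p)) → p }) (λ p → here (trueᴷ-holds e , p))

    clauses-∪ : ∀ D E → HoldsClauses (D ∪ E) e h ⇔ (HoldsClauses D e h ⊎ HoldsClauses E e h)
    clauses-∪ D E = mk⇔ (AnyP.++⁻ D) (λ { (inj₁ p) → AnyP.++⁺ˡ p ; (inj₂ p) → AnyP.++⁺ʳ D p })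

    clauses-∩ : ∀ D E → HoldsClauses (D ∩ E) e h ⇔ (HoldsClauses D e h × HoldsClauses E e h)
    clauses-∩ D E = mk⇔
      (AnyP.cartesianProductWith⁻ _ (λ { ((p , p′) , (q , q′)) → (p , q) , (p′ , q′) }) D E)
      (λ { (p , q) → AnyP.cartesianProductWith⁺ _
             (λ { (p , q) (p′ , q′) → (p , p′) , (q , q′) }) p q })

    clauses-complement : ∀ D → HoldsClauses (complement D) e h ⇔ (¬ HoldsClauses D e h)
    clauses-complement [] = mk⇔ (λ _ ()) (λ _ → from clauses-order (trueᴳ-holds h))
    clauses-complement ((φ , ψ) ∷ D) = mk⇔
      (λ p → λ { (here (q , q′)) → refute (to (clauses-∪ (fieldClause (¬′ φ)) _)
                                   (proj₁ (to (clauses-∩ first (complement D)) p))) q q′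
               ; (there q) → to (clauses-complement D) (proj₂ (to (clauses-∩ first (complement D)) p)) q })
      (λ p → from (clauses-∩ first (complement D))
        (from (clauses-∪ (fieldClause (¬′ φ)) _) (choose (λ q q′ → p (here (q , q′))))
        , from (clauses-complement D) (p ∘ there)))
      where
      open Syntax
      first = fieldClause (¬′ φ) ∪ orderClause (¬′ ψ)
      refute : HoldsClauses (fieldClause (¬′ φ)) e h ⊎ HoldsClauses (orderClause (¬′ ψ)) e h →
        𝕂.Sat φ e → 𝔾.Sat ψ h → ⊥
      refute (inj₁ p) q _ = to clauses-field p q
      refute (inj₂ p) _ q = to clauses-order p q
      choose : (𝕂.Sat φ e → 𝔾.Sat ψ h → ⊥) →
        HoldsClauses (fieldClause (¬′ φ)) e h ⊎ HoldsClauses (orderClause (¬′ ψ)) e h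
      choose p with em {𝕂.Sat φ e}
      ... | yes q = inj₂ (from clauses-order (p q))
      ... | no ¬q = inj₁ (from clauses-field ¬q)

    clauses-existsᴳ : ∀ D → HoldsClauses (existsᴳ D) e h ⇔ ∃ λ γ → HoldsClauses D e (γ ∷ h)
    clauses-existsᴳ D = mk⇔ (f D) (λ { (γ , p) → AnyP.map⁺ (Any.map (λ { (q , q′) → q , γ , q′ }) p) })
      where
      f : ∀ D → HoldsClauses (existsᴳ D) e h → ∃ λ γ → HoldsClauses D e (γ ∷ h)
      f (_ ∷ D) (here (q , γ , q′)) = γ , here (q , q′)
      f (_ ∷ D) (there p) = let γ , q = f D p in γ , there q

    clauses-existsᴷ* : ∀ {n} D → HoldsClauses (existsᴷ* {n} D) e h ⇔
      ∃ λ (ks : Vector (ValuedVectorSpace.Scalar U) n) → HoldsClauses D (push ks e) h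
    clauses-existsᴷ* {zero}  D = mk⇔ (λ p → (λ ()) , p) proj₂
    clauses-existsᴷ* {suc n} D = mk⇔
      (λ p → let ks , q = to (clauses-existsᴷ* {n} (existsᴷ D)) p
                 k , r = to (clauses-existsᴷ D) q in (k ◃ ks) , r)
      (λ { (ks , p) → from (clauses-existsᴷ* {n} (existsᴷ D)) (tail ks , from (clauses-existsᴷ D) (head ks , p)) })

    clauses-meet : ∀ {n} (D : Fin n → Clauses kc gc) → HoldsClauses (meet D) e h ⇔ (∀ i → HoldsClauses (D i) e h)
    clauses-meet {zero}  D = mk⇔ (λ _ ()) (λ _ → from clauses-order (trueᴳ-holds h))
    clauses-meet {suc n} D = mk⇔
      (λ p → let q , r = to (clauses-∩ (D zero) (meet (D ∘ suc))) p in
             λ { zero → q ; (suc i) → to (clauses-meet (D ∘ suc)) r i })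
      (λ p → from (clauses-∩ (D zero) (meet (D ∘ suc))) (p zero , from (clauses-meet (D ∘ suc)) (p ∘ suc)))

    clauses-join : ∀ {n} (D : Fin n → Clauses kc gc) → HoldsClauses (join D) e h ⇔ (∃ λ i → HoldsClauses (D i) e h)
    clauses-join {zero}  D = mk⇔ (λ ()) (λ { (() , _) })
    clauses-join {suc n} D = mk⇔
      (λ p → f (to (clauses-∪ (D zero) (join (D ∘ suc))) p))
      (λ { (zero , p)  → from (clauses-∪ (D zero) (join (D ∘ suc))) (inj₁ p)
         ; (suc i , p) → from (clauses-∪ (D zero) (join (D ∘ suc))) (inj₂ (from (clauses-join (D ∘ suc)) (i , p))) })
      where
      f : HoldsClauses (D zero) e h ⊎ HoldsClauses (join (D ∘ suc)) e h → ∃ λ i → HoldsClauses (D i) e h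
      f (inj₁ p) = zero , p
      f (inj₂ p) = let i , q = to (clauses-join (D ∘ suc)) p in suc i , q

module _ {ℓ : Level} (U : ValuedVectorSpace ℓ) where
  open ValuedVectorSpace U

  Holds : ∀ {kc gc} → PairFormula kc gc → FieldEnv U kc → OrderEnv U gc → Set ℓ
  Holds (inᴷ φ)   e h = Semantics.Sat (fieldStructure K) φ e
  Holds (inᴳ ψ)   e h = Semantics.Sat (colouredOrder U) ψ h
  Holds (D ∧ E)   e h = Holds D e h × Holds E e h
  Holds (D ∨ E)   e h = Holds D e h ⊎ Holds E e h
  Holds (∼ D)     e h = ¬ Holds D e h
  Holds (⋀ D)     e h = ∀ i → Holds (D i) e h
  Holds (⋁ D)     e h = ∃ λ i → Holds (D i) e h
  Holds (∃ᴷ* n D) e h = ∃ λ (ks : Vector Scalar n) → Holds D (push ks e) h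
  Holds (∃ᴳ D)    e h = ∃ λ (γ : Value) → Holds D e (γ ∷ h)

module _ {ℓ : Level} (em : ExcludedMiddle ℓ) (U : ValuedVectorSpace ℓ) where
  open Truth em U

  holds-normalise : ∀ {kc gc} (D : PairFormula kc gc) e h →
    Holds U D e h ⇔ HoldsClauses (normalise D) e h
  holds-normalise (inᴷ φ) e h = ⇔.sym clauses-field
  holds-normalise (inᴳ ψ) e h = ⇔.sym clauses-order
  holds-normalise (D ∧ E) e h = ⇔.trans
    (holds-normalise D e h ×-⇔ holds-normalise E e h) (⇔.sym (clauses-∩ (normalise D) (normalise E)))
  holds-normalise (D ∨ E) e h = ⇔.trans
    (holds-normalise D e h ⊎-⇔ holds-normalise E e h) (⇔.sym (clauses-∪ (normalise D) (normalise E)))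
  holds-normalise (∼ D) e h = ⇔.trans
    (¬-⇔ (holds-normalise D e h)) (⇔.sym (clauses-complement (normalise D)))
  holds-normalise (⋀ D) e h = ⇔.trans
    (∀-⇔ λ i → holds-normalise (D i) e h) (⇔.sym (clauses-meet _))
  holds-normalise (⋁ D) e h = ⇔.trans
    (∃-⇔ λ i → holds-normalise (D i) e h) (⇔.sym (clauses-join _))
  holds-normalise (∃ᴷ* n D) e h = ⇔.trans
    (∃-⇔ λ ks → holds-normalise D (push ks e) h) (⇔.sym (clauses-existsᴷ* {n = n} (normalise D)))
  holds-normalise (∃ᴳ D) e h = ⇔.trans
    (∃-⇔ λ γ → holds-normalise D e (γ ∷ h)) (⇔.sym (clauses-existsᴳ (normalise D)))

-- The two parts of a clause have separate parameters, so each hypothesis applies to its own part of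
-- the same clause.
clauses-transfer : ∀ {ℓ} (em : ExcludedMiddle ℓ) (U U′ : ValuedVectorSpace ℓ) {f g} →
  Elementary (fieldStructure (ValuedVectorSpace.K U)) (fieldStructure (ValuedVectorSpace.K U′)) f →
  Elementary (colouredOrder U) (colouredOrder U′) g →
  ∀ {kc gc} (D : Clauses kc gc) e h →
  Truth.HoldsClauses em U D e h ⇔ Truth.HoldsClauses em U′ D (All.map (λ {s} → f s) e) (All.map (λ {s} → g s) h)
clauses-transfer em U U′ elF elG D e h = mk⇔
  (Any.map (λ { {φ , ψ} (p , q) → to (elF φ e) p , to (elG ψ h) q }))
  (Any.map (λ { {φ , ψ} (p , q) → from (elF φ e) p , from (elG ψ h) q }))

holds-transfer : ∀ {ℓ} (em : ExcludedMiddle ℓ) (U U′ : ValuedVectorSpace ℓ) {f g} →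
  Elementary (fieldStructure (ValuedVectorSpace.K U)) (fieldStructure (ValuedVectorSpace.K U′)) f →
  Elementary (colouredOrder U) (colouredOrder U′) g →
  ∀ {kc gc} (D : PairFormula kc gc) e h →
  Holds U D e h ⇔ Holds U′ D (All.map (λ {s} → f s) e) (All.map (λ {s} → g s) h)
holds-transfer em U U′ elF elG D e h = ⇔.trans (holds-normalise em U D e h) (⇔.trans
  (clauses-transfer em U U′ elF elG (normalise D) e h) (⇔.sym (holds-normalise em U′ D _ _)))

-- Elimination of vectors

-- `nought` is the coordinate of an older vector along a basis vector added later, and `one` that of
-- a new vector along its own basis vector.
data Coefficient (kc : Tags) : Set where
  nought one : Coefficient kc
  var        : Unit.tt ∈ kc → Coefficient kc

-- A vector is described by its coordinates in a separated basis of length n.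
Symbol : ℕ → Tags → Tags → VSort → Set
Symbol n kc gc vector = Fin n → Coefficient kc
Symbol n kc gc scalar = Coefficient kc
Symbol n kc gc value  = Unit.tt ∈ gc

Assignment : ℕ → Tags → Tags → List VSort → Set
Assignment n kc gc Γ = ∀ s → s ∈ Γ → Symbol n kc gc s

_▹_ : ∀ {n kc gc Γ s} → Symbol n kc gc s → Assignment n kc gc Γ → Assignment n kc gc (s ∷ Γ)
(y ▹ σ) _ (here refl) = y
(y ▹ σ) s (there x)   = σ s x

coefficient : ∀ {kc} → Coefficient kc → Syntax.Term L-field kc Unit.tt
coefficient nought  = Syntax.app nought (λ ())
coefficient one     = Syntax.app one (λ ())
coefficient (var x) = Syntax.var x

renameCoefficient : ∀ {kc kc′} → (Unit.tt ∈ kc → Unit.tt ∈ kc′) → Coefficient kc → Coefficient kc′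
renameCoefficient f nought  = nought
renameCoefficient f one     = one
renameCoefficient f (var x) = var (f x)

renameSymbol : ∀ {n kc kc′ gc gc′} → (Unit.tt ∈ kc → Unit.tt ∈ kc′) → (Unit.tt ∈ gc → Unit.tt ∈ gc′) →
  ∀ s → Symbol n kc gc s → Symbol n kc′ gc′ s
renameSymbol f g vector c = renameCoefficient f ∘ c
renameSymbol f g scalar c = renameCoefficient f c
renameSymbol f g value  x = g x

padSymbol : ∀ {n kc gc} s → Symbol n kc gc s → Symbol (suc n) kc gc s
padSymbol vector c = nought ◃ c
padSymbol scalar c = c
padSymbol value  x = x

assignScalar : ∀ {n kc gc Γ} → Assignment n kc gc Γ → Assignment n (Unit.tt ∷ kc) gc (scalar ∷ Γ)
assignScalar σ = var (here refl) ▹ (λ s → renameSymbol there id s ∘ σ s)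

assignValue : ∀ {n kc gc Γ} → Assignment n kc gc Γ → Assignment n kc (Unit.tt ∷ gc) (value ∷ Γ)
assignValue σ = here refl ▹ (λ s → renameSymbol id there s ∘ σ s)

assignVector : ∀ {n kc gc Γ} → Assignment n kc gc Γ →
  Assignment n (extend {n = n} (λ _ → Unit.tt) kc) gc (vector ∷ Γ)
assignVector σ = (var ∘ fresh) ▹ (λ s → renameSymbol old id s ∘ σ s)

-- The new vector needs a new basis vector, which is put in front with coordinate 1.
assignNewVector : ∀ {n kc gc Γ} → Assignment n kc gc Γ →
  Assignment (suc n) (extend {n = n} (λ _ → Unit.tt) kc) (Unit.tt ∷ gc) (vector ∷ Γ)
assignNewVector σ = (one ◃ (var ∘ fresh)) ▹ (λ s → padSymbol s ∘ renameSymbol old there s ∘ σ s)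

newValue : ∀ {n gc} → (Fin n → Unit.tt ∈ gc) → Fin (suc n) → Unit.tt ∈ (Unit.tt ∷ gc)
newValue g = here refl ◃ (there ∘ g)

module Definability {ℓ : Level} (em : ExcludedMiddle ℓ) where

  Str : ValuedVectorSpace ℓ → Structure L-Wλ ℓ
  Str = valuedStructure em

  Env : ValuedVectorSpace ℓ → List VSort → Set ℓ
  Env U = All (Structure.∣_∣ (Str U))

  Predicate : List VSort → Set (lsuc ℓ)
  Predicate Γ = ∀ U → Env U Γ → Set ℓ

  module Realization (U : ValuedVectorSpace ℓ) where
    open ValuedVectorSpace U
    open Valuation em U using (Separated)
    open Structure (Str U) using (∣_∣)
    open LinearAlgebra em K V using (combination-congˡ; combination-head≈0; combination-head≈1)
    private
      module K = Field K
      module Γ = StrictTotalOrder Γ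

    ⟦_⟧ : ∀ {kc} → Coefficient kc → FieldEnv U kc → Scalar
    ⟦ c ⟧ e = Semantics.⟦_⟧ (fieldStructure K) (coefficient c) e

    Represents : ∀ {n kc gc} → Vector Carrierᴹ n → FieldEnv U kc → OrderEnv U gc →
      ∀ s → Symbol n kc gc s → ∣ s ∣ → Set ℓ
    Represents b e h vector c v = v ≈ᴹ combination (λ i → ⟦ c i ⟧ e) b
    Represents b e h scalar c k = k ≈ᴷ ⟦ c ⟧ e
    Represents b e h value  x γ = γ ≈ⱽ All.lookup h x

    -- The environment in coordinates, where `g` names for each basis vector an order variable
    -- holding its value. Basis vectors of equal value may have different variables; their equality
    -- is tested by the formula.
    record Realizes {n kc gc Γ} (σ : Assignment n kc gc Γ) (g : Fin n → Unit.tt ∈ gc)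
                    (b : Vector Carrierᴹ n) (e : FieldEnv U kc) (h : OrderEnv U gc)
                    (ρ : Env U Γ) : Set ℓ where
      field
        separated  : Separated b
        values     : ∀ i → val (b i) ≈ⱽ All.lookup h (g i)
        represents : ∀ s x → Represents b e h s (σ s x) (All.lookup ρ x)

    ⟦rename⟧ : ∀ {kc kc′} (f : Unit.tt ∈ kc → Unit.tt ∈ kc′) {e : FieldEnv U kc} {e′} →
      (∀ x → All.lookup e′ (f x) ≡ All.lookup e x) →
      ∀ c → ⟦ renameCoefficient f c ⟧ e′ ≈ᴷ ⟦ c ⟧ e
    ⟦rename⟧ f eq nought  = K.refl
    ⟦rename⟧ f eq one     = K.refl
    ⟦rename⟧ f eq (var x) = K.reflexive (eq x)

    represents-rename : ∀ {n kc kc′ gc gc′} (f : Unit.tt ∈ kc → Unit.tt ∈ kc′)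
      (f′ : Unit.tt ∈ gc → Unit.tt ∈ gc′) {b : Vector Carrierᴹ n} {e e′ h h′} →
      (∀ x → All.lookup e′ (f x) ≡ All.lookup e x) →
      (∀ x → All.lookup h′ (f′ x) ≡ All.lookup h x) →
      ∀ s y {v} → Represents b e h s y v → Represents b e′ h′ s (renameSymbol f f′ s y) v
    represents-rename f f′ {b} eq eq′ vector c r =
      ≈ᴹ-trans r (combination-congˡ {b = b} (λ i → K.sym (⟦rename⟧ f eq (c i))))
    represents-rename f f′ eq eq′ scalar c r = K.trans r (K.sym (⟦rename⟧ f eq c))
    represents-rename f f′ eq eq′ value  x r = Γ.Eq.trans r (Γ.Eq.reflexive (sym (eq′ x)))

    represents-pad : ∀ {n kc gc} {b : Vector Carrierᴹ n} r {e : FieldEnv U kc} {h : OrderEnv U gc} →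
      ∀ s y {v} → Represents b e h s y v → Represents (r ◃ b) e h s (padSymbol s y) v
    represents-pad {b = b} r {e} vector c eq =
      ≈ᴹ-trans eq (≈ᴹ-sym (combination-head≈0 (λ i → ⟦ (nought ◃ c) i ⟧ e) (r ◃ b) K.refl))
    represents-pad r scalar c eq = eq
    represents-pad r value  x eq = eq

    represents-∷ : ∀ {n kc gc Γ s} {b : Vector Carrierᴹ n} {e : FieldEnv U kc} {h : OrderEnv U gc}
      {y : Symbol n kc gc s} {σ : Assignment n kc gc Γ} {v} {ρ : Env U Γ} →
      Represents b e h s y v → (∀ t x → Represents b e h t (σ t x) (All.lookup ρ x)) →
      ∀ t x → Represents b e h t ((y ▹ σ) t x) (All.lookup (v ∷ ρ) x)
    represents-∷ r rs _ (here refl) = r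
    represents-∷ r rs t (there x)   = rs t x

    module _ {n kc gc Γ} {σ : Assignment n kc gc Γ} {g : Fin n → Unit.tt ∈ gc}
             {b : Vector Carrierᴹ n} {e : FieldEnv U kc} {h : OrderEnv U gc} {ρ : Env U Γ}
             (r : Realizes σ g b e h ρ) where
      open Realizes r

      realizes-scalar : ∀ k → Realizes (assignScalar σ) g b (k ∷ e) h (k ∷ ρ)
      realizes-scalar k = record
        { separated = separated
        ; values = values
        ; represents = represents-∷ K.refl
            λ s x → represents-rename there id (λ _ → refl) (λ _ → refl) s (σ s x) (represents s x)
        }

      realizes-value : ∀ γ → Realizes (assignValue σ) (there ∘ g) b e (γ ∷ h) (γ ∷ ρ)
      realizes-value γ = record
        { separated = separated
        ; values = values
        ; represents = represents-∷ Γ.Eq.refl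
            λ s x → represents-rename id there (λ _ → refl) (λ _ → refl) s (σ s x) (represents s x)
        }

      combination-fresh : (ks : Vector Scalar n) →
        combination ks b ≈ᴹ combination (λ i → ⟦ var (fresh i) ⟧ (push ks e)) b
      combination-fresh ks = combination-congˡ {b = b} (λ i → K.reflexive (sym (lookup-fresh ks e i)))

      realizes-vector : ∀ ks x → x ≈ᴹ combination ks b →
        Realizes (assignVector σ) g b (push ks e) h (x ∷ ρ)
      realizes-vector ks x x≈ = record
        { separated = separated
        ; values = values
        ; represents = represents-∷ (≈ᴹ-trans x≈ (combination-fresh ks))
            λ s y → represents-rename old id (lookup-old ks e) (λ _ → refl) s (σ s y) (represents s y)
        }

      realizes-newVector : ∀ ks x v γ → x ≈ᴹ v +ᴹ combination ks b → val v ≈ⱽ γ → Separated (v ◃ b) →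
        Realizes (assignNewVector σ) (newValue g) (v ◃ b) (push ks e) (γ ∷ h) (x ∷ ρ)
      realizes-newVector ks x v γ x≈ v≈γ sep = record
        { separated = sep
        ; values = λ { zero → v≈γ ; (suc i) → values i }
        ; represents = represents-∷
            (≈ᴹ-trans x≈ (≈ᴹ-trans (+ᴹ-congˡ (combination-fresh ks))
              (≈ᴹ-sym (combination-head≈1
                (λ i → ⟦ (one ◃ (var ∘ fresh)) i ⟧ (push ks e)) (v ◃ b) K.refl))))
            λ s y → represents-pad v s (renameSymbol old there s (σ s y))
              (represents-rename old there (lookup-old ks e) (λ _ → refl) s (σ s y) (represents s y))
        }

  open Realization using (Realizes; Represents)

  -- Once vectors are described by coordinates in a separated basis, P is
  -- expressed by one formula about K and Γ, the same for all U.
  record Definable Γ (P : Predicate Γ) : Set (lsuc ℓ) where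
    constructor definable
    field
      formula : ∀ {n kc gc} → Assignment n kc gc Γ → (Fin n → Unit.tt ∈ gc) → PairFormula kc gc
      correct : ∀ {n kc gc} (σ : Assignment n kc gc Γ) (g : Fin n → Unit.tt ∈ gc) U {b e h ρ} →
        Realizes U σ g b e h ρ → P U ρ ⇔ Holds U (formula σ g) e h

  open Definable

  definable-resp : ∀ {Γ} {P Q : Predicate Γ} → (∀ U ρ → P U ρ ⇔ Q U ρ) →
    Definable Γ P → Definable Γ Q
  definable-resp P⇔Q D = definable (formula D) λ σ g U r →
    ⇔.trans (⇔.sym (P⇔Q U _)) (correct D σ g U r)

  definable-¬ : ∀ {Γ} {P : Predicate Γ} → Definable Γ P → Definable Γ (λ U ρ → ¬ P U ρ)
  definable-¬ D = definable (λ σ g → ∼ formula D σ g) λ σ g U r → ¬-⇔ (correct D σ g U r)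

  definable-× : ∀ {Γ} {P Q : Predicate Γ} → Definable Γ P → Definable Γ Q →
    Definable Γ (λ U ρ → P U ρ × Q U ρ)
  definable-× D E = definable (λ σ g → formula D σ g ∧ formula E σ g) λ σ g U r →
    correct D σ g U r ×-⇔ correct E σ g U r

  definable-⊎ : ∀ {Γ} {P Q : Predicate Γ} → Definable Γ P → Definable Γ Q →
    Definable Γ (λ U ρ → P U ρ ⊎ Q U ρ)
  definable-⊎ D E = definable (λ σ g → formula D σ g ∨ formula E σ g) λ σ g U r →
    correct D σ g U r ⊎-⇔ correct E σ g U r

  definable-→ : ∀ {Γ} {P Q : Predicate Γ} → Definable Γ P → Definable Γ Q →
    Definable Γ (λ U ρ → P U ρ → Q U ρ)
  definable-→ {P = P} {Q} D E = definable-resp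
    (λ U ρ → mk⇔ (λ { (inj₁ ¬p) p → ⊥-elim (¬p p) ; (inj₂ q) _ → q }) (f U ρ))
    (definable-⊎ (definable-¬ D) E)
    where
    f : ∀ U ρ → (P U ρ → Q U ρ) → ¬ P U ρ ⊎ Q U ρ
    f U ρ i with em {P U ρ}
    ... | yes p = inj₂ (i p)
    ... | no ¬p = inj₁ ¬p

  definable-⋀ : ∀ {Γ n} {P : Fin n → Predicate Γ} → (∀ i → Definable Γ (P i)) →
    Definable Γ (λ U ρ → ∀ i → P i U ρ)
  definable-⋀ D = definable (λ σ g → ⋀ (λ i → formula (D i) σ g)) λ σ g U r →
    ∀-⇔ λ i → correct (D i) σ g U r

  definable-reindex : ∀ {Γ Δ} {P : Predicate Γ} (r : ∀ s → s ∈ Γ → s ∈ Δ)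
    (f : ∀ U → Env U Δ → Env U Γ) →
    (∀ U ρ s (x : s ∈ Γ) → All.lookup (f U ρ) x ≡ All.lookup ρ (r s x)) →
    Definable Γ P → Definable Δ (λ U ρ → P U (f U ρ))
  definable-reindex r f eq D = definable (λ σ g → formula D (λ s → σ s ∘ r s) g)
    λ σ g U {b} {e} {h} {ρ} ϱ → let open Realizes ϱ in correct D (λ s → σ s ∘ r s) g U record
      { separated = separated
      ; values = values
      ; represents = λ s x → subst (Represents U b e h s (σ s (r s x))) (sym (eq U ρ s x))
          (represents s (r s x))
      }

  -- dim B y = j + the number of i with g i = y
  hasDimension : ∀ {n gc} → Unit.tt ∈ gc → (Fin n → Unit.tt ∈ gc) → ℕ → ∀ {kc} → PairFormula kc gc
  hasDimension {zero}  y g j = inᴳ (Syntax.rel (colour j) (λ _ → Syntax.var y))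
  hasDimension {suc n} y g j =
    (inᴳ (Syntax.var (head g) Syntax.≐ Syntax.var y) ∧ hasDimension y (tail g) (suc j)) ∨
    (inᴳ (Syntax.¬′ (Syntax.var (head g) Syntax.≐ Syntax.var y)) ∧ hasDimension y (tail g) j)

  -- The thinning records which `g i` hold the value of `y`. Each of its constructors singles out
  -- the one disjunct that can be true and adjusts the accumulator `j`.
  holds-hasDimension : ∀ (U : ValuedVectorSpace ℓ) {n k gc kc} {y : Unit.tt ∈ gc} {g : Fin n → Unit.tt ∈ gc} j
    {e : FieldEnv U kc} {h : OrderEnv U gc} (t : Thinning k n) →
    Picks t (λ i → ValuedVectorSpace._≈ⱽ_ U (All.lookup h (g i)) (All.lookup h y)) →
    Holds U (hasDimension y g j) e h ⇔ Linear.HasDimension (B U (All.lookup h y)) (k +ℕ j)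
  holds-hasDimension U j done pk = ⇔.refl
  holds-hasDimension U {k = suc k} {y = y} {g} j {h = h} (keep t) (p , pk) = mk⇔
    (λ { (inj₁ (_ , x)) → subst (Linear.HasDimension (B U (All.lookup h y))) (+-suc k j) (to rec x)
       ; (inj₂ (¬p , _)) → ⊥-elim (¬p p) })
    (λ x → inj₁ (p , from rec (subst (Linear.HasDimension (B U (All.lookup h y))) (sym (+-suc k j)) x)))
    where rec = holds-hasDimension U {y = y} {tail g} (suc j) t pk
  holds-hasDimension U {y = y} {g} j (skip t) (¬p , pk) = mk⇔
    (λ { (inj₁ (p , _)) → ⊥-elim (¬p p) ; (inj₂ (_ , x)) → to rec x })
    (λ x → inj₂ (¬p , from rec x))
    where rec = holds-hasDimension U {y = y} {tail g} j t pk

  module _ (U : ValuedVectorSpace ℓ) {n : ℕ} {gc kc : Tags} {b : Vector (ValuedVectorSpace.Carrierᴹ U) n}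
           {g : Fin n → Unit.tt ∈ gc} {h : OrderEnv U gc} where
    open ValuedVectorSpace U
    open Valuation em U using (Separated; separated-extends)
    private module Γ = StrictTotalOrder Γ

    -- The vectors of value `γ` are counted on the order variables, where the formula can see them,
    -- and the count is moved to `b` by `vals`.
    extension-formula : Separated b → (∀ i → val (b i) ≈ⱽ All.lookup h (g i)) →
      ∀ γ {e : FieldEnv U kc} → (∃ λ r → val r ≈ⱽ γ × Separated (r ◃ b)) ⇔
        Holds U (∼ hasDimension (here refl) (there ∘ g) 0) e (γ ∷ h)
    extension-formula sep vals γ =
      let k , t , pk = thinning em (λ i → All.lookup h (g i) ≈ⱽ γ)
          ext = separated-extends sep t (picks-resp t (λ i → Γ.Eq.trans (vals i))
                  (λ i → Γ.Eq.trans (Γ.Eq.sym (vals i))) pk)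
          dim = holds-hasDimension U {y = here refl} {there ∘ g} 0 {h = γ ∷ h} t pk
          k+0 = +-identityʳ k
      in mk⇔ (λ x d → to ext x (subst (Linear.HasDimension (B U γ)) k+0 (to dim d)))
             (λ ¬d → from ext (λ d → ¬d (from dim (subst (Linear.HasDimension (B U γ)) (sym k+0) d))))

  -- For a vector, the first disjunct is the case that it lies in the span of the basis. Otherwise
  -- its remainder joins the basis with coordinate 1; the formula quantifies only over the value of
  -- the remainder and demands that some vector of this value extend the basis.
  definable-∃ : ∀ {Γ} s {P : Predicate (s ∷ Γ)} → Definable (s ∷ Γ) P →
    Definable Γ (λ U ρ → ∃ λ x → P U (x ∷ ρ))
  definable-∃ scalar D = definable
    (λ σ g → ∃ᴷ* 1 (formula D (assignScalar σ) g))
    λ σ g U r → let r⁺ = Realization.realizes-scalar U r in mk⇔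
      (λ { (k , p) → (λ _ → k) , to (correct D (assignScalar σ) g U (r⁺ k)) p })
      (λ { (ks , p) → ks zero , from (correct D (assignScalar σ) g U (r⁺ (ks zero))) p })
  definable-∃ value D = definable
    (λ σ g → ∃ᴳ (formula D (assignValue σ) (there ∘ g)))
    λ σ g U r → let r⁺ = Realization.realizes-value U r in mk⇔
      (λ { (γ , p) → γ , to (correct D (assignValue σ) (there ∘ g) U (r⁺ γ)) p })
      (λ { (γ , p) → γ , from (correct D (assignValue σ) (there ∘ g) U (r⁺ γ)) p })
  definable-∃ vector {P} D = definable
    (λ {n} σ g → ∃ᴷ* n (formula D (assignVector σ) g) ∨
      ∃ᴳ (∃ᴷ* n (∼ hasDimension (here refl) (there ∘ g) 0 ∧ formula D (assignNewVector σ) (newValue g))))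
    λ σ g U {b} {ρ = ρ} r →
      let open Realizes r
          open ValuedVectorSpace U
          open Valuation em U using (Separated; approximate)
          module ΓU = StrictTotalOrder (ValuedVectorSpace.Γ U)
          r⁰ = Realization.realizes-vector U r
          r⁺ = Realization.realizes-newVector U r
          into : (∃ λ x → P U (x ∷ ρ)) → _
          into = λ { (x , p) → let ks , v , x≈ , c = approximate separated x in Sum.map
            (λ v≈0 → ks , to (correct D (assignVector σ) g U (r⁰ ks x
              (≈ᴹ-trans x≈ (≈ᴹ-trans (+ᴹ-congʳ v≈0) (+ᴹ-identityˡ _))))) p)
            (λ sep → val v , ks
              , to (extension-formula U separated values (val v)) (v , ΓU.Eq.refl , sep)
              , to (correct D (assignNewVector σ) (newValue g) U (r⁺ ks x v (val v) x≈ ΓU.Eq.refl sep)) p)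
            c }
      in mk⇔ into λ
        { (inj₁ (ks , q)) → combination ks b ,
            from (correct D (assignVector σ) g U (r⁰ ks _ ≈ᴹ-refl)) q
        -- Any `v` of value `γ` extending the basis will do, because `D` is correct for every
        -- realization.
        ; (inj₂ (γ , ks , ¬dim , q)) →
            let v , v≈γ , sep = from (extension-formula U separated values γ) ¬dim in
            v +ᴹ combination ks b ,
            from (correct D (assignNewVector σ) (newValue g) U (r⁺ ks _ v γ ≈ᴹ-refl v≈γ sep)) q }

  record Realized U {Γ} (ρ : Env U Γ) : Set ℓ where
    constructor realized
    field
      {n}   : ℕ
      {kc}  : Tags
      {gc}  : Tags
      {σ}   : Assignment n kc gc Γ
      {g}   : Fin n → Unit.tt ∈ gc
      {b}   : Vector (ValuedVectorSpace.Carrierᴹ U) n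
      {e}   : FieldEnv U kc
      {h}   : OrderEnv U gc
      realizes : Realizes U σ g b e h ρ

  -- Each vector is approximated by the basis built so far, and a nonzero remainder becomes the next
  -- basis vector.
  realize : ∀ U {Γ} (ρ : Env U Γ) → Realized U ρ
  realize U [] = realized {n = 0} {[]} {[]} {λ _ ()} {λ ()} {λ ()} {[]} {[]} record
    { separated = _ ; values = λ () ; represents = λ _ () }
  realize U {scalar ∷ Γ} (k ∷ ρ) with realize U ρ
  ... | realized r = realized (Realization.realizes-scalar U r k)
  realize U {value ∷ Γ} (γ ∷ ρ) with realize U ρ
  ... | realized r = realized (Realization.realizes-value U r γ)
  realize U {vector ∷ Γ} (x ∷ ρ) with realize U ρ
  ... | realized r with Valuation.approximate em U (Realizes.separated r) x
  ...   | ks , v , x≈ , inj₁ v≈0 = realized (Realization.realizes-vector U r ks x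
            (≈ᴹ-trans x≈ (≈ᴹ-trans (+ᴹ-congʳ v≈0) (+ᴹ-identityˡ _))))
    where open ValuedVectorSpace U
  ...   | ks , v , x≈ , inj₂ sep = realized (Realization.realizes-newVector U r ks x v _ x≈
            (StrictTotalOrder.Eq.refl (ValuedVectorSpace.Γ U)) sep)

-- Definability of the terms and formulas of the language

module DefinableFunctions {ℓ : Level} (em : ExcludedMiddle ℓ) where
  open Definability em
  open Realization using (Realizes)
  open Signature L-Wλ

  definable-∃* : ∀ {n} (d : Vector VSort n) {Γ} {P : Predicate (extend d Γ)} →
    Definable (extend d Γ) P →
    Definable Γ (λ U ρ → Σ (∀ i → Structure.∣_∣ (Str U) (d i)) λ ys → P U (push ys ρ))
  definable-∃* {zero}  d D = definable-resp (λ U ρ → mk⇔ (λ p → (λ ()) , p) proj₂) D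
  definable-∃* {suc n} d D = definable-resp
    (λ U ρ → mk⇔ (λ { (ys , y , p) → ∀-cons y ys , p }) (λ { (ys , p) → ys ∘ suc , ys zero , p }))
    (definable-∃* (tail d) (definable-∃ (head d) D))

  -- Looking up a pushed tuple returns it only pointwise; respect for pointwise equality of tuples
  -- replaces function extensionality.
  definable-∃-fresh : ∀ {n} (d : Vector VSort n) {Γ}
    (Q : ∀ U → (∀ i → Structure.∣_∣ (Str U) (d i)) → Env U Γ → Set ℓ) →
    (∀ U ρ {ys zs} → (∀ i → ys i ≡ zs i) → Q U ys ρ → Q U zs ρ) →
    Definable (extend d Γ) (λ U ρ → Q U (λ i → All.lookup ρ (fresh i)) (drop ρ)) →
    Definable Γ (λ U ρ → Σ (∀ i → Structure.∣_∣ (Str U) (d i)) λ ys → Q U ys ρ)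
  definable-∃-fresh d Q resp D = definable-resp
    (λ U ρ → mk⇔
      (λ { (ys , q) → ys , subst (Q U ys) (drop-push ys ρ) (resp U _ (lookup-fresh ys ρ) q) })
      (λ { (ys , q) → ys , resp U _ (sym ∘ lookup-fresh ys ρ)
                             (subst (Q U ys) (sym (drop-push ys ρ)) q) }))
    (definable-∃* d D)

  definable-∀-fresh : ∀ {n} (d : Vector VSort n) {Γ}
    (Q : ∀ U → (∀ i → Structure.∣_∣ (Str U) (d i)) → Env U Γ → Set ℓ) →
    (∀ U ρ {ys zs} → (∀ i → ys i ≡ zs i) → Q U ys ρ → Q U zs ρ) →
    Definable (extend d Γ) (λ U ρ → Q U (λ i → All.lookup ρ (fresh i)) (drop ρ)) →
    Definable Γ (λ U ρ → ∀ ys → Q U ys ρ)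
  definable-∀-fresh d Q resp D = definable-resp
    (λ U ρ → mk⇔ (λ ¬∃¬ ys → decidable-stable em (λ ¬q → ¬∃¬ (ys , ¬q))) (λ q → λ { (ys , ¬q) → ¬q (q ys) }))
    (definable-¬ (definable-∃-fresh d (λ U ys ρ → ¬ Q U ys ρ)
      (λ U ρ eq ¬q → ¬q ∘ resp U ρ (sym ∘ eq)) (definable-¬ D)))

  Function : List VSort → VSort → Set (lsuc ℓ)
  Function Γ s = ∀ U → Env U Γ → Structure.∣_∣ (Str U) s

  -- Functions are handled through their graphs because an assignment gives symbols to variables
  -- only: the value of a vector, for instance, is in general not among the order variables.
  record DefinableFunction Γ s (F : Function Γ s) : Set (lsuc ℓ) where
    constructor definableFunction
    field
      graph : Definable (s ∷ Γ)
        (λ U ρ → Structure.Eq (Str U) s (F U (All.tail ρ)) (All.lookup ρ (here refl)))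

  open DefinableFunction

  record Weakening (Γ Δ : List VSort) : Set (lsuc ℓ) where
    constructor weakening
    field
      embed    : ∀ s → s ∈ Γ → s ∈ Δ
      restrict : ∀ U → Env U Δ → Env U Γ
      lookup-restrict : ∀ U ρ s (x : s ∈ Γ) → All.lookup (restrict U ρ) x ≡ All.lookup ρ (embed s x)

  open Weakening

  dropping : ∀ {n} {d : Vector VSort n} {Γ} → Weakening Γ (extend d Γ)
  dropping = weakening (λ _ → old) (λ U → drop) (λ U ρ s → lookup-drop ρ)

  tailing : ∀ {s Γ} → Weakening Γ (s ∷ Γ)
  tailing = weakening (λ _ → there) (λ U → All.tail) (λ U ρ s → lookup-tail ρ)

  graph-at : ∀ {Γ Δ s} {F : Function Γ s} (w : Weakening Γ Δ) → DefinableFunction Γ s F →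
    (x : s ∈ Δ) →
    Definable Δ (λ U ρ → Structure.Eq (Str U) s (F U (restrict w U ρ)) (All.lookup ρ x))
  graph-at w D x = definable-reindex
    (λ { _ (here refl) → x ; t (there y) → embed w t y })
    (λ U ρ → All.lookup ρ x ∷ restrict w U ρ)
    (λ { U ρ _ (here refl) → refl ; U ρ t (there y) → lookup-restrict w U ρ t y })
    (graph D)

  weaken : ∀ {Γ Δ s} {F : Function Γ s} (w : Weakening Γ Δ) → DefinableFunction Γ s F →
    DefinableFunction Δ s (λ U ρ → F U (restrict w U ρ))
  weaken w D = definableFunction (graph-at (weakening (λ s → there ∘ embed w s) (λ U ρ → restrict w U (All.tail ρ))
    (λ U ρ s x → trans (lookup-restrict w U (All.tail ρ) s x) (lookup-tail ρ (embed w s x))))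
    D (here refl))

  -- Unnesting: the arguments are replaced by quantified variables that the graphs tie to them.
  definable-substitution : ∀ {n} (d : Vector VSort n) {Γ} {F : ∀ i → Function Γ (d i)} →
    (R : ∀ U → (∀ i → Structure.∣_∣ (Str U) (d i)) → Set ℓ) →
    (∀ U {xs ys} → (∀ i → Structure.Eq (Str U) (d i) (xs i) (ys i)) → R U xs → R U ys) →
    (∀ {Δ} (xs : ∀ i → d i ∈ Δ) → Definable Δ (λ U ρ → R U (λ i → All.lookup ρ (xs i)))) →
    (∀ i → DefinableFunction Γ (d i) (F i)) →
    Definable Γ (λ U ρ → R U (λ i → F i U ρ))
  definable-substitution d {F = F} R resp atom D = definable-resp
    (λ U ρ → mk⇔
      (λ { (ys , e , r) → resp U (λ i → Setoid.sym (Structure.sort (Str U) (d i)) (e i)) r })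
      (λ r → (λ i → F i U ρ) , (λ i → Setoid.refl (Structure.sort (Str U) (d i))) , r))
    (definable-∃-fresh d
      (λ U ys ρ → (∀ i → Structure.Eq (Str U) (d i) (F i U ρ) (ys i)) × R U ys)
      (λ U ρ eq → λ { (e , r) →
          (λ i → subst (Structure.Eq (Str U) (d i) (F i U ρ)) (eq i) (e i))
        , resp U (λ i → Setoid.reflexive (Structure.sort (Str U) (d i)) (eq i)) r })
      (definable-× (definable-⋀ (λ i → graph-at dropping (D i) (fresh i))) (atom fresh)))

  module Coordinates (U : ValuedVectorSpace ℓ) {n} {b : Vector (ValuedVectorSpace.Carrierᴹ U) n}
                     (sep : Valuation.Separated em U b) where
    open ValuedVectorSpace U
    open LinearAlgebra em K V
    open Valuation em U using (independent-≋)

    coordinates : ∀ {ks ls v w} → v ≈ᴹ combination ks b → w ≈ᴹ combination ls b →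
      v ≈ᴹ w ⇔ (∀ i → ks i ≈ᴷ ls i)
    coordinates {ks} {ls} v≈ w≈ = mk⇔
      (λ v≈w → independent-≋ sep ks ls (≈ᴹ-trans (≈ᴹ-sym v≈) (≈ᴹ-trans v≈w w≈)))
      (λ e → ≈ᴹ-trans v≈ (≈ᴹ-trans (combination-congˡ {b = b} e) (≈ᴹ-sym w≈)))

  ≈-cong : ∀ {c} (S : Setoid c ℓ) (let open Setoid S) {x x′ y y′} → x ≈ x′ → y ≈ y′ → x ≈ y ⇔ x′ ≈ y′
  ≈-cong S p q = mk⇔ (λ e → S.trans (S.sym p) (S.trans e q)) (λ e → S.trans p (S.trans e (S.sym q)))
    where module S = Setoid S

  module _ where
    open Syntax

    equation : ∀ {kc gc} → Coefficient kc → Coefficient kc → PairFormula kc gc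
    equation c c′ = inᴷ (coefficient c ≐ coefficient c′)

    binary : ∀ {kc gc} (f : FieldFun) → (∀ i → Coefficient kc) → Coefficient kc → PairFormula kc gc
    binary f cs c′ = inᴷ (app f (λ i → coefficient (cs i)) ≐ coefficient c′)

    sameValue : ∀ {kc gc} → Unit.tt ∈ gc → Unit.tt ∈ gc → PairFormula kc gc
    sameValue x y = inᴳ (var x ≐ var y)

    lessValue : ∀ {kc gc} → Unit.tt ∈ gc → Unit.tt ∈ gc → PairFormula kc gc
    lessValue x y = inᴳ (rel less (λ { zero → var x ; (suc _) → var y }))

    -- The language of coloured orders has no constant for `∞`, so it is characterised as the
    -- element with nothing above it.
    isInfinity : ∀ {kc gc} → Unit.tt ∈ gc → PairFormula kc gc
    isInfinity x = ∼ ∃ᴳ (lessValue (there x) (here refl))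

  holds-isInfinity : ∀ U {kc gc} {e : FieldEnv {ℓ} U kc} {h : OrderEnv U gc} x →
    ValuedVectorSpace._≈ⱽ_ U (All.lookup h x) (ValuedVectorSpace.∞ U) ⇔ Holds U (isInfinity x) e h
  holds-isInfinity U {h = h} x = mk⇔
    (λ { x≈∞ (γ , lt) → Valuation.<⇒≉∞ em U lt x≈∞ })
    (λ p → f p (ValuedVectorSpace.∞-last U (All.lookup h x)))
    where
    open ValuedVectorSpace U
    f : ¬ (∃ λ γ → All.lookup h x < γ) → All.lookup h x ≤ ∞ → All.lookup h x ≈ⱽ ∞
    f p (inj₁ lt) = ⊥-elim (p (∞ , lt))
    f p (inj₂ eq) = eq

  atom-≈ : ∀ {Γ} s (x y : s ∈ Γ) →
    Definable Γ (λ U ρ → Structure.Eq (Str U) s (All.lookup ρ x) (All.lookup ρ y))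
  atom-≈ vector x y = definable (λ σ g → ⋀ λ i → equation (σ vector x i) (σ vector y i))
    λ σ g U r → let open Realizes r in
      Coordinates.coordinates U separated (represents vector x) (represents vector y)
  atom-≈ scalar x y = definable (λ σ g → equation (σ scalar x) (σ scalar y))
    λ σ g U r → let open Realizes r in
      ≈-cong (Structure.sort (Str U) scalar) (represents scalar x) (represents scalar y)
  atom-≈ value x y = definable (λ σ g → sameValue (σ value x) (σ value y))
    λ σ g U r → let open Realizes r in
      ≈-cong (Structure.sort (Str U) value) (represents value x) (represents value y)

  atom-< : ∀ {Γ} (x y : value ∈ Γ) →
    Definable Γ (λ U ρ → ValuedVectorSpace._<_ U (All.lookup ρ x) (All.lookup ρ y))
  atom-< x y = definable (λ σ g → lessValue (σ value x) (σ value y))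
    λ σ g U r → let open Realizes r
                    open StrictTotalOrder (ValuedVectorSpace.Γ U) in
      mk⇔ (λ lt → <-respˡ-≈ (represents value x) (<-respʳ-≈ (represents value y) lt))
          (λ lt → <-respˡ-≈ (Eq.sym (represents value x)) (<-respʳ-≈ (Eq.sym (represents value y)) lt))

  Atomic : VFun → Set (lsuc ℓ)
  Atomic f = ∀ {Γ} (xs : ∀ i → funDom f i ∈ Γ) (y : funCod f ∈ Γ) → Definable Γ
    (λ U ρ → Structure.Eq (Str U) (funCod f)
               (Structure.fun (Str U) f (λ i → All.lookup ρ (xs i))) (All.lookup ρ y))

  atom-+ᵛ : Atomic +ᵛ
  atom-+ᵛ xs y = definable
    (λ σ g → ⋀ λ i → binary plus (λ j → σ vector (xs j) i) (σ vector y i))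
    λ σ g U {b} r →
      let open Realizes r
          open ValuedVectorSpace U
      in Coordinates.coordinates U separated
        (≈ᴹ-trans (+ᴹ-cong (represents vector (xs zero)) (represents vector (xs (suc zero))))
          (≈ᴹ-sym (LinearAlgebra.combination-+ em K V _ _ b)))
        (represents vector y)

  atom-0ᵛ : Atomic 0ᵛ
  atom-0ᵛ xs y = definable
    (λ σ g → ⋀ λ i → equation nought (σ vector y i))
    λ σ g U {b} r →
      let open Realizes r
          open ValuedVectorSpace U
      in Coordinates.coordinates U separated
        (≈ᴹ-sym (LinearAlgebra.combination-zero em K V b (λ _ → Field.refl K)))
        (represents vector y)

  atom-scal : Atomic scal-sym
  atom-scal xs y = definable
    (λ σ g → ⋀ λ i → binary times (λ { zero → σ scalar (xs zero) ; (suc _) → σ vector (xs (suc zero)) i })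
                              (σ vector y i))
    λ σ g U {b} r →
      let open Realizes r
          open ValuedVectorSpace U
      in Coordinates.coordinates U separated
        (≈ᴹ-trans (*ₗ-cong (represents scalar (xs zero)) (represents vector (xs (suc zero))))
          (≈ᴹ-sym (LinearAlgebra.combination-* em K V _ _ b)))
        (represents vector y)

  atom-+ᵏ : Atomic +ᵏ
  atom-+ᵏ xs y = definable (λ σ g → binary plus (λ j → σ scalar (xs j)) (σ scalar y))
    λ σ g U r → let open Realizes r in ≈-cong (Structure.sort (Str U) scalar)
      (Field.+-cong (ValuedVectorSpace.K U) (represents scalar (xs zero)) (represents scalar (xs (suc zero))))
      (represents scalar y)

  atom-*ᵏ : Atomic *ᵏ
  atom-*ᵏ xs y = definable (λ σ g → binary times (λ j → σ scalar (xs j)) (σ scalar y))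
    λ σ g U r → let open Realizes r in ≈-cong (Structure.sort (Str U) scalar)
      (Field.*-cong (ValuedVectorSpace.K U) (represents scalar (xs zero)) (represents scalar (xs (suc zero))))
      (represents scalar y)

  atom-0ᵏ : Atomic 0ᵏ
  atom-0ᵏ xs y = definable (λ σ g → equation nought (σ scalar y))
    λ σ g U r → let open Realizes r in ≈-cong (Structure.sort (Str U) scalar)
      (Field.refl (ValuedVectorSpace.K U)) (represents scalar y)

  atom-1ᵏ : Atomic 1ᵏ
  atom-1ᵏ xs y = definable (λ σ g → equation one (σ scalar y))
    λ σ g U r → let open Realizes r in ≈-cong (Structure.sort (Str U) scalar)
      (Field.refl (ValuedVectorSpace.K U)) (represents scalar y)

  atom-∞ : Atomic ∞-sym
  atom-∞ xs y = definable (λ σ g → isInfinity (σ value y))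
    λ σ g U {e = e} {h} r →
      let open Realizes r
          module S = Setoid (Structure.sort (Str U) value)
      in ⇔.trans (mk⇔ (λ eq → S.trans (S.sym (represents value y)) (S.sym eq))
                   (λ eq → S.sym (S.trans (represents value y) eq)))
              (holds-isInfinity U {e = e} {h} (σ value y))

  -- `MinimalValue` written out, with the implication in the lower bound as a negated conjunction.
  -- It is the only atomic graph in which field and order conditions occur together.
  atom-val : Atomic val-sym
  atom-val xs y = definable
    (λ σ g → let c = σ vector (xs zero) ; z = σ value y in
      (⋀ λ i → ∼ (∼ equation (c i) nought ∧ lessValue (g i) z)) ∧
      (isInfinity z ∨ ⋁ λ i → ∼ equation (c i) nought ∧ sameValue z (g i)))
    λ σ g U {b} {e} {h} {ρ} r →
      let open Realizes r
          open ValuedVectorSpace U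
          open Valuation em U
          module ΓU = StrictTotalOrder (ValuedVectorSpace.Γ U)
          z = σ value y
          ks = λ i → Realization.⟦_⟧ U (σ vector (xs zero) i) e
          minimal : MinimalValue ks (val ∘ b) (All.lookup h z) ⇔ _
          minimal =
            mk⇔ (λ p i → λ { (k≉0 , lt) → ≤⇒≯ (p i k≉0) (ΓU.<-respˡ-≈ (ΓU.Eq.sym (values i)) lt) })
                (λ p i k≉0 → ≮⇒≥ (λ lt → p i (k≉0 , ΓU.<-respˡ-≈ (values i) lt)))
            ×-⇔ (holds-isInfinity U {e = e} {h} z
            ⊎-⇔ mk⇔ (λ { (i , k≉0 , eq) → i , k≉0 , ΓU.Eq.trans eq (values i) })
                    (λ { (i , k≉0 , eq) → i , k≉0 , ΓU.Eq.trans eq (ΓU.Eq.sym (values i)) }))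
      in ⇔.trans (≈-cong (Structure.sort (Str U) value)
                   (val-cong (represents vector (xs zero))) (represents value y))
           (⇔.trans (val-combination separated ks) minimal)

  variable-definable : ∀ {Γ s} (x : s ∈ Γ) → DefinableFunction Γ s (λ U ρ → All.lookup ρ x)
  variable-definable {s = s} x = definableFunction (definable-resp
    (λ { U (y ∷ ρ) → ⇔.refl }) (atom-≈ s (there x) (here refl)))

  -- The result variable is treated as argument zero, so one substitution handles it together with
  -- the nested arguments.
  symbol-definable : ∀ f → Atomic f → ∀ {Γ} {F : ∀ i → Function Γ (funDom f i)} →
    (∀ i → DefinableFunction Γ (funDom f i) (F i)) →
    DefinableFunction Γ (funCod f) (λ U ρ → Structure.fun (Str U) f (λ i → F i U ρ))
  symbol-definable f atom {Γ} {F} D = definableFunction (definable-substitution (funCod f ◃ funDom f)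
    {F = ∀-cons (λ U ρ → All.lookup ρ (here refl)) (λ i U ρ → F i U (All.tail ρ))}
    (λ U zs → Structure.Eq (Str U) (funCod f) (Structure.fun (Str U) f (zs ∘ suc)) (zs zero))
    (λ U e p → let module S = Setoid (Structure.sort (Str U) (funCod f)) in
      S.trans (Structure.fun-cong (Str U) f (λ i → S′.sym U i (e (suc i)))) (S.trans p (e zero)))
    (λ xs → atom (xs ∘ suc) (xs zero))
    (∀-cons (variable-definable (here refl)) (λ i → weaken tailing (D i))))
    where module S′ U i = Setoid (Structure.sort (Str U) (funDom f i))

  ≈-definable : ∀ {Γ s} {F G : Function Γ s} → DefinableFunction Γ s F → DefinableFunction Γ s G →
    Definable Γ (λ U ρ → Structure.Eq (Str U) s (F U ρ) (G U ρ))
  ≈-definable {s = s} {F} {G} D E = definable-substitution {2} (λ _ → s)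
    {F = λ { zero → F ; (suc _) → G }}
    (λ U xs → Structure.Eq (Str U) s (xs zero) (xs (suc zero)))
    (λ U e p → let open Setoid (Structure.sort (Str U) s) using () renaming (trans to tr; sym to sy)
      in tr (sy (e zero)) (tr p (e (suc zero))))
    (λ xs → atom-≈ s (xs zero) (xs (suc zero)))
    (λ { zero → D ; (suc _) → E })

  <-definable : ∀ {Γ} {F G : Function Γ value} →
    DefinableFunction Γ value F → DefinableFunction Γ value G →
    Definable Γ (λ U ρ → ValuedVectorSpace._<_ U (F U ρ) (G U ρ))
  <-definable {F = F} {G} D E = definable-substitution {2} (λ _ → value)
    {F = λ { zero → F ; (suc _) → G }}
    (λ U xs → ValuedVectorSpace._<_ U (xs zero) (xs (suc zero)))
    (λ U e → Structure.rel-resp (Str U) <-sym e)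
    (λ xs → atom-< (xs zero) (xs (suc zero)))
    (λ { zero → D ; (suc _) → E })

  val-definable : ∀ {Γ F} → DefinableFunction Γ vector F →
    DefinableFunction Γ value (λ U ρ → ValuedVectorSpace.val U (F U ρ))
  val-definable {F = F} D = symbol-definable val-sym atom-val {F = λ _ → F} (λ _ → D)

  +-definable : ∀ {Γ F G} → DefinableFunction Γ vector F → DefinableFunction Γ vector G →
    DefinableFunction Γ vector (λ U ρ → ValuedVectorSpace._+ᴹ_ U (F U ρ) (G U ρ))
  +-definable {F = F} {G} D E = symbol-definable +ᵛ atom-+ᵛ
    {F = λ { zero → F ; (suc _) → G }} (λ { zero → D ; (suc _) → E })

  scal-definable : ∀ {Γ F G} → DefinableFunction Γ scalar F → DefinableFunction Γ vector G →
    DefinableFunction Γ vector (λ U ρ → ValuedVectorSpace._*ₗ_ U (F U ρ) (G U ρ))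
  scal-definable {F = F} {G} D E = symbol-definable scal-sym atom-scal
    {F = λ { zero → F ; (suc _) → G }} (λ { zero → D ; (suc _) → E })

  0ᵛ-definable : ∀ {Γ} → DefinableFunction Γ vector (λ U ρ → ValuedVectorSpace.0ᴹ U)
  0ᵛ-definable = symbol-definable 0ᵛ atom-0ᵛ {F = λ ()} (λ ())

  0ᵏ-definable : ∀ {Γ} → DefinableFunction Γ scalar (λ U ρ → ValuedVectorSpace.0# U)
  0ᵏ-definable = symbol-definable 0ᵏ atom-0ᵏ {F = λ ()} (λ ())

  combination-definable : ∀ {Γ n} {F : Fin n → Function Γ scalar} {G : Fin n → Function Γ vector} →
    (∀ i → DefinableFunction Γ scalar (F i)) → (∀ i → DefinableFunction Γ vector (G i)) →
    DefinableFunction Γ vector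
      (λ U ρ → ValuedVectorSpace.combination U (λ i → F i U ρ) (λ i → G i U ρ))
  combination-definable {n = zero}  D E = 0ᵛ-definable
  combination-definable {n = suc n} D E =
    +-definable (scal-definable (D zero) (E zero)) (combination-definable (D ∘ suc) (E ∘ suc))

  -- The language has no subtraction: `z` is the difference exactly when `z + G` is `F`.
  sub-definable : ∀ {Γ F G} → DefinableFunction Γ vector F → DefinableFunction Γ vector G →
    DefinableFunction Γ vector (λ U ρ → ValuedVectorSpace._-ᴹ_ U (F U ρ) (G U ρ))
  sub-definable {F = F} {G} D E = definableFunction (definable-resp
    (λ U ρ →
      let open ValuedVectorSpace U
          open Valuation em U using (x-y+y; x+y-y)
      in mk⇔
      (λ e → ≈ᴹ-trans (+ᴹ-congʳ (≈ᴹ-sym e)) (x+y-y _ _))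
      (λ e → ≈ᴹ-trans (+ᴹ-congʳ (≈ᴹ-sym e)) (x-y+y _ _)))
    (≈-definable (+-definable (variable-definable (here refl)) (weaken tailing E)) (weaken tailing D)))

  pastScalars : ∀ n {Γ} → Weakening Γ (extend {n = n} (λ _ → scalar) Γ)
  pastScalars n = dropping {n} {λ _ → scalar}

  freshScalar-definable : ∀ {n Γ} (i : Fin n) →
    DefinableFunction (extend {n = n} (λ _ → scalar) Γ) scalar
      (λ U ρ → All.lookup ρ (fresh {d = λ _ → scalar} i))
  freshScalar-definable i = variable-definable (fresh {d = λ _ → scalar} i)

  -- The definition of `W` is expanded: it quantifies over scalars only and uses functions already
  -- treated.
  W-definable : ∀ {Γ n} {F : Fin (suc n) → Function Γ vector} →
    (∀ i → DefinableFunction Γ vector (F i)) → Definable Γ (λ U ρ → W U (λ i → F i U ρ))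
  W-definable {n = n} {F} D = definable-×
    (definable-⋀ λ i → definable-¬ (≈-definable (D i) 0ᵛ-definable))
    (definable-×
      (definable-⋀ λ i → definable-⋀ λ j → ≈-definable (val-definable (D i)) (val-definable (D j)))
      (definable-∀-fresh (λ _ → scalar)
        (λ U ks ρ → ValuedVectorSpace._<_ U (ValuedVectorSpace.val U (F zero U ρ))
            (ValuedVectorSpace.val U (ValuedVectorSpace.combination U ks (λ i → F i U ρ))) →
          ∀ i → ValuedVectorSpace._≈ᴷ_ U (ks i) (ValuedVectorSpace.0# U))
        (λ U ρ eq q lt i →
          let open ValuedVectorSpace U
              module F = Field K
              module ΓU = StrictTotalOrder (ValuedVectorSpace.Γ U)
          in F.trans (F.reflexive (sym (eq i))) (q (ΓU.<-respʳ-≈ (val-cong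
            (LinearAlgebra.combination-congˡ em K V {b = λ i → F i U ρ}
              (λ j → F.reflexive (sym (eq j))))) lt) i))
        (definable-→
          (<-definable (val-definable (weaken (pastScalars (suc n)) (D zero)))
            (val-definable (combination-definable (λ i → freshScalar-definable i)
                                                  (λ i → weaken (pastScalars (suc n)) (D i)))))
          (definable-⋀ λ i → ≈-definable (freshScalar-definable i) 0ᵏ-definable))))

  module _ (U : ValuedVectorSpace ℓ) where
    open ValuedVectorSpace U
    private module F = Field K

    Approximates : ∀ {m} → Vector Carrierᴹ (suc (suc m)) → Vector Scalar (suc m) → Set ℓ
    Approximates vs ks = val (head vs) < val (combination ks (tail vs) -ᴹ head vs)

    approximates-resp : ∀ {m} (vs : Vector Carrierᴹ (suc (suc m))) {ks ls} →
      (∀ i → ks i ≡ ls i) → Approximates vs ks → Approximates vs ls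
    approximates-resp vs eq = StrictTotalOrder.<-respʳ-≈ (ValuedVectorSpace.Γ U) (val-cong (+ᴹ-congʳ
      (LinearAlgebra.combination-congˡ em K V {b = tail vs} (F.reflexive ∘ eq))))

    -- `λ-Case` with its witness as a parameter, so that the graph of one component can quantify
    -- over the whole tuple.
    λ-Solution : ∀ {m} → Vector Carrierᴹ (suc (suc m)) → Vector Scalar (suc m) → Set ℓ
    λ-Solution vs ks = W U (tail vs) × ¬ W U vs × Approximates vs ks ×
      (∀ ls → Approximates vs ls → ∀ i → ks i ≈ᴷ ls i)

    λ-solution-resp : ∀ {m} (vs : Vector Carrierᴹ (suc (suc m))) {ks ls} →
      (∀ i → ks i ≡ ls i) → λ-Solution vs ks → λ-Solution vs ls
    λ-solution-resp vs eq (w , ¬w , ap , uniq) = w , ¬w , approximates-resp vs eq ap ,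
      λ ls ap′ i → F.trans (F.reflexive (sym (eq i))) (uniq ls ap′ i)

    -- By uniqueness, a component read off from any solution is the one chosen by `λ-value`; the
    -- second disjunct is the default value 0.
    λ-graph : ∀ {m} i (vs : Vector Carrierᴹ (suc (suc m))) y →
      ((∃ λ ks → λ-Solution vs ks × ks i ≈ᴷ y) ⊎ (¬ (∃ λ ks → λ-Solution vs ks) × 0# ≈ᴷ y)) ⇔
      λ-value U em i vs ≈ᴷ y
    λ-graph i vs y with em {λ-Case U vs}
    ... | yes (w , ¬w , ks , ap , uniq) = mk⇔
      (λ { (inj₁ (ls , (_ , _ , ap′ , _) , eq)) → F.trans (uniq {ls} ap′ i) eq
         ; (inj₂ (none , _)) → ⊥-elim (none (ks , solution)) })
      (λ eq → inj₁ (ks , solution , eq))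
      where
      solution : λ-Solution vs ks
      solution = w , ¬w , ap , λ ls ap′ → uniq {ls} ap′
    ... | no ¬case = mk⇔
      (λ { (inj₁ (ks , s , _)) → ⊥-elim (none (ks , s)) ; (inj₂ (_ , eq)) → eq })
      (λ eq → inj₂ (none , eq))
      where
      none : ¬ (∃ λ ks → λ-Solution vs ks)
      none (ks , w , ¬w , ap , uniq) = ¬case (w , ¬w , ks , ap , λ {ls} → uniq ls)

  approximates-definable : ∀ {Γ m} {F : Fin (suc (suc m)) → Function Γ vector}
    {G : Fin (suc m) → Function Γ scalar} →
    (∀ i → DefinableFunction Γ vector (F i)) → (∀ i → DefinableFunction Γ scalar (G i)) →
    Definable Γ (λ U ρ → Approximates U (λ i → F i U ρ) (λ i → G i U ρ))
  approximates-definable D E = <-definable (val-definable (D zero))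
    (val-definable (sub-definable (combination-definable E (D ∘ suc)) (D zero)))

  λ-solution-definable : ∀ {Γ m} {F : Fin (suc (suc m)) → Function Γ vector}
    {G : Fin (suc m) → Function Γ scalar} →
    (∀ i → DefinableFunction Γ vector (F i)) → (∀ i → DefinableFunction Γ scalar (G i)) →
    Definable Γ (λ U ρ → λ-Solution U (λ i → F i U ρ) (λ i → G i U ρ))
  λ-solution-definable {m = m} {F} {G} D E = definable-× (W-definable (D ∘ suc))
    (definable-× (definable-¬ (W-definable D)) (definable-× (approximates-definable D E)
      (definable-∀-fresh (λ _ → scalar)
        (λ U ls ρ → Approximates U (λ i → F i U ρ) ls → ∀ i → ValuedVectorSpace._≈ᴷ_ U (G i U ρ) (ls i))
        (λ U ρ eq q ap i → let module F = Field (ValuedVectorSpace.K U) in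
          F.trans (q (approximates-resp U (λ i → F i U ρ) (sym ∘ eq) ap) i) (F.reflexive (eq i)))
        (definable-→
          (approximates-definable (λ i → weaken (pastScalars (suc m)) (D i)) (λ i → freshScalar-definable i))
          (definable-⋀ λ i → ≈-definable (weaken (pastScalars (suc m)) (E i)) (freshScalar-definable i))))))

  λ-definable : ∀ {Γ m} i {F : Fin (suc (suc m)) → Function Γ vector} →
    (∀ j → DefinableFunction Γ vector (F j)) →
    DefinableFunction Γ scalar (λ U ρ → λ-value U em i (λ j → F j U ρ))
  λ-definable {Γ} {m} i {F} D = definableFunction (definable-resp
    (λ U ρ → λ-graph U i (λ j → F j U (All.tail ρ)) (All.lookup ρ (here refl)))
    (definable-⊎
      (definable-∃-fresh (λ _ → scalar)
        (λ U ks ρ → λ-Solution U (vs U ρ) ks × ValuedVectorSpace._≈ᴷ_ U (ks i) (All.lookup ρ (here refl)))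
        (λ U ρ eq → λ { (s , e) → λ-solution-resp U (vs U ρ) eq s ,
          (let module F = Field (ValuedVectorSpace.K U) in F.trans (F.reflexive (sym (eq i))) e) })
        (definable-×
          (λ-solution-definable (λ j → weaken (pastScalars (suc m)) (vs-definable j)) (λ j → freshScalar-definable j))
          (≈-definable (freshScalar-definable i) (weaken (pastScalars (suc m)) (variable-definable (here refl))))))
      (definable-×
        (definable-¬ (definable-∃-fresh (λ _ → scalar) (λ U ks ρ → λ-Solution U (vs U ρ) ks)
          (λ U ρ → λ-solution-resp U (vs U ρ))
          (λ-solution-definable (λ j → weaken (pastScalars (suc m)) (vs-definable j)) (λ j → freshScalar-definable j))))
        (≈-definable 0ᵏ-definable (variable-definable (here refl))))))
    where
    vs : ∀ U → Env U (scalar ∷ Γ) → Vector (ValuedVectorSpace.Carrierᴹ U) (suc (suc m))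
    vs U ρ j = F j U (All.tail ρ)
    vs-definable : ∀ j → DefinableFunction (scalar ∷ Γ) vector (λ U ρ → vs U ρ j)
    vs-definable j = weaken tailing (D j)

  term-definable : ∀ {Γ s} (t : Syntax.Term L-Wλ Γ s) →
    DefinableFunction Γ s (λ U → Semantics.⟦_⟧ (Str U) t)
  term-definable (Syntax.var x) = variable-definable x
  term-definable (Syntax.app +ᵛ ts) = symbol-definable +ᵛ atom-+ᵛ (λ i → term-definable (ts i))
  term-definable (Syntax.app 0ᵛ ts) = symbol-definable 0ᵛ atom-0ᵛ (λ i → term-definable (ts i))
  term-definable (Syntax.app +ᵏ ts) = symbol-definable +ᵏ atom-+ᵏ (λ i → term-definable (ts i))
  term-definable (Syntax.app *ᵏ ts) = symbol-definable *ᵏ atom-*ᵏ (λ i → term-definable (ts i))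
  term-definable (Syntax.app 0ᵏ ts) = symbol-definable 0ᵏ atom-0ᵏ (λ i → term-definable (ts i))
  term-definable (Syntax.app 1ᵏ ts) = symbol-definable 1ᵏ atom-1ᵏ (λ i → term-definable (ts i))
  term-definable (Syntax.app ∞-sym ts) = symbol-definable ∞-sym atom-∞ (λ i → term-definable (ts i))
  term-definable (Syntax.app scal-sym ts) = symbol-definable scal-sym atom-scal (λ i → term-definable (ts i))
  term-definable (Syntax.app val-sym ts) = symbol-definable val-sym atom-val (λ i → term-definable (ts i))
  term-definable (Syntax.app (λ-sym m i) ts) = λ-definable i (λ j → term-definable (ts j))

  formula-definable : ∀ {Γ} (φ : Syntax.Formula L-Wλ Γ) →
    Definable Γ (λ U → Semantics.Sat (Str U) φ)
  formula-definable (t Syntax.≐ u) = ≈-definable (term-definable t) (term-definable u)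
  formula-definable (Syntax.rel <-sym ts) = <-definable (term-definable (ts zero)) (term-definable (ts (suc zero)))
  formula-definable (Syntax.rel (W-sym n) ts) = W-definable (λ i → term-definable (ts i))
  formula-definable (Syntax.¬′ φ) = definable-¬ (formula-definable φ)
  formula-definable (φ Syntax.∧′ ψ) = definable-× (formula-definable φ) (formula-definable ψ)
  formula-definable (Syntax.∃′ s φ) = definable-∃ s (formula-definable φ)

-- Extensions

module Embedding {ℓ : Level} (em : ExcludedMiddle ℓ) (V W : ValuedVectorSpace ℓ)
                 (ι : Extension (valuedStructure em V) (valuedStructure em W)) where
  private
    module V = ValuedVectorSpace V
    module W = ValuedVectorSpace W
    module 𝕍 = Valuation em V
    module 𝕎 = Valuation em W
    module Δ = StrictTotalOrder W.Γ
    module L = Field W.K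
  open Extension ι renaming (cong to map-cong; injective to map-injective)
  open Definability em
  open Realization using (Realizes; Represents)

  map-+ : ∀ x y → map vector (x V.+ᴹ y) W.≈ᴹ map vector x W.+ᴹ map vector y
  map-+ x y = fun-homo +ᵛ (λ { zero → x ; (suc _) → y })

  map-scal : ∀ k x → map vector (k V.*ₗ x) W.≈ᴹ map scalar k W.*ₗ map vector x
  map-scal k x = fun-homo scal-sym (λ { zero → k ; (suc _) → x })

  map-0 : map vector V.0ᴹ W.≈ᴹ W.0ᴹ
  map-0 = fun-homo 0ᵛ (λ ())

  map-val : ∀ x → map value (V.val x) W.≈ⱽ W.val (map vector x)
  map-val x = fun-homo val-sym (λ _ → x)

  map-val-≈ : ∀ x y → V.val x V.≈ⱽ V.val y ⇔ W.val (map vector x) W.≈ⱽ W.val (map vector y)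
  map-val-≈ x y = mk⇔
    (λ e → Δ.Eq.trans (Δ.Eq.sym (map-val x)) (Δ.Eq.trans (map-cong value e) (map-val y)))
    (λ e → map-injective value (Δ.Eq.trans (map-val x) (Δ.Eq.trans e (Δ.Eq.sym (map-val y)))))

  map-combination : ∀ {n} (ks : Vector V.Scalar n) b →
    map vector (V.combination ks b) W.≈ᴹ W.combination (map scalar ∘ ks) (map vector ∘ b)
  map-combination {zero}  ks b = map-0
  map-combination {suc n} ks b = W.≈ᴹ-trans (map-+ _ _)
    (W.+ᴹ-cong (map-scal (head ks) (head b)) (map-combination (tail ks) (tail b)))

  -- By separation, the new vector together with the old ones of the same
  -- value satisfies W in V, hence in W.
  map-separated : ∀ {n} {b : Vector V.Carrierᴹ n} → 𝕍.Separated b → 𝕎.Separated (map vector ∘ b)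
  map-separated {zero}  s = _
  map-separated {suc n} {b} sep@(s , _ , _) =
    let k , t , pk = thinning em (λ i → V.val (tail b i) V.≈ⱽ V.val v)
        pk′ = picks-resp t (λ i → to (map-val-≈ (tail b i) v)) (λ i → from (map-val-≈ (tail b i) v)) pk
        s′ = map-separated {b = tail b} s
        y = (v , inj₂ (StrictTotalOrder.Eq.refl V.Γ)) ◃ 𝕍.selected {b = tail b} s t pk
        y′ = (map vector v , inj₂ Δ.Eq.refl) ◃ 𝕎.selected {b = map vector ∘ tail b} s′ t pk′
        w = 𝕍.independent⇒W y
              (𝕍.separated-◃-independent {b = tail b} sep t pk (StrictTotalOrder.Eq.refl V.Γ))
        -- Independence over K need not persist over the larger field; preservation of the symbols
        -- `W` is what carries it over.
        w′ = W-resp W (λ { zero → W.≈ᴹ-refl ; (suc i) → W.≈ᴹ-refl })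
               (to (rel-iff (W-sym k) (proj₁ ∘ y)) w)
    in 𝕎.independent⇒separated {b = map vector ∘ tail b} s′ t pk′ {head y′} (𝕎.W⇒independent y′ Δ.Eq.refl w′)
    where v = head b

  map-coefficient : ∀ {kc} (c : Coefficient kc) (e : FieldEnv V kc) →
    map scalar (Realization.⟦_⟧ V c e) W.≈ᴷ Realization.⟦_⟧ W c (All.map (map scalar) e)
  map-coefficient nought  e = fun-homo 0ᵏ (λ ())
  map-coefficient one     e = fun-homo 1ᵏ (λ ())
  map-coefficient (var x) e = L.reflexive (sym (lookup-map e x))

  map-represents : ∀ {n kc gc} {b : Vector V.Carrierᴹ n} {e : FieldEnv V kc} {h : OrderEnv V gc} s y {x} →
    Represents V b e h s y x →
    Represents W (map vector ∘ b) (All.map (map scalar) e) (All.map (map value) h) s y (map s x)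
  map-represents {b = b} {e} vector c r = W.≈ᴹ-trans (map-cong vector r) (W.≈ᴹ-trans
    (map-combination (λ i → Realization.⟦_⟧ V (c i) e) b)
    (LinearAlgebra.combination-congˡ em W.K W.V {b = map vector ∘ b} (λ i → map-coefficient (c i) e)))
  map-represents {e = e} scalar c r = L.trans (map-cong scalar r) (map-coefficient c e)
  map-represents {h = h} value x r = Δ.Eq.trans (map-cong value r) (Δ.Eq.reflexive (sym (lookup-map h x)))

  map-realizes : ∀ {n kc gc Γ} {σ : Assignment n kc gc Γ} {g : Fin n → Unit.tt ∈ gc} {b e h ρ} →
    Realizes V σ g b e h ρ →
    Realizes W σ g (map vector ∘ b) (All.map (map scalar) e) (All.map (map value) h)
      (All.map (λ {s} → map s) ρ)
  map-realizes {σ = σ} {g} {b} {e} {h} {ρ} r = record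
    { separated = map-separated separated
    ; values = λ i → Δ.Eq.trans (Δ.Eq.sym (map-val (b i)))
        (Δ.Eq.trans (map-cong value (values i)) (Δ.Eq.reflexive (sym (lookup-map h (g i)))))
    ; represents = λ s x → subst (Represents W _ _ _ s (σ s x)) (sym (lookup-map ρ x))
        (map-represents s (σ s x) (represents s x))
    }
    where open Realizes r

  -- The realization is chosen in the smaller space and mapped, so both spaces evaluate the same
  -- pair formula at corresponding parameters.
  elementary :
    Elementary (fieldStructure V.K) (fieldStructure W.K) (λ _ → map scalar) →
    Elementary (colouredOrder V) (colouredOrder W) (λ _ → map value) →
    Elementary (valuedStructure em V) (valuedStructure em W) map
  elementary elK elΓ φ ρ with realize V ρ
  ... | realized {σ = σ} {g} {e = e} {h} r = ⇔.trans (correct D σ g V r) (⇔.trans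
      (holds-transfer em V W elK elΓ (formula D σ g) e h)
      (⇔.sym (correct D σ g W (map-realizes r))))
    where
    open Definable
    D = DefinableFunctions.formula-definable em φ

-- The field and the coloured order inside the valued vector space

module _ {a b p} {A : Set a} {B : Set b} {f : A → B} {P : B → Set p} where

  lookup-map⁺ : ∀ {xs} (ρ : All (P ∘ f) xs) {x} (i : x ∈ xs) →
    All.lookup (map⁺ {P = P} ρ) (∈-map⁺ f i) ≡ All.lookup ρ i
  lookup-map⁺ (_ ∷ ρ) (here refl) = refl
  lookup-map⁺ (_ ∷ ρ) (there i)   = lookup-map⁺ ρ i

  map-map⁺ : ∀ {q} {Q : B → Set q} (h : ∀ x → P x → Q x) {xs} (ρ : All (P ∘ f) xs) →
    All.map (λ {x} → h x) (map⁺ ρ) ≡ map⁺ (All.map (λ {x} → h (f x)) ρ)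
  map-map⁺ h []      = refl
  map-map⁺ h (p ∷ ρ) = cong (h _ p ∷_) (map-map⁺ h ρ)

module Interpretation where
  open Syntax

  asScalar : Unit.⊤ → VSort
  asScalar _ = scalar

  asValue : Unit.⊤ → VSort
  asValue _ = value

  ⟪_⟫ᵗ : ∀ {kc} → Term L-field kc Unit.tt → Term L-Wλ (mapList asScalar kc) scalar
  ⟪ var x ⟫ᵗ         = var (∈-map⁺ asScalar x)
  ⟪ app plus ts ⟫ᵗ   = app +ᵏ (λ i → ⟪ ts i ⟫ᵗ)
  ⟪ app times ts ⟫ᵗ  = app *ᵏ (λ i → ⟪ ts i ⟫ᵗ)
  ⟪ app nought ts ⟫ᵗ = app 0ᵏ (λ ())
  ⟪ app one ts ⟫ᵗ    = app 1ᵏ (λ ())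

  ⟪_⟫ᴷ : ∀ {kc} → FieldFormula kc → Formula L-Wλ (mapList asScalar kc)
  ⟪ t ≐ u ⟫ᴷ   = ⟪ t ⟫ᵗ ≐ ⟪ u ⟫ᵗ
  ⟪ rel () ts ⟫ᴷ
  ⟪ ¬′ φ ⟫ᴷ    = ¬′ ⟪ φ ⟫ᴷ
  ⟪ φ ∧′ ψ ⟫ᴷ  = ⟪ φ ⟫ᴷ ∧′ ⟪ ψ ⟫ᴷ
  ⟪ ∃′ s φ ⟫ᴷ  = ∃′ scalar ⟪ φ ⟫ᴷ

  exists* : ∀ {n} (d : Vector VSort n) {Γ} → Formula L-Wλ (extend d Γ) → Formula L-Wλ Γ
  exists* {zero}  d φ = φ
  exists* {suc n} d φ = exists* (tail d) (∃′ (head d) φ)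

  -- `W-sym m` has arity `m + 1`, so colour 0 needs a case of its own, given by `hasDimension-zero`;
  -- the other case is `hasDimension-suc`.
  colourFormula : ∀ {Γ} → ℕ → value ∈ Γ → Formula L-Wλ Γ
  colourFormula zero    y = var y ≐ app ∞-sym (λ ())
  colourFormula (suc m) y = exists* {suc m} (λ _ → vector)
    (app val-sym (λ _ → var (fresh {d = vectors} zero)) ≐ var (old {d = vectors} y) ∧′
     rel (W-sym m) (λ i → var (fresh {d = vectors} i)) ∧′
     ¬′ ∃′ vector (rel (W-sym (suc m)) (λ { zero → var (here refl) ; (suc i) → var (there (fresh {d = vectors} i)) })))
    where
    vectors : Vector VSort (suc m)
    vectors _ = vector

  index : ∀ {gc} → Term L-colouredOrder gc Unit.tt → value ∈ mapList asValue gc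
  index (var x) = ∈-map⁺ asValue x
  index (app () ts)

  ⟪_⟫ᴳ : ∀ {gc} → OrderFormula gc → Formula L-Wλ (mapList asValue gc)
  ⟪ t ≐ u ⟫ᴳ             = var (index t) ≐ var (index u)
  ⟪ rel less ts ⟫ᴳ       = rel <-sym (λ i → var (index (ts i)))
  ⟪ rel (colour n) ts ⟫ᴳ = colourFormula n (index (ts zero))
  ⟪ ¬′ φ ⟫ᴳ              = ¬′ ⟪ φ ⟫ᴳ
  ⟪ φ ∧′ ψ ⟫ᴳ            = ⟪ φ ⟫ᴳ ∧′ ⟪ ψ ⟫ᴳ
  ⟪ ∃′ s φ ⟫ᴳ            = ∃′ value ⟪ φ ⟫ᴳ

  module _ {ℓ : Level} (em : ExcludedMiddle ℓ) (U : ValuedVectorSpace ℓ) where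
    open ValuedVectorSpace U
    private
      Str = valuedStructure em U
      module S = Semantics Str
      module 𝕂 = Semantics (fieldStructure K)
      module 𝔾 = Semantics (colouredOrder U)
      module F = Field K
      module O = StrictTotalOrder Γ
    open Structure Str using (∣_∣)

    scalarEnv : ∀ {kc} → FieldEnv U kc → All ∣_∣ (mapList asScalar kc)
    scalarEnv e = map⁺ e

    valueEnv : ∀ {gc} → OrderEnv U gc → All ∣_∣ (mapList asValue gc)
    valueEnv h = map⁺ h

    ⟪⟫ᵗ-correct : ∀ {kc} (t : Term L-field kc Unit.tt) e → S.⟦ ⟪ t ⟫ᵗ ⟧ (scalarEnv e) ≈ᴷ 𝕂.⟦ t ⟧ e
    ⟪⟫ᵗ-correct (var x)         e = F.reflexive (lookup-map⁺ {f = asScalar} {P = ∣_∣} e x)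
    ⟪⟫ᵗ-correct (app plus ts)   e = F.+-cong (⟪⟫ᵗ-correct (ts zero) e) (⟪⟫ᵗ-correct (ts (suc zero)) e)
    ⟪⟫ᵗ-correct (app times ts)  e = F.*-cong (⟪⟫ᵗ-correct (ts zero) e) (⟪⟫ᵗ-correct (ts (suc zero)) e)
    ⟪⟫ᵗ-correct (app nought ts) e = F.refl
    ⟪⟫ᵗ-correct (app one ts)    e = F.refl

    ⟪⟫ᴷ-correct : ∀ {kc} (φ : FieldFormula kc) e → S.Sat ⟪ φ ⟫ᴷ (scalarEnv e) ⇔ 𝕂.Sat φ e
    ⟪⟫ᴷ-correct (t ≐ u)  e = DefinableFunctions.≈-cong em F.setoid (⟪⟫ᵗ-correct t e) (⟪⟫ᵗ-correct u e)
    ⟪⟫ᴷ-correct (rel () ts) e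
    ⟪⟫ᴷ-correct (¬′ φ)   e = ¬-⇔ (⟪⟫ᴷ-correct φ e)
    ⟪⟫ᴷ-correct (φ ∧′ ψ) e = ⟪⟫ᴷ-correct φ e ×-⇔ ⟪⟫ᴷ-correct ψ e
    ⟪⟫ᴷ-correct (∃′ s φ) e = ∃-⇔ λ k → ⟪⟫ᴷ-correct φ (k ∷ e)

    sat-exists* : ∀ {n} (d : Vector VSort n) {Γ} (φ : Formula L-Wλ (extend d Γ)) ρ →
      S.Sat (exists* d φ) ρ ⇔ Σ (∀ i → ∣ d i ∣) λ ys → S.Sat φ (push ys ρ)
    sat-exists* {zero}  d φ ρ = mk⇔ (λ p → (λ ()) , p) proj₂
    sat-exists* {suc n} d φ ρ = ⇔.trans (sat-exists* (tail d) (∃′ (head d) φ) ρ) (mk⇔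
      (λ { (ys , y , p) → ∀-cons y ys , p }) (λ { (ys , p) → ys ∘ suc , ys zero , p }))

    W-⇔ : ∀ {n} {us vs : Vector Carrierᴹ (suc n)} → (∀ i → us i ≡ vs i) → W U us ⇔ W U vs
    W-⇔ eq = mk⇔ (W-resp U (λ i → ≈ᴹ-reflexive (eq i))) (W-resp U (λ i → ≈ᴹ-reflexive (sym (eq i))))

    colourFormula-correct : ∀ {Γ} n (y : value ∈ Γ) ρ →
      S.Sat (colourFormula n y) ρ ⇔ Linear.HasDimension (B U (All.lookup ρ y)) n
    colourFormula-correct zero    y ρ = ⇔.sym (Valuation.hasDimension-zero em U)
    colourFormula-correct (suc m) y ρ = ⇔.trans (sat-exists* {suc m} (λ _ → vector) _ ρ) (⇔.trans
      (∃-⇔ λ vs → DefinableFunctions.≈-cong em O.Eq.setoid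
          (val-cong (≈ᴹ-reflexive (lookup-fresh {d = λ _ → vector} vs ρ zero)))
          (O.Eq.reflexive (lookup-old {d = λ _ → vector} vs ρ y))
        ×-⇔ (W-⇔ (lookup-fresh {d = λ _ → vector} vs ρ)
        ×-⇔ ¬-⇔ (∃-⇔ λ v → W-⇔ (λ { zero → refl ; (suc i) → lookup-fresh {d = λ _ → vector} vs ρ i }))))
      (⇔.sym (Valuation.hasDimension-suc em U)))

    lookup-index : ∀ {gc} (t : Term L-colouredOrder gc Unit.tt) h →
      All.lookup (valueEnv h) (index t) ≡ 𝔾.⟦ t ⟧ h
    lookup-index (var x) h = lookup-map⁺ {f = asValue} {P = ∣_∣} h x
    lookup-index (app () ts) h

    ⟪⟫ᴳ-correct : ∀ {gc} (φ : OrderFormula gc) h → S.Sat ⟪ φ ⟫ᴳ (valueEnv h) ⇔ 𝔾.Sat φ h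
    ⟪⟫ᴳ-correct (t ≐ u) h = DefinableFunctions.≈-cong em O.Eq.setoid
      (O.Eq.reflexive (lookup-index t h)) (O.Eq.reflexive (lookup-index u h))
    ⟪⟫ᴳ-correct (rel less ts) h = mk⇔
      (Structure.rel-resp (colouredOrder U) less (λ i → O.Eq.reflexive (lookup-index (ts i) h)))
      (Structure.rel-resp (colouredOrder U) less (λ i → O.Eq.reflexive (sym (lookup-index (ts i) h))))
    ⟪⟫ᴳ-correct (rel (colour n) ts) h = subst
      (λ γ → S.Sat (colourFormula n (index (ts zero))) (valueEnv h) ⇔ Linear.HasDimension (B U γ) n)
      (lookup-index (ts zero) h) (colourFormula-correct n (index (ts zero)) (valueEnv h))
    ⟪⟫ᴳ-correct (¬′ φ)   h = ¬-⇔ (⟪⟫ᴳ-correct φ h)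
    ⟪⟫ᴳ-correct (φ ∧′ ψ) h = ⟪⟫ᴳ-correct φ h ×-⇔ ⟪⟫ᴳ-correct ψ h
    ⟪⟫ᴳ-correct (∃′ s φ) h = ∃-⇔ λ γ → ⟪⟫ᴳ-correct φ (γ ∷ h)

  module _ {ℓ : Level} (em : ExcludedMiddle ℓ) (V W : ValuedVectorSpace ℓ)
           (h : ∀ s → Structure.∣_∣ (valuedStructure em V) s → Structure.∣_∣ (valuedStructure em W) s)
           (el : Elementary (valuedStructure em V) (valuedStructure em W) h) where

    field-elementary : Elementary (fieldStructure (ValuedVectorSpace.K V))
      (fieldStructure (ValuedVectorSpace.K W)) (λ _ → h scalar)
    field-elementary φ e = ⇔.trans (⇔.sym (⟪⟫ᴷ-correct em V φ e)) (⇔.trans (el ⟪ φ ⟫ᴷ (scalarEnv em V e))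
      (subst (λ ρ → Semantics.Sat (valuedStructure em W) ⟪ φ ⟫ᴷ ρ ⇔ _)
        (sym (map-map⁺ {f = asScalar} h e)) (⟪⟫ᴷ-correct em W φ _)))

    order-elementary : Elementary (colouredOrder V) (colouredOrder W) (λ _ → h value)
    order-elementary φ e = ⇔.trans (⇔.sym (⟪⟫ᴳ-correct em V φ e)) (⇔.trans (el ⟪ φ ⟫ᴳ (valueEnv em V e))
      (subst (λ ρ → Semantics.Sat (valuedStructure em W) ⟪ φ ⟫ᴳ ρ ⇔ _)
        (sym (map-map⁺ {f = asValue} h e)) (⟪⟫ᴳ-correct em W φ _)))

proposition3p14 : (ℓ : Level) (em : ExcludedMiddle ℓ) (V W : ValuedVectorSpace ℓ)
    (ι : Extension (valuedStructure em V) (valuedStructure em W)) →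
    Elementary (valuedStructure em V) (valuedStructure em W) (Extension.map ι)
    ⇔
    (Elementary (fieldStructure (ValuedVectorSpace.K V)) (fieldStructure (ValuedVectorSpace.K W))
    (λ _ → Extension.map ι scalar)
    × Elementary (colouredOrder V) (colouredOrder W) (λ _ → Extension.map ι value))
proposition3p14 ℓ em V W ι = record
  { to = reducts ; from = converse ; to-cong = cong reducts ; from-cong = cong converse }
  where
  open Extension ι using (map)
  Reducts : Set ℓ
  Reducts =
    Elementary (fieldStructure (ValuedVectorSpace.K V)) (fieldStructure (ValuedVectorSpace.K W)) (λ _ → map scalar)
    × Elementary (colouredOrder V) (colouredOrder W) (λ _ → map value)
  reducts : Elementary (valuedStructure em V) (valuedStructure em W) map → Reducts
  reducts el = Interpretation.field-elementary em V W map el , Interpretation.order-elementary em V W map el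
  converse : Reducts → Elementary (valuedStructure em V) (valuedStructure em W) map
  converse els = Embedding.elementary em V W ι (proj₁ els) (proj₂ els)
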